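{- Let $\mathcal{N}$ be a near octagon of order $(2,4)$ containing a subgeometry isomorphic to the dual split Cayley hexagon $\mathrm{H}(2)^D$ that is isometrically embedded in $\mathcal{N}$. Then $\mathcal{N}$ is isomorphic to the Hall-Janko near octagon $\mathsf{HJ}$.
   Context: A partial linear space has order $(s,t)$ if every line has exactly $s+1$ points and every point is on exactly $t+1$ lines. Distances are measured in the collinearity graph. A near $2d$-gon is a partial linear space whose collinearity graph is connected of diameter $d$ and such that for every point $x$ and every line $L$ there is a unique point on $L$ nearest to $x$; a near octagon is a near $8$-gon. A subgeometry is isometrically embedded if distances between its points measured in it and in the ambient geometry coincide. $\mathrm{H}(2)^D$ is the point-line dual of the split Cayley hexagon $\mathrm{H}(2)$ of order $(2,2)$. The Hall-Janko near octagon $\mathsf{HJ}$ is the geometry whose points are the $315$ central involutions of the Hall-Janko group $J_2$ and whose lines are the triples $\{x,y,xy\}$ with $x,y$ distinct commuting central involutions; equivalently, it is the unique regular near octagon with parameters $(2,4;0,3)$. -}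

module Defs where

open import Data.Nat using (ℕ; zero; suc; _≤_; _<_; _≡ᵇ_)
open import Data.Bool using (Bool; true; false; _∨_)
open import Data.Fin using (Fin; toℕ)
open import Data.Vec using (Vec; _∷_; []; lookup)
open import Data.Product using (Σ; _×_; _,_)
open import Relation.Binary.PropositionalEquality using (_≡_)
open import Relation.Nullary using (¬_)
open import Function.Bundles using (_↔_; Inverse)

-- Point-line geometries (incidence structures).
-- Incidence is Bool-valued, so "the set of points on a line" is the
-- subtype  Σ Point (λ p → p I L)  with propositional second component.

record Geometry : Set₁ where
  field
    Point : Set
    Line  : Set
    inc   : Point → Line → Bool

module _ (G : Geometry) where
  open Geometry G

  _I_ : Point → Line → Set
  p I L = inc p L ≡ true

  PointsOn : Line → Set
  PointsOn L = Σ Point (λ p → p I L)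

  LinesThrough : Point → Set
  LinesThrough p = Σ Line (λ L → p I L)

  IsPartialLinearSpace : Set
  IsPartialLinearSpace =
    ∀ p q L M → ¬ (p ≡ q) → p I L → q I L → p I M → q I M → L ≡ M

  HasOrder : ℕ → ℕ → Set
  HasOrder s t =
    (∀ L → Fin (suc s) ↔ PointsOn L) × (∀ p → Fin (suc t) ↔ LinesThrough p)

  Collinear : Point → Point → Set
  Collinear x y = Σ Line (λ L → x I L × y I L)

  data Walk : ℕ → Point → Point → Set where
    here : ∀ {x} → Walk zero x x
    step : ∀ {n x y z} → Collinear x y → Walk n y z → Walk (suc n) x z

  Dist : Point → Point → ℕ → Set
  Dist x y n = Walk n x y × (∀ m → m < n → ¬ Walk m x y)

  IsNearPolygon : ℕ → Set
  IsNearPolygon d =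
    IsPartialLinearSpace
    × (∀ x y → Σ ℕ (λ n → n ≤ d × Walk n x y))
    × Σ Point (λ x → Σ Point (λ y → Dist x y d))
    × (∀ x L → Σ Point (λ p → p I L × Σ ℕ (λ k → Dist x p k
         × (∀ q → q I L → ¬ (q ≡ p) → ∀ m → Dist x q m → k < m))))

  IsNearOctagon : Set
  IsNearOctagon = IsNearPolygon 4

record IsometricSubgeometry (S N : Geometry) : Set where
  open Geometry
  field
    φ      : Point S → Point N
    ψ      : Line S → Line N
    φ-inj  : ∀ x y → φ x ≡ φ y → x ≡ y
    ψ-inj  : ∀ L M → ψ L ≡ ψ M → L ≡ M
    inc-eq : ∀ p L → inc S p L ≡ inc N (φ p) (ψ L)
    isom   : ∀ x y n → (Dist S x y n → Dist N (φ x) (φ y) n)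
                     × (Dist N (φ x) (φ y) n → Dist S x y n)

record Isomorphism (G H : Geometry) : Set where
  open Geometry
  field
    onPoints : Point G ↔ Point H
    onLines  : Line G ↔ Line H
    inc-eq   : ∀ p L → inc G p L ≡ inc H (Inverse.to onPoints p) (Inverse.to onLines L)

tableGeometry : (np nl : ℕ) → Vec (ℕ × ℕ × ℕ) nl → Geometry
tableGeometry np nl tbl = record
  { Point = Fin np
  ; Line  = Fin nl
  ; inc   = λ p L → member (toℕ p) (lookup tbl L)
  }
  where
  member : ℕ → ℕ × ℕ × ℕ → Bool
  member x (a , b , c) = (x ≡ᵇ a) ∨ (x ≡ᵇ b) ∨ (x ≡ᵇ c)

h2dLineTable : Vec (ℕ × ℕ × ℕ) 63
h2dLineTable =
  (0 , 1 , 2) ∷ (3 , 4 , 5) ∷ (6 , 7 , 8) ∷ (9 , 10 , 11) ∷ (12 , 13 , 14) ∷ (15 , 16 , 17) ∷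
  (18 , 19 , 20) ∷ (3 , 9 , 15) ∷ (3 , 21 , 22) ∷ (9 , 23 , 24) ∷ (15 , 25 , 26) ∷ (0 , 10 , 12) ∷
  (0 , 27 , 28) ∷ (10 , 29 , 30) ∷ (12 , 31 , 32) ∷ (6 , 11 , 18) ∷ (6 , 33 , 34) ∷ (11 , 35 , 36) ∷
  (18 , 37 , 38) ∷ (1 , 4 , 7) ∷ (1 , 39 , 40) ∷ (4 , 41 , 42) ∷ (7 , 43 , 44) ∷ (5 , 13 , 19) ∷
  (5 , 45 , 46) ∷ (13 , 47 , 48) ∷ (19 , 49 , 50) ∷ (2 , 16 , 20) ∷ (2 , 51 , 52) ∷ (16 , 53 , 54) ∷
  (20 , 55 , 56) ∷ (8 , 14 , 17) ∷ (8 , 57 , 58) ∷ (14 , 59 , 60) ∷ (17 , 61 , 62) ∷ (29 , 41 , 53) ∷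
  (35 , 42 , 61) ∷ (30 , 45 , 62) ∷ (36 , 46 , 54) ∷ (23 , 39 , 47) ∷ (36 , 40 , 59) ∷ (24 , 51 , 60) ∷
  (35 , 48 , 52) ∷ (30 , 43 , 55) ∷ (24 , 44 , 49) ∷ (29 , 50 , 57) ∷ (23 , 56 , 58) ∷ (21 , 27 , 33) ∷
  (28 , 46 , 58) ∷ (22 , 52 , 57) ∷ (34 , 45 , 51) ∷ (31 , 42 , 56) ∷ (37 , 41 , 60) ∷ (22 , 32 , 38) ∷
  (21 , 55 , 59) ∷ (25 , 40 , 50) ∷ (38 , 39 , 62) ∷ (26 , 28 , 37) ∷ (27 , 49 , 61) ∷ (32 , 44 , 54) ∷
  (26 , 43 , 48) ∷ (25 , 31 , 34) ∷ (33 , 47 , 53) ∷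
  []

hjLineTable : Vec (ℕ × ℕ × ℕ) 525
hjLineTable =
  (0 , 1 , 2) ∷ (0 , 15 , 16) ∷ (0 , 39 , 40) ∷ (0 , 295 , 296) ∷ (0 , 297 , 298) ∷ (1 , 3 , 4) ∷
  (1 , 21 , 22) ∷ (1 , 95 , 96) ∷ (1 , 97 , 98) ∷ (2 , 9 , 10) ∷ (2 , 51 , 52) ∷ (2 , 291 , 292) ∷
  (2 , 293 , 294) ∷ (3 , 11 , 12) ∷ (3 , 53 , 54) ∷ (3 , 91 , 92) ∷ (3 , 93 , 94) ∷ (4 , 17 , 18) ∷
  (4 , 45 , 46) ∷ (4 , 87 , 88) ∷ (4 , 89 , 90) ∷ (5 , 13 , 16) ∷ (5 , 17 , 19) ∷ (5 , 29 , 30) ∷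
  (5 , 207 , 208) ∷ (5 , 209 , 210) ∷ (6 , 8 , 18) ∷ (6 , 14 , 15) ∷ (6 , 25 , 26) ∷ (6 , 211 , 212) ∷
  (6 , 213 , 214) ∷ (7 , 10 , 19) ∷ (7 , 11 , 14) ∷ (7 , 57 , 58) ∷ (7 , 255 , 256) ∷ (7 , 257 , 258) ∷
  (8 , 9 , 20) ∷ (8 , 55 , 56) ∷ (8 , 215 , 216) ∷ (8 , 217 , 218) ∷ (9 , 59 , 60) ∷ (9 , 151 , 152) ∷
  (9 , 153 , 154) ∷ (10 , 41 , 42) ∷ (10 , 271 , 272) ∷ (10 , 273 , 274) ∷ (11 , 31 , 32) ∷ (11 , 235 , 236) ∷
  (11 , 237 , 238) ∷ (12 , 13 , 20) ∷ (12 , 37 , 38) ∷ (12 , 239 , 240) ∷ (12 , 241 , 242) ∷ (13 , 49 , 50) ∷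
  (13 , 279 , 280) ∷ (13 , 281 , 282) ∷ (14 , 47 , 48) ∷ (14 , 167 , 168) ∷ (14 , 169 , 170) ∷ (15 , 23 , 24) ∷
  (15 , 175 , 176) ∷ (15 , 177 , 178) ∷ (16 , 27 , 28) ∷ (16 , 247 , 248) ∷ (16 , 249 , 250) ∷ (17 , 43 , 44) ∷
  (17 , 107 , 108) ∷ (17 , 109 , 110) ∷ (18 , 61 , 62) ∷ (18 , 135 , 136) ∷ (18 , 137 , 138) ∷ (19 , 35 , 36) ∷
  (19 , 203 , 204) ∷ (19 , 205 , 206) ∷ (20 , 33 , 34) ∷ (20 , 191 , 192) ∷ (20 , 193 , 194) ∷ (21 , 36 , 56) ∷
  (21 , 48 , 50) ∷ (21 , 131 , 132) ∷ (21 , 133 , 134) ∷ (22 , 26 , 30) ∷ (22 , 34 , 58) ∷ (22 , 119 , 120) ∷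
  (22 , 121 , 122) ∷ (23 , 34 , 43) ∷ (23 , 41 , 54) ∷ (23 , 63 , 64) ∷ (23 , 65 , 66) ∷ (24 , 36 , 37) ∷
  (24 , 46 , 60) ∷ (24 , 171 , 172) ∷ (24 , 173 , 174) ∷ (25 , 35 , 53) ∷ (25 , 49 , 51) ∷ (25 , 227 , 230) ∷
  (25 , 228 , 229) ∷ (26 , 38 , 42) ∷ (26 , 303 , 305) ∷ (26 , 304 , 306) ∷ (27 , 53 , 59) ∷ (27 , 58 , 61) ∷
  (27 , 83 , 86) ∷ (27 , 84 , 85) ∷ (28 , 32 , 56) ∷ (28 , 42 , 45) ∷ (28 , 243 , 244) ∷ (28 , 245 , 246) ∷
  (29 , 47 , 52) ∷ (29 , 54 , 55) ∷ (29 , 223 , 226) ∷ (29 , 224 , 225) ∷ (30 , 31 , 60) ∷ (30 , 299 , 301) ∷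
  (30 , 300 , 302) ∷ (31 , 40 , 62) ∷ (31 , 283 , 284) ∷ (31 , 285 , 286) ∷ (32 , 43 , 51) ∷ (32 , 183 , 185) ∷
  (32 , 184 , 186) ∷ (33 , 35 , 40) ∷ (33 , 45 , 47) ∷ (33 , 187 , 188) ∷ (33 , 189 , 190) ∷ (34 , 111 , 112) ∷
  (34 , 113 , 114) ∷ (35 , 231 , 234) ∷ (35 , 232 , 233) ∷ (36 , 307 , 309) ∷ (36 , 308 , 310) ∷ (37 , 52 , 61) ∷
  (37 , 259 , 260) ∷ (37 , 261 , 262) ∷ (38 , 39 , 44) ∷ (38 , 159 , 161) ∷ (38 , 160 , 162) ∷ (39 , 55 , 57) ∷
  (39 , 155 , 158) ∷ (39 , 156 , 157) ∷ (40 , 287 , 288) ∷ (40 , 289 , 290) ∷ (41 , 50 , 62) ∷ (41 , 71 , 74) ∷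
  (41 , 72 , 73) ∷ (42 , 267 , 268) ∷ (42 , 269 , 270) ∷ (43 , 103 , 104) ∷ (43 , 105 , 106) ∷ (44 , 48 , 59) ∷
  (44 , 99 , 100) ∷ (44 , 101 , 102) ∷ (45 , 199 , 200) ∷ (45 , 201 , 202) ∷ (46 , 49 , 57) ∷ (46 , 195 , 196) ∷
  (46 , 197 , 198) ∷ (47 , 163 , 164) ∷ (47 , 165 , 166) ∷ (48 , 123 , 124) ∷ (48 , 125 , 126) ∷ (49 , 275 , 278) ∷
  (49 , 276 , 277) ∷ (50 , 127 , 129) ∷ (50 , 128 , 130) ∷ (51 , 179 , 182) ∷ (51 , 180 , 181) ∷ (52 , 263 , 264) ∷
  (52 , 265 , 266) ∷ (53 , 79 , 80) ∷ (53 , 81 , 82) ∷ (54 , 67 , 68) ∷ (54 , 69 , 70) ∷ (55 , 219 , 222) ∷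
  (55 , 220 , 221) ∷ (56 , 311 , 313) ∷ (56 , 312 , 314) ∷ (57 , 251 , 254) ∷ (57 , 252 , 253) ∷ (58 , 115 , 117) ∷
  (58 , 116 , 118) ∷ (59 , 75 , 76) ∷ (59 , 77 , 78) ∷ (60 , 147 , 148) ∷ (60 , 149 , 150) ∷ (61 , 139 , 140) ∷
  (61 , 141 , 142) ∷ (62 , 143 , 144) ∷ (62 , 145 , 146) ∷ (63 , 85 , 98) ∷ (63 , 123 , 138) ∷ (63 , 152 , 199) ∷
  (63 , 265 , 312) ∷ (64 , 76 , 87) ∷ (64 , 134 , 142) ∷ (64 , 164 , 217) ∷ (64 , 244 , 294) ∷ (65 , 156 , 209) ∷
  (65 , 233 , 239) ∷ (65 , 257 , 303) ∷ (65 , 276 , 285) ∷ (66 , 162 , 204) ∷ (66 , 229 , 237) ∷ (66 , 251 , 300) ∷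
  (66 , 282 , 287) ∷ (67 , 151 , 243) ∷ (67 , 182 , 190) ∷ (67 , 198 , 298) ∷ (67 , 281 , 286) ∷ (68 , 148 , 247) ∷
  (68 , 186 , 193) ∷ (68 , 200 , 293) ∷ (68 , 277 , 288) ∷ (69 , 109 , 122) ∷ (69 , 124 , 141) ∷ (69 , 160 , 258) ∷
  (69 , 211 , 309) ∷ (70 , 102 , 116) ∷ (70 , 133 , 137) ∷ (70 , 170 , 261) ∷ (70 , 203 , 305) ∷ (71 , 169 , 307) ∷
  (71 , 184 , 189) ∷ (71 , 218 , 266) ∷ (71 , 228 , 240) ∷ (72 , 84 , 88) ∷ (72 , 101 , 121) ∷ (72 , 147 , 297) ∷
  (72 , 210 , 254) ∷ (73 , 75 , 97) ∷ (73 , 110 , 118) ∷ (73 , 157 , 302) ∷ (73 , 197 , 248) ∷ (74 , 163 , 314) ∷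
  (74 , 179 , 194) ∷ (74 , 212 , 262) ∷ (74 , 232 , 238) ∷ (75 , 111 , 137) ∷ (75 , 176 , 200) ∷ (75 , 289 , 304) ∷
  (76 , 122 , 146) ∷ (76 , 188 , 213) ∷ (76 , 268 , 298) ∷ (77 , 180 , 205) ∷ (77 , 225 , 235) ∷ (77 , 252 , 261) ∷
  (77 , 281 , 311) ∷ (78 , 186 , 208) ∷ (78 , 221 , 241) ∷ (78 , 258 , 263) ∷ (78 , 275 , 308) ∷ (79 , 158 , 166) ∷
  (79 , 175 , 267) ∷ (79 , 197 , 294) ∷ (79 , 257 , 262) ∷ (80 , 162 , 169) ∷ (80 , 172 , 271) ∷ (80 , 199 , 297) ∷
  (80 , 253 , 264) ∷ (81 , 110 , 134) ∷ (81 , 112 , 145) ∷ (81 , 184 , 282) ∷ (81 , 215 , 301) ∷ (82 , 106 , 128) ∷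
  (82 , 121 , 138) ∷ (82 , 194 , 285) ∷ (82 , 207 , 313) ∷ (83 , 160 , 165) ∷ (83 , 193 , 299) ∷ (83 , 214 , 290) ∷
  (83 , 220 , 236) ∷ (84 , 105 , 133) ∷ (84 , 171 , 293) ∷ (84 , 206 , 278) ∷ (85 , 109 , 130) ∷ (85 , 181 , 310) ∷
  (85 , 198 , 272) ∷ (86 , 155 , 170) ∷ (86 , 187 , 306) ∷ (86 , 216 , 286) ∷ (86 , 224 , 242) ∷ (87 , 116 , 128) ∷
  (87 , 167 , 191) ∷ (87 , 247 , 271) ∷ (88 , 112 , 124) ∷ (88 , 151 , 175) ∷ (88 , 255 , 279) ∷ (89 , 158 , 182) ∷
  (89 , 226 , 234) ∷ (89 , 260 , 284) ∷ (89 , 305 , 313) ∷ (90 , 161 , 185) ∷ (90 , 222 , 230) ∷ (90 , 264 , 288) ∷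
  (90 , 301 , 309) ∷ (91 , 147 , 244) ∷ (91 , 176 , 272) ∷ (91 , 208 , 216) ∷ (91 , 303 , 307) ∷ (92 , 152 , 248) ∷
  (92 , 171 , 268) ∷ (92 , 204 , 212) ∷ (92 , 299 , 311) ∷ (93 , 105 , 146) ∷ (93 , 118 , 123) ∷ (93 , 155 , 263) ∷
  (93 , 189 , 276) ∷ (94 , 101 , 142) ∷ (94 , 111 , 130) ∷ (94 , 165 , 252) ∷ (94 , 179 , 287) ∷ (95 , 168 , 280) ∷
  (95 , 190 , 253) ∷ (95 , 203 , 215) ∷ (95 , 223 , 227) ∷ (96 , 166 , 277) ∷ (96 , 192 , 256) ∷ (96 , 207 , 211) ∷
  (96 , 219 , 231) ∷ (97 , 106 , 141) ∷ (97 , 159 , 283) ∷ (97 , 172 , 243) ∷ (98 , 102 , 145) ∷ (98 , 148 , 267) ∷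
  (98 , 183 , 259) ∷ (99 , 175 , 187) ∷ (99 , 195 , 217) ∷ (99 , 230 , 246) ∷ (99 , 282 , 310) ∷ (100 , 174 , 191) ∷
  (100 , 199 , 214) ∷ (100 , 233 , 249) ∷ (100 , 278 , 313) ∷ (101 , 224 , 257) ∷ (101 , 284 , 291) ∷ (102 , 236 , 264) ∷
  (102 , 274 , 300) ∷ (103 , 151 , 163) ∷ (103 , 196 , 213) ∷ (103 , 222 , 270) ∷ (103 , 258 , 302) ∷ (104 , 150 , 167) ∷
  (104 , 200 , 218) ∷ (104 , 225 , 273) ∷ (104 , 254 , 305) ∷ (105 , 232 , 281) ∷ (105 , 260 , 296) ∷ (106 , 240 , 288) ∷
  (106 , 250 , 308) ∷ (107 , 152 , 168) ∷ (107 , 173 , 188) ∷ (107 , 239 , 295) ∷ (107 , 263 , 283) ∷ (108 , 149 , 164) ∷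
  (108 , 176 , 192) ∷ (108 , 235 , 292) ∷ (108 , 259 , 287) ∷ (109 , 227 , 311) ∷ (109 , 251 , 269) ∷ (110 , 219 , 303) ∷
  (110 , 245 , 275) ∷ (111 , 168 , 195) ∷ (111 , 228 , 286) ∷ (112 , 149 , 214) ∷ (112 , 238 , 277) ∷ (113 , 157 , 203) ∷
  (113 , 224 , 269) ∷ (113 , 249 , 259) ∷ (113 , 293 , 314) ∷ (114 , 160 , 210) ∷ (114 , 219 , 274) ∷ (114 , 243 , 266) ∷
  (114 , 295 , 310) ∷ (115 , 153 , 231) ∷ (115 , 172 , 180) ∷ (115 , 213 , 285) ∷ (115 , 296 , 312) ∷ (116 , 166 , 241) ∷
  (116 , 209 , 270) ∷ (117 , 150 , 229) ∷ (117 , 178 , 183) ∷ (117 , 215 , 289) ∷ (117 , 294 , 308) ∷ (118 , 162 , 225) ∷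
  (118 , 202 , 280) ∷ (119 , 167 , 276) ∷ (119 , 171 , 185) ∷ (119 , 201 , 242) ∷ (119 , 250 , 265) ∷ (120 , 165 , 279) ∷
  (120 , 177 , 181) ∷ (120 , 196 , 237) ∷ (120 , 244 , 260) ∷ (121 , 154 , 290) ∷ (121 , 204 , 222) ∷ (122 , 156 , 273) ∷
  (122 , 216 , 234) ∷ (123 , 192 , 196) ∷ (123 , 220 , 262) ∷ (124 , 173 , 218) ∷ (124 , 242 , 253) ∷ (125 , 181 , 207) ∷
  (125 , 232 , 245) ∷ (125 , 273 , 283) ∷ (125 , 297 , 306) ∷ (126 , 184 , 206) ∷ (126 , 227 , 250) ∷ (126 , 267 , 290) ∷
  (126 , 292 , 302) ∷ (127 , 148 , 156) ∷ (127 , 177 , 223) ∷ (127 , 217 , 261) ∷ (127 , 291 , 304) ∷ (128 , 190 , 237) ∷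
  (128 , 205 , 246) ∷ (129 , 154 , 159) ∷ (129 , 174 , 221) ∷ (129 , 211 , 265) ∷ (129 , 298 , 300) ∷ (130 , 186 , 233) ∷
  (130 , 201 , 256) ∷ (131 , 147 , 161) ∷ (131 , 191 , 252) ∷ (131 , 202 , 238) ∷ (131 , 274 , 289) ∷ (132 , 153 , 157) ∷
  (132 , 189 , 255) ∷ (132 , 195 , 241) ∷ (132 , 268 , 284) ∷ (133 , 178 , 266) ∷ (133 , 208 , 230) ∷ (134 , 180 , 249) ∷
  (134 , 212 , 226) ∷ (135 , 155 , 183) ∷ (135 , 240 , 291) ∷ (135 , 248 , 256) ∷ (135 , 270 , 278) ∷ (136 , 159 , 179) ∷
  (136 , 236 , 296) ∷ (136 , 246 , 254) ∷ (136 , 272 , 280) ∷ (137 , 163 , 174) ∷ (137 , 231 , 299) ∷ (138 , 150 , 187) ∷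
  (138 , 223 , 307) ∷ (139 , 149 , 234) ∷ (139 , 194 , 304) ∷ (139 , 201 , 210) ∷ (139 , 271 , 275) ∷ (140 , 154 , 228) ∷
  (140 , 188 , 301) ∷ (140 , 197 , 205) ∷ (140 , 269 , 279) ∷ (141 , 158 , 235) ∷ (141 , 177 , 314) ∷ (142 , 169 , 221) ∷
  (142 , 185 , 295) ∷ (143 , 170 , 312) ∷ (143 , 173 , 226) ∷ (143 , 202 , 206) ∷ (143 , 247 , 251) ∷ (144 , 164 , 309) ∷
  (144 , 178 , 220) ∷ (144 , 198 , 209) ∷ (144 , 245 , 255) ∷ (145 , 153 , 306) ∷ (145 , 182 , 239) ∷ (146 , 161 , 292) ∷
  (146 , 193 , 229) ∷ (147 , 220 , 282) ∷ (148 , 242 , 313) ∷ (149 , 181 , 257) ∷ (150 , 206 , 264) ∷ (151 , 207 , 236) ∷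
  (152 , 184 , 224) ∷ (153 , 262 , 278) ∷ (154 , 253 , 310) ∷ (155 , 200 , 227) ∷ (156 , 192 , 308) ∷ (157 , 173 , 281) ∷
  (158 , 213 , 245) ∷ (159 , 196 , 311) ∷ (160 , 176 , 232) ∷ (161 , 218 , 275) ∷ (162 , 188 , 250) ∷ (163 , 205 , 284) ∷
  (164 , 186 , 274) ∷ (165 , 230 , 298) ∷ (166 , 249 , 304) ∷ (167 , 208 , 291) ∷ (168 , 180 , 300) ∷ (169 , 246 , 289) ∷
  (170 , 233 , 268) ∷ (171 , 228 , 258) ∷ (172 , 238 , 305) ∷ (174 , 210 , 288) ∷ (175 , 203 , 240) ∷ (177 , 254 , 286) ∷
  (178 , 277 , 302) ∷ (179 , 199 , 219) ∷ (182 , 217 , 269) ∷ (183 , 195 , 303) ∷ (185 , 214 , 251) ∷ (187 , 209 , 260) ∷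
  (189 , 222 , 294) ∷ (190 , 273 , 312) ∷ (191 , 204 , 296) ∷ (193 , 265 , 270) ∷ (194 , 225 , 244) ∷ (197 , 223 , 287) ∷
  (198 , 231 , 263) ∷ (201 , 283 , 307) ∷ (202 , 259 , 299) ∷ (211 , 239 , 271) ∷ (212 , 279 , 292) ∷ (215 , 235 , 247) ∷
  (216 , 255 , 295) ∷ (221 , 248 , 285) ∷ (226 , 276 , 297) ∷ (229 , 261 , 272) ∷ (234 , 252 , 293) ∷ (237 , 267 , 309) ∷
  (241 , 243 , 301) ∷ (256 , 290 , 314) ∷ (266 , 280 , 306) ∷
  []

H2D : Geometry
H2D = tableGeometry 63 63 h2dLineTable

-- HJ : Hall-Janko near octagon, 315 points (central involutions of J2),
-- 525 lines {x, y, xy}.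
HJ : Geometry
HJ = tableGeometry 315 525 hjLineTable

{-# OPTIONS --safe #-}

-- Distances to the copy H of H(2)^D turn a point x of N into a function on the 63 points of H that has a
-- unique minimum on every line, the other two values being one larger. Up to automorphisms and an additive
-- constant there are only four such functions (A: the distance from a point of H; B: those induced by the
-- points of HJ outside H; C: one zero, 22 ones; D: five zeros), found by an exhaustive search.
--
-- Type D cannot occur at distance 1: for some zero p, the third point on the line through x and p would have an
-- impossible function. Type C cannot occur either: its 16 ones not collinear with the zero would give
-- 16 different neighbours of x, and there are only 10. So points at distance 1 have type A or B.
--
-- If type B occurs, its values 2 force further points of type B, until all 252 of them are there; since
-- every point has only ten neighbours, N has no other points, and the adjacencies are those of HJ.
--
-- If only type A occurs at distance 1, the arguments above, shifted by one, show that there are no points at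
-- distance 2. Then the four lines on x other than that to its foot h lie over the three lines of H on h, so two
-- lie over the same one; x has two neighbours over the same point. Following such lines of H leads to a
-- point of N that is too close to both lines leaving H at some point, a contradiction.
module Submission where

-- The search treats only functions that vanish at point 0. Three involutions generate a transitive
-- group on H(2)^D, and composing the embedding with a word in them brings any zero to 0; this is
-- why the statements below are about arbitrary frames and not about one embedding. Distances 1 and
-- 2 are handled by a single argument, `Layer c`: the points closer to the copy are those of the
-- copy itself for `c = 0` and those of type A for `c = 1`. Distance 2 is then impossible because
-- each surviving type would take the value 5, more than the diameter. If type B occurs, distances
-- to the copy separate points, and neighbours are identified by elimination: vectors of adjacent
-- points differ by at most 1 everywhere, which leaves one candidate. If only type A occurs, all
-- points over the same point of the copy have equal vectors, and adjacency must be analysed by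
-- hand. What controls it is that three of the five lines on a point of the copy lie in the copy, so
-- that only two leave it.

open import Defs
open import Data.Bool using (Bool; true; false; if_then_else_; _∧_; _∨_; T)
open import Data.Empty using (⊥; ⊥-elim)
open import Data.Fin as Fin using (Fin; zero; suc; toℕ; fromℕ<; punchOut; combine)
open import Data.Fin.Patterns using (0F; 1F; 2F)
import Data.Fin.Properties as Fin
open import Data.List as List using (List; []; _∷_; _++_; map; applyUpTo; upTo; zipWith; concatMap; filter; length)
open import Data.List.Membership.Propositional using (_∈_; find; lose)
open import Data.List.Membership.Propositional.Properties
  using (∈-lookup; ∈-upTo⁻; ∈-upTo⁺; ∈-++⁻; ∈-map⁻; ∈-filter⁻; ∈-concatMap⁻)
open import Data.List.Properties using (≡-dec; length-applyUpTo; length-map)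
open import Data.List.Relation.Unary.All as All using (All; []; _∷_; all?)
open import Data.List.Relation.Unary.All.Properties using (¬Any⇒All¬) renaming (map⁺ to All-map⁺)
open import Data.List.Relation.Unary.AllPairs using (AllPairs; []; _∷_; allPairs?)
open import Data.List.Relation.Unary.Any using (Any; here; there; any?)
open import Data.List.Relation.Unary.Linked using (Linked; linked?)
open import Data.List.Relation.Unary.Linked.Properties using (Linked⇒AllPairs)
open import Data.List.Relation.Unary.Unique.Propositional using (Unique)
open import Data.List.Relation.Unary.Unique.Propositional.Properties using (upTo⁺; filter⁺)
open import Data.Maybe using (Maybe; just; nothing)
open import Data.Nat
  using (ℕ; zero; suc; _+_; _*_; _∸_; _⊔_; _≤_; _<_; z≤n; s≤s; pred; _≡ᵇ_; _<ᵇ_; NonZero)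
open import Data.Nat.DivMod using (_/_; _%_; _mod_; m<n⇒m%n≡m; m%n<n)
import Data.Nat.Properties as ℕ
open import Data.List.Membership.DecPropositional ℕ._≟_ using () renaming (_∈?_ to _∈ℕ?_)
open import Data.Product using (Σ; ∃; _×_; _,_; proj₁; proj₂)
open import Data.Product.Properties using () renaming (≡-dec to ×-≡-dec)
open import Data.Sum using (_⊎_; inj₁; inj₂)
open import Data.Vec using (Vec; []; _∷_; lookup; toList)
open import Function.Bundles using (Inverse; mk↔ₛ′)
open import Axiom.UniquenessOfIdentityProofs.WithK using (uip)
open import Relation.Binary.Definitions using (tri<; tri≈; tri>)
open import Relation.Binary.PropositionalEquality
  using (_≡_; _≢_; refl; sym; trans; cong; cong₂; subst; subst₂)
open import Relation.Nullary
  using (¬_; Dec; yes; no; does; contradiction; _×-dec_; _⊎-dec_; _→-dec_; ¬?)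
open import Relation.Nullary.Decidable using (map′)

-- Near octagons of order (2,4)

-- The values taken on a line with a unique nearest point.
data Near : ℕ → ℕ → ℕ → Set where
  near₁ : ∀ {k} → Near k (suc k) (suc k)
  near₂ : ∀ {k} → Near (suc k) k (suc k)
  near₃ : ∀ {k} → Near (suc k) (suc k) k

Near-swap₁₂ : ∀ {a b c} → Near a b c → Near b a c
Near-swap₁₂ near₁ = near₂
Near-swap₁₂ near₂ = near₁
Near-swap₁₂ near₃ = near₃

Near-swap₂₃ : ∀ {a b c} → Near a b c → Near a c b
Near-swap₂₃ near₁ = near₁
Near-swap₂₃ near₂ = near₃
Near-swap₂₃ near₃ = near₂

least : {P : ℕ → Set} → (∀ n → Dec (P n)) → ∀ n → P n →
        Σ ℕ λ m → P m × (∀ k → k < m → ¬ P k)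
least {P} P? n pn with search n
  where
  search : ∀ n → (Σ ℕ λ m → P m × (∀ k → k < m → ¬ P k)) ⊎ (∀ k → k < n → ¬ P k)
  search zero = inj₂ λ _ ()
  search (suc n) with search n
  ... | inj₁ found = inj₁ found
  ... | inj₂ none with P? n
  ...   | yes p = inj₁ (n , p , none)
  ...   | no ¬p = inj₂ below
    where
    below : ∀ k → k < suc n → ¬ P k
    below k (s≤s k≤n) with ℕ.m≤n⇒m<n∨m≡n k≤n
    ... | inj₁ k<n = none k k<n
    ... | inj₂ refl = ¬p
... | inj₁ found = found
... | inj₂ none = n , pn , none

AllPairs-lookup : ∀ {A : Set} {R : A → A → Set} {xs : List A} → AllPairs R xs →
                  ∀ i j → i Fin.< j → R (List.lookup xs i) (List.lookup xs j)
AllPairs-lookup {xs = _ ∷ xs} (r ∷ _) zero (suc j) _ = All.lookup r (∈-lookup j)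
AllPairs-lookup (_ ∷ rs) (suc i) (suc j) (s≤s i<j) = AllPairs-lookup rs i j i<j

module NearOctagon (N : Geometry) (oct : IsNearOctagon N) (order : HasOrder N 2 4) where
  open Geometry N

  linear : IsPartialLinearSpace N
  linear = proj₁ oct

  module OnLine (L : Line) where
    private module I = Inverse (proj₁ order L)

    point : Fin 3 → Point
    point i = proj₁ (I.to i)

    point-on : ∀ i → inc (point i) L ≡ true
    point-on i = proj₂ (I.to i)

    index : ∀ {p} → inc p L ≡ true → Fin 3
    index {p} pL = I.from (p , pL)

    point-index : ∀ {p} (pL : inc p L ≡ true) → point (index pL) ≡ p
    point-index pL = cong proj₁ (I.strictlyInverseˡ (_ , pL))

    index-injective : ∀ {p q} (pL : inc p L ≡ true) (qL : inc q L ≡ true) →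
                      index pL ≡ index qL → p ≡ q
    index-injective pL qL eq =
      trans (sym (point-index pL)) (trans (cong point eq) (point-index qL))

    index-cong : ∀ {p q} (pL : inc p L ≡ true) (qL : inc q L ≡ true) →
                 p ≡ q → index pL ≡ index qL
    index-cong pL qL refl = cong index (uip pL qL)

    point-injective : ∀ i j → point i ≡ point j → i ≡ j
    point-injective i j eq =
      trans (sym (I.strictlyInverseʳ i)) (trans (index-cong (point-on i) (point-on j) eq) (I.strictlyInverseʳ j))

    index-point : ∀ i → index (point-on i) ≡ i
    index-point = I.strictlyInverseʳ

    ≟-on : ∀ {p q} → inc p L ≡ true → inc q L ≡ true → Dec (p ≡ q)
    ≟-on pL qL = map′ (index-injective pL qL) (index-cong pL qL) (index pL Fin.≟ index qL)

  module Through (x : Point) where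
    private module I = Inverse (proj₂ order x)

    line : Fin 5 → Line
    line i = proj₁ (I.to i)

    on-line : ∀ i → inc x (line i) ≡ true
    on-line i = proj₂ (I.to i)

    index : ∀ {L} → inc x L ≡ true → Fin 5
    index {L} xL = I.from (L , xL)

    line-index : ∀ {L} (xL : inc x L ≡ true) → line (index xL) ≡ L
    line-index xL = cong proj₁ (I.strictlyInverseˡ (_ , xL))

    index-injective : ∀ {L M} (xL : inc x L ≡ true) (xM : inc x M ≡ true) →
                      index xL ≡ index xM → L ≡ M
    index-injective xL xM eq =
      trans (sym (line-index xL)) (trans (cong line eq) (line-index xM))

    line-injective : ∀ i j → line i ≡ line j → i ≡ j
    line-injective i j e = trans (sym (I.strictlyInverseʳ i)) (trans (index-cong (on-line i) (on-line j) e) (I.strictlyInverseʳ j))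
      where
      index-cong : ∀ {L M} (xL : inc x L ≡ true) (xM : inc x M ≡ true) → L ≡ M → index xL ≡ index xM
      index-cong xL xM refl = cong index (uip xL xM)

  opaque
    -- Equality of points is not assumed decidable, but on a single line it is, by the bijection
    -- with `Fin 3`. Take a line on `y` and its point nearest to `x`: if that distance is 0, then
    -- `x` is on the line too; otherwise `x` is off the line and differs from `y`.
    _≟ₚ_ : (x y : Point) → Dec (x ≡ y)
    x ≟ₚ y with proj₂ (proj₂ (proj₂ oct)) x (Through.line y zero)
    ... | p , pL , zero , (here , _) , _ = OnLine.≟-on _ pL (Through.on-line y zero)
    ... | p , pL , suc k , (_ , far) , nearest
      with OnLine.≟-on _ (Through.on-line y zero) pL
    ...   | yes refl = no λ { refl → far 0 (s≤s z≤n) here }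
    ...   | no y≢p = no λ { refl → ℕ.n≮0 (nearest y (Through.on-line y zero) y≢p 0 (here , λ _ ())) }

  Collinear-sym : ∀ {x y} → Collinear N x y → Collinear N y x
  Collinear-sym (L , xL , yL) = L , yL , xL

  snoc : ∀ {n x y z} → Walk N n x y → Collinear N y z → Walk N (suc n) x z
  snoc here c = step c here
  snoc (step c w) c′ = step c (snoc w c′)

  reverse : ∀ {n x y} → Walk N n x y → Walk N n y x
  reverse here = here
  reverse (step c w) = snoc (reverse w) (Collinear-sym c)

  -- A step chooses one of five lines and one of three points on it, so walks of a given length can
  -- be enumerated; this makes a shortest length available.
  walk? : ∀ n x y → Dec (Walk N n x y)
  walk? zero x y = map′ (λ { refl → here }) (λ { here → refl }) (x ≟ₚ y)
  walk? (suc n) x y =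
    map′ (λ { (i , j , w) → step (_ , Through.on-line x i , OnLine.point-on _ j) w })
         split
         (Fin.any? λ i → Fin.any? λ j → walk? n (OnLine.point (Through.line x i) j) y)
    where
    split : Walk N (suc n) x y → ∃ λ i → ∃ λ j → Walk N n (OnLine.point (Through.line x i) j) y
    split (step (L , xL , zL) w) = Through.index x xL , subst P (sym (Through.line-index x xL)) (OnLine.index L zL , subst (λ u → Walk N n u y) (sym (OnLine.point-index L zL)) w)
      where
      P : Line → Set
      P M = ∃ λ j → Walk N n (OnLine.point M j) y

  abstract
    shortest : ∀ x y → Σ ℕ λ n → Dist N x y n
    shortest x y = least (λ n → walk? n x y) _ (proj₂ (proj₂ (proj₁ (proj₂ oct) x y)))

  d : Point → Point → ℕ
  d x y = proj₁ (shortest x y)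

  d-Dist : ∀ x y → Dist N x y (d x y)
  d-Dist x y = proj₂ (shortest x y)

  d-walk : ∀ x y → Walk N (d x y) x y
  d-walk x y = proj₁ (d-Dist x y)

  d-min : ∀ {x y n} → Walk N n x y → d x y ≤ n
  d-min {x} {y} {n} w with d x y ℕ.≤? n
  ... | yes le = le
  ... | no nle = contradiction w (proj₂ (d-Dist x y) n (ℕ.≰⇒> nle))

  Dist⇒d : ∀ {x y n} → Dist N x y n → d x y ≡ n
  Dist⇒d {x} {y} {n} (w , far) with ℕ.<-cmp (d x y) n
  ... | tri≈ _ eq _ = eq
  ... | tri< lt _ _ = contradiction (d-walk x y) (far _ lt)
  ... | tri> _ _ gt = contradiction (d-min w) (ℕ.<⇒≱ gt)

  d≤4 : ∀ x y → d x y ≤ 4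
  d≤4 x y = let _ , n≤4 , w = proj₁ (proj₂ oct) x y in ℕ.≤-trans (d-min w) n≤4

  d-refl : ∀ x → d x x ≡ 0
  d-refl x = Dist⇒d (here , λ _ ())

  d≡0⇒≡ : ∀ {x y} → d x y ≡ 0 → x ≡ y
  d≡0⇒≡ {x} {y} eq with subst (λ n → Walk N n x y) eq (d-walk x y)
  ... | here = refl

  d-sym : ∀ x y → d x y ≡ d y x
  d-sym x y = ℕ.≤-antisym (d-min (reverse (d-walk y x))) (d-min (reverse (d-walk x y)))

  d-step : ∀ {x y} z → Collinear N x y → d x z ≤ suc (d y z)
  d-step z c = d-min (step c (d-walk _ z))

  opaque
    d-path : ∀ {x z n} → d x z ≡ suc n → ∃ λ y → Collinear N x y × d y z ≡ n
    d-path {x} {z} {n} eq with subst (λ m → Walk N m x z) eq (d-walk x z)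
    ... | step {y = y} c w = y , c , ℕ.≤-antisym (d-min w) (ℕ.≤-pred (ℕ.≤-trans (ℕ.≤-reflexive (sym eq)) (d-step z c)))

  record Line₃ (x y z : Point) : Set where
    constructor line₃
    field
      {through} : Line
      on₁ : inc x through ≡ true
      on₂ : inc y through ≡ true
      on₃ : inc z through ≡ true
      ne₁₂ : x ≢ y
      ne₁₃ : x ≢ z
      ne₂₃ : y ≢ z

  open Line₃ public

  rotate : ∀ {x y z} → Line₃ x y z → Line₃ y z x
  rotate (line₃ a b c p q r) = line₃ b c a r (λ e → p (sym e)) (λ e → q (sym e))

  flip : ∀ {x y z} → Line₃ x y z → Line₃ y x z
  flip (line₃ a b c p q r) = line₃ b a c (λ e → p (sym e)) r q

  private
    third₃ : ∀ (i j : Fin 3) → i ≢ j → ∃ λ k → i ≢ k × j ≢ k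
    third₃ zero zero n = contradiction refl n
    third₃ zero (suc zero) _ = suc (suc zero) , (λ ()) , λ ()
    third₃ zero (suc (suc zero)) _ = suc zero , (λ ()) , λ ()
    third₃ (suc zero) zero _ = suc (suc zero) , (λ ()) , λ ()
    third₃ (suc zero) (suc zero) n = contradiction refl n
    third₃ (suc zero) (suc (suc zero)) _ = zero , (λ ()) , λ ()
    third₃ (suc (suc zero)) zero _ = suc zero , (λ ()) , λ ()
    third₃ (suc (suc zero)) (suc zero) _ = zero , (λ ()) , λ ()
    third₃ (suc (suc zero)) (suc (suc zero)) n = contradiction refl n

    cover₃ : ∀ (i j k l : Fin 3) → i ≢ j → i ≢ k → j ≢ k → l ≢ i → l ≢ j → l ≢ k → ⊥
    cover₃ i j k l p q r s t u with Fin.pigeonhole (ℕ.≤-refl {4}) (List.lookup (i ∷ j ∷ k ∷ l ∷ []))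
    ... | a , b , a<b , e = AllPairs-lookup {R = _≢_} {xs = i ∷ j ∷ k ∷ l ∷ []}
      ((p ∷ q ∷ (λ e → s (sym e)) ∷ []) ∷ (r ∷ (λ e → t (sym e)) ∷ []) ∷ ((λ e → u (sym e)) ∷ []) ∷ [] ∷ [])
      a b a<b e

  complete : ∀ {x y} → Collinear N x y → x ≢ y → ∃ λ z → Line₃ x y z
  complete {x} {y} (L , xL , yL) x≢y =
    let open OnLine L
        k , i≢k , j≢k = third₃ (index xL) (index yL) (λ e → x≢y (index-injective xL yL e))
    in point k , line₃ xL yL (point-on k) x≢y
         (λ e → i≢k (trans (index-cong xL (point-on k) e) (index-point k)))
         (λ e → j≢k (trans (index-cong yL (point-on k) e) (index-point k)))

  opaque
    others : ∀ {x L} → inc x L ≡ true → ∃ λ y → ∃ λ z → Σ (Line₃ x y z) λ ℓ → through ℓ ≡ L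
    others {x} {L} xL =
      let j , i≢j , _ = third₃ i (other i) (other-≢ i)
          k , i≢k , j≢k = third₃ i j i≢j
      in point j , point k ,
         line₃ xL (point-on j) (point-on k) (off i≢j) (off i≢k) (λ e → j≢k (point-injective j k e)) , refl
      where
      open OnLine L
      i : Fin 3
      i = index xL
      other : Fin 3 → Fin 3
      other zero = suc zero
      other (suc _) = zero
      other-≢ : ∀ i → i ≢ other i
      other-≢ zero ()
      other-≢ (suc _) ()
      off : ∀ {k} → i ≢ k → x ≢ point k
      off {k} i≢k e = i≢k (trans (index-cong xL (point-on k) e) (index-point k))

  line₃-cover : ∀ {x y z} (ℓ : Line₃ x y z) {u} → inc u (through ℓ) ≡ true →
                (u ≡ x) ⊎ (u ≡ y) ⊎ (u ≡ z)
  line₃-cover {x} {y} {z} ℓ@(line₃ {L} xL yL zL x≢y x≢z y≢z) {u} uL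
    with u ≟ₚ x | u ≟ₚ y | u ≟ₚ z
  ... | yes e | _ | _ = inj₁ e
  ... | _ | yes e | _ = inj₂ (inj₁ e)
  ... | _ | _ | yes e = inj₂ (inj₂ e)
  ... | no p | no q | no r = ⊥-elim (cover₃ (index xL) (index yL) (index zL) (index uL)
      (λ e → x≢y (index-injective xL yL e)) (λ e → x≢z (index-injective xL zL e))
      (λ e → y≢z (index-injective yL zL e)) (λ e → p (index-injective uL xL e))
      (λ e → q (index-injective uL yL e)) (λ e → r (index-injective uL zL e)))
    where open OnLine L

  opaque
    near : ∀ {a b c} → Line₃ a b c → ∀ x → Near (d x a) (d x b) (d x c)
    near {a} {b} {c} ℓ@(line₃ {L} aL bL cL a≢b a≢c b≢c) x with proj₂ (proj₂ (proj₂ oct)) x L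
    ... | p , pL , k , Dxp , nearest = cases (line₃-cover ℓ pL)
      where
      atp : ∀ {q} → p ≡ q → d x q ≡ k
      atp refl = Dist⇒d Dxp

      off : ∀ {q} → inc q L ≡ true → q ≢ p → d x q ≡ suc k
      off {q} qL q≢p = ℕ.≤-antisym (d-min (snoc (proj₁ Dxp) (L , pL , qL)))
                                 (nearest q qL q≢p _ (d-Dist x q))

      cases : (p ≡ a) ⊎ (p ≡ b) ⊎ (p ≡ c) → Near (d x a) (d x b) (d x c)
      cases (inj₁ refl) rewrite atp {a} refl | off bL (λ e → a≢b (sym e)) | off cL (λ e → a≢c (sym e)) = near₁
      cases (inj₂ (inj₁ refl)) rewrite atp {b} refl | off aL a≢b | off cL (λ e → b≢c (sym e)) = near₂
      cases (inj₂ (inj₂ refl)) rewrite atp {c} refl | off aL a≢c | off bL b≢c = near₃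

  near′ : ∀ {a b c} → Line₃ a b c → ∀ x → Near (d a x) (d b x) (d c x)
  near′ {a} {b} {c} ℓ x rewrite d-sym a x | d-sym b x | d-sym c x = near ℓ x

  Adj : Point → Point → Set
  Adj x y = d x y ≡ 1

  Adj-sym : ∀ {x y} → Adj x y → Adj y x
  Adj-sym {x} {y} e = trans (d-sym y x) e

  Adj⇒≢ : ∀ {x y} → Adj x y → x ≢ y
  Adj⇒≢ {x} e refl with trans (sym e) (d-refl x)
  ... | ()

  opaque
    Adj⇒Collinear : ∀ {x y} → Adj x y → Collinear N x y
    Adj⇒Collinear {x} {y} e with d-path {x} {y} e
    ... | z , c , dz with d≡0⇒≡ dz
    ...   | refl = c

  opaque
    line-of : ∀ {x y} → Adj x y → ∃ λ z → Line₃ x y z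
    line-of e = complete (Adj⇒Collinear e) (Adj⇒≢ e)

  opaque
    Collinear⇒Adj : ∀ {x y} → Collinear N x y → x ≢ y → Adj x y
    Collinear⇒Adj {x} {y} c x≢y with d x y in eq | d-min (step c here)
    ... | zero | _ = contradiction (d≡0⇒≡ eq) x≢y
    ... | suc zero | _ = refl
    ... | suc (suc _) | s≤s ()

  adj₁₂ : ∀ {x y z} → Line₃ x y z → Adj x y
  adj₁₂ ℓ = Collinear⇒Adj (through ℓ , on₁ ℓ , on₂ ℓ) (ne₁₂ ℓ)

  adj₁₃ : ∀ {x y z} → Line₃ x y z → Adj x z
  adj₁₃ ℓ = Collinear⇒Adj (through ℓ , on₁ ℓ , on₃ ℓ) (ne₁₃ ℓ)

  adj₂₃ : ∀ {x y z} → Line₃ x y z → Adj y z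
  adj₂₃ ℓ = Collinear⇒Adj (through ℓ , on₂ ℓ , on₃ ℓ) (ne₂₃ ℓ)

  Adj-step : ∀ {x y} → Adj x y → ∀ z → d x z ≤ suc (d y z)
  Adj-step e z = d-step z (Adj⇒Collinear e)

  opaque
    neighbour-towards : ∀ {x z n} → d x z ≡ suc n → ∃ λ y → Adj x y × d y z ≡ n
    neighbour-towards {x} {z} {n} e with d-path {x} {z} e
    ... | y , c , dy = y , Collinear⇒Adj c x≢y , dy
      where
      x≢y : x ≢ y
      x≢y refl with trans (sym e) dy
      ... | ()

  opaque
    -- Two points of a line at equal distance from `x` make the third the nearest one, one step
    -- closer; here that is distance 0.
    no-triangle : ∀ {x y z w} → Line₃ y z w → Adj x y → Adj x z → x ≡ w
    no-triangle {x} {y} {z} {w} ℓ xy xz with d x y | d x z | d x w in eq | near ℓ x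
    no-triangle ℓ refl refl | _ | _ | zero | near₃ = d≡0⇒≡ eq

  opaque
    third-unique : ∀ {x y z w} → Line₃ x y z → Line₃ x y w → z ≡ w
    third-unique ℓ m = no-triangle m (Adj-sym (adj₁₃ ℓ)) (Adj-sym (adj₂₃ ℓ))

  opaque
    neighbour-index : ∀ {x y} → Adj x y → ∃ λ i → ∃ λ j → OnLine.point (Through.line x i) j ≡ y
    neighbour-index {x} {y} xy = locate (Adj⇒Collinear xy)
      where
      Q : Line → Set
      Q L = ∃ λ j → OnLine.point L j ≡ y

      locate : Collinear N x y → ∃ λ i → Q (Through.line x i)
      locate (L , xL , yL) = Through.index x xL , subst Q (sym (Through.line-index x xL)) (OnLine.index L yL , OnLine.point-index L yL)

  module Neighbours (x : Point) where
    code : ∀ {y} → Collinear N x y → Fin 5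
    code (_ , xL , _) = Through.index x xL

    code-injective : ∀ {y z} (c : Collinear N x y) (c′ : Collinear N x z) →
                     code c ≡ code c′ → proj₁ c ≡ proj₁ c′
    code-injective (_ , xL , _) (_ , xM , _) = Through.index-injective x xL xM

    apart : ∀ {y} (c : Collinear N x y) → x ≢ y →
            OnLine.index (proj₁ c) (proj₁ (proj₂ c)) ≢ OnLine.index (proj₁ c) (proj₂ (proj₂ c))
    apart (L , xL , yL) x≢y e = x≢y (OnLine.index-injective L xL yL e)

    -- Ten is five lines times the two positions left on a line once `punchOut` has removed that of
    -- `x`.
    code₁₀ : ∀ {y} → Collinear N x y → x ≢ y → Fin 10
    code₁₀ c x≢y = combine (code c) (punchOut (apart c x≢y))

    code₁₀-injective : ∀ {y z} (c : Collinear N x y) (c′ : Collinear N x z)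
                       (x≢y : x ≢ y) (x≢z : x ≢ z) → code₁₀ c x≢y ≡ code₁₀ c′ x≢z → y ≡ z
    code₁₀-injective {y} {z} c c′ x≢y x≢z e =
      let e₁ , e₂ = Fin.combine-injective (code c) (punchOut (apart c x≢y)) (code c′) (punchOut (apart c′ x≢z)) e
      in same c c′ (apart c x≢y) (apart c′ x≢z) (code-injective c c′ e₁) e₂
      where
      same : (c : Collinear N x y) (c′ : Collinear N x z)
             (p : OnLine.index (proj₁ c) (proj₁ (proj₂ c)) ≢ OnLine.index (proj₁ c) (proj₂ (proj₂ c)))
             (q : OnLine.index (proj₁ c′) (proj₁ (proj₂ c′)) ≢ OnLine.index (proj₁ c′) (proj₂ (proj₂ c′))) →
             proj₁ c ≡ proj₁ c′ → punchOut p ≡ punchOut q → y ≡ z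
      same (L , xL , yL) (.L , xL′ , zL) p q refl e with uip xL xL′
      ... | refl = OnLine.index-injective L yL zL (Fin.punchOut-injective p q e)

    opaque
      neighbours≤10 : ∀ (ys : List Point) → All (Adj x) ys → AllPairs _≢_ ys → length ys ≤ 10
      neighbours≤10 ys adj distinct with length ys ℕ.≤? 10
      ... | yes le = le
      ... | no nle =
        let i , j , i<j , e = Fin.pigeonhole (ℕ.≰⇒> nle) (λ i → code₁₀ (joined i) (distinct-from i))
        in contradiction (code₁₀-injective (joined i) (joined j) (distinct-from i) (distinct-from j) e)
                         (AllPairs-lookup distinct i j i<j)
        where
        joined : ∀ i → Collinear N x (List.lookup ys i)
        joined i = Adj⇒Collinear (All.lookup adj (∈-lookup i))
        distinct-from : ∀ i → x ≢ List.lookup ys i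
        distinct-from i = Adj⇒≢ (All.lookup adj (∈-lookup i))

    opaque
      all-neighbours : ∀ (ys : List Point) → All (Adj x) ys → AllPairs _≢_ ys → length ys ≡ 10 →
                       ∀ {y} → Adj x y → y ∈ ys
      all-neighbours ys adj distinct ten {y} xy with any? (y ≟ₚ_) ys
      ... | yes y∈ = y∈
      ... | no y∉ = contradiction (neighbours≤10 (y ∷ ys) (xy ∷ adj) (¬Any⇒All¬ ys y∉ ∷ distinct))
                      (ℕ.<⇒≱ (s≤s (ℕ.≤-reflexive (sym ten))))

    opaque
      -- Different neighbours on the same line through `x` are adjacent, so these use different
      -- lines among the five.
      non-collinear≤5 : ∀ (ys : List Point) → All (Adj x) ys →
                        AllPairs (λ y z → y ≢ z × ¬ Adj y z) ys → length ys ≤ 5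
      non-collinear≤5 ys adj non-adjacent with length ys ℕ.≤? 5
      ... | yes le = le
      ... | no nle =
        let i , j , i<j , e = Fin.pigeonhole (ℕ.≰⇒> nle) (λ i → code (joined i))
            y≢z , ¬yz = AllPairs-lookup non-adjacent i j i<j
            M , _ , zM = joined j
            yM = subst (λ L → inc (List.lookup ys i) L ≡ true) (code-injective (joined i) (joined j) e) (proj₂ (proj₂ (joined i)))
        in ⊥-elim (¬yz (Collinear⇒Adj (M , yM , zM) y≢z))
        where
        joined : ∀ i → Collinear N x (List.lookup ys i)
        joined i = Adj⇒Collinear (All.lookup adj (∈-lookup i))

-- Valuations of H(2)^D

by : ∀ {P : Set} (P? : Dec P) → does P? ≡ true → P
by (yes p) _ = p

-- Finite functions are lists, read with nth; indices out of range give 0.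
nth : List ℕ → ℕ → ℕ
nth [] _ = 0
nth (x ∷ _) zero = x
nth (_ ∷ xs) (suc n) = nth xs n

digits : ∀ b .{{_ : NonZero b}} → ℕ → ℕ → List ℕ
digits b zero n = []
digits b (suc k) n = n % b ∷ digits b k (n / b)

Triple : Set
Triple = ℕ × ℕ × ℕ

lines : List Triple
lines = toList h2dLineTable

On : (ℕ → ℕ → ℕ → Set) → (ℕ → ℕ) → Triple → Set
On R f (a , b , c) = R (f a) (f b) (f c)

Valid : (ℕ → ℕ) → Set
Valid f = All (On Near f) lines

Near-resp : ∀ {a b c a′ b′ c′} → a ≡ a′ → b ≡ b′ → c ≡ c′ → Near a b c → Near a′ b′ c′
Near-resp refl refl refl n = n

near? : ∀ a b c → Dec (Near a b c)
near? a b c = map′ to from ((b ℕ.≟ suc a ×-dec c ℕ.≟ suc a) ⊎-dec ((a ℕ.≟ suc b ×-dec c ℕ.≟ suc b) ⊎-dec (a ℕ.≟ suc c ×-dec b ℕ.≟ suc c)))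
  where
  to : (b ≡ suc a × c ≡ suc a) ⊎ (a ≡ suc b × c ≡ suc b) ⊎ (a ≡ suc c × b ≡ suc c) → Near a b c
  to (inj₁ (refl , refl)) = near₁
  to (inj₂ (inj₁ (refl , refl))) = near₂
  to (inj₂ (inj₂ (refl , refl))) = near₃
  from : Near a b c → (b ≡ suc a × c ≡ suc a) ⊎ (a ≡ suc b × c ≡ suc b) ⊎ (a ≡ suc c × b ≡ suc c)
  from near₁ = inj₁ (refl , refl)
  from near₂ = inj₂ (inj₁ (refl , refl))
  from near₃ = inj₂ (inj₂ (refl , refl))

valid? : ∀ f → Dec (Valid f)
valid? f = all? (λ (a , b , c) → near? (f a) (f b) (f c)) lines

-- Meaningful only if the values differ by at most 1 and are not both 0.
third : ℕ → ℕ → ℕ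
third a b = if a ≡ᵇ b then pred a else a ⊔ b

private
  ≡ᵇ-refl : ∀ n → (n ≡ᵇ n) ≡ true
  ≡ᵇ-refl zero = refl
  ≡ᵇ-refl (suc n) = ≡ᵇ-refl n

  ≡ᵇ-suc : ∀ n → (n ≡ᵇ suc n) ≡ false
  ≡ᵇ-suc zero = refl
  ≡ᵇ-suc (suc n) = ≡ᵇ-suc n

  suc-≡ᵇ : ∀ n → (suc n ≡ᵇ n) ≡ false
  suc-≡ᵇ zero = refl
  suc-≡ᵇ (suc n) = suc-≡ᵇ n

Near⇒third : ∀ {a b c} → Near a b c → third a b ≡ c
Near⇒third {a} near₁ rewrite ≡ᵇ-suc a = ℕ.m≤n⇒m⊔n≡n (ℕ.n≤1+n a)
Near⇒third {_} {b} near₂ rewrite suc-≡ᵇ b = ℕ.m≥n⇒m⊔n≡m (ℕ.n≤1+n b)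
Near⇒third {suc a} near₃ rewrite ≡ᵇ-refl a = refl

permutations : Triple → List Triple
permutations (a , b , c) =
  (a , b , c) ∷ (a , c , b) ∷ (b , a , c) ∷ (b , c , a) ∷ (c , a , b) ∷ (c , b , a) ∷ []

flags : List Triple
flags = concatMap permutations lines

_∈?_ : (t : Triple) (ts : List Triple) → Dec (t ∈ ts)
t ∈? ts = any? (×-≡-dec ℕ._≟_ (×-≡-dec ℕ._≟_ ℕ._≟_) t) ts

Valid⇒flags : ∀ {f} → Valid f → All (On Near f) flags
Valid⇒flags = go _
  where
  go : ∀ {f} ls → All (On Near f) ls → All (On Near f) (concatMap permutations ls)
  go [] [] = []
  go ((a , b , c) ∷ ls) (n ∷ ns) =
    n ∷ Near-swap₂₃ n ∷ Near-swap₁₂ n ∷ Near-swap₂₃ (Near-swap₁₂ n) ∷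
    Near-swap₁₂ (Near-swap₂₃ n) ∷ Near-swap₁₂ (Near-swap₂₃ (Near-swap₁₂ n)) ∷ go ls ns

nth-applyUpTo : ∀ f n {p} → p < n → nth (applyUpTo f n) p ≡ f p
nth-applyUpTo f (suc n) {zero} _ = refl
nth-applyUpTo f (suc n) {suc p} (s≤s p<n) = nth-applyUpTo (λ i → f (suc i)) n p<n

applyUpTo-cong : ∀ {f g : ℕ → ℕ} n → (∀ {p} → p < n → f p ≡ g p) → applyUpTo f n ≡ applyUpTo g n
applyUpTo-cong zero _ = refl
applyUpTo-cong (suc n) e = cong₂ _∷_ (e (s≤s z≤n)) (applyUpTo-cong n (λ p<n → e (s≤s p<n)))

lines<63 : All (On (λ a b c → a < 63 × b < 63 × c < 63) (λ p → p)) lines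
lines<63 = by (all? (λ (a , b , c) → a ℕ.<? 63 ×-dec (b ℕ.<? 63 ×-dec c ℕ.<? 63)) lines) refl

Valid-cong : ∀ {f g} → (∀ {p} → p < 63 → f p ≡ g p) → Valid f → Valid g
Valid-cong {f} {g} e v = go lines lines<63 v
  where
  go : ∀ ls → All (On (λ a b c → a < 63 × b < 63 × c < 63) (λ p → p)) ls → All (On Near f) ls → All (On Near g) ls
  go [] [] [] = []
  go (_ ∷ ls) ((a , b , c) ∷ bs) (n ∷ ns) = Near-resp (e a) (e b) (e c) n ∷ go ls bs ns

-- A partial function on the points of H(2)^D.
Env : Set
Env = List (ℕ × ℕ)

valueAt : ℕ → Env → Maybe ℕ
valueAt p [] = nothing
valueAt p ((q , v) ∷ e) = if p ≡ᵇ q then just v else valueAt p e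

Agrees : (ℕ → ℕ) → Env → Set
Agrees f = All (λ (p , v) → f p ≡ v)

valueAt-agrees : ∀ {f e} p {v} → Agrees f e → valueAt p e ≡ just v → f p ≡ v
valueAt-agrees p {v} (_∷_ {x = q , _} eq ag) found with p ≡ᵇ q in p≡q
valueAt-agrees p (eq ∷ ag) refl | true rewrite ℕ.≡ᵇ⇒≡ p _ (subst T (sym p≡q) _) = eq
valueAt-agrees p (eq ∷ ag) found | false = valueAt-agrees p ag found

-- Exhaustive search for valuations

module Search (n : ℕ) {A : List ℕ → Set} (accept? : ∀ v → Dec (A v)) where

  value : Maybe ℕ → ℕ
  value (just v) = v
  value nothing = 0

  defined : Maybe ℕ → Bool
  defined (just _) = true
  defined nothing = false

  allBelow : ℕ → (ℕ → Bool) → Bool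
  allBelow zero _ = true
  allBelow (suc n) P = P n ∧ allBelow n P

  -- Runs through the lines, extending the partial function in all possible ways, and tests
  -- whether all the resulting valuations are accepted.
  solve : List Triple → Env → Bool
  solve₃ : List Triple → Env → Triple → Maybe ℕ → Maybe ℕ → Maybe ℕ → Bool
  branch : List Triple → Env → Triple → ℕ → Bool

  solve [] e = allBelow n (λ p → defined (valueAt p e)) ∧ does (accept? (applyUpTo (λ p → value (valueAt p e)) n))
  solve ((a , b , c) ∷ ls) e = solve₃ ls e (a , b , c) (valueAt a e) (valueAt b e) (valueAt c e)

  -- On a line with impossible values the answer is `true`: no valuation extends `e`, so there is
  -- nothing to accept.
  solve₃ ls e (a , b , c) (just x) (just y) (just z) = if does (near? x y z) then solve ls e else true
  solve₃ ls e (a , b , c) (just x) (just y) nothing =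
    if does (near? x y (third x y)) then solve ls ((c , third x y) ∷ e) else true
  solve₃ ls e (a , b , c) (just x) nothing nothing =
    solve ls ((b , suc x) ∷ (c , suc x) ∷ e) ∧ branch ls e (a , b , c) x
  -- Lines met in any other state of knowledge count as failure; `search` confirms that the order of
  -- `program` avoids them.
  solve₃ ls e t _ _ _ = false

  -- No point of the line can be nearer than one with value 0.
  branch ls e t zero = true
  branch ls e (a , b , c) (suc x) =
    solve ls ((b , x) ∷ (c , suc x) ∷ e) ∧ solve ls ((b , suc x) ∷ (c , x) ∷ e)

  private
    ∧-true : ∀ {a b} → a ∧ b ≡ true → a ≡ true × b ≡ true
    ∧-true {true} {true} _ = refl , refl

    guard : ∀ {P : Set} {b} (P? : Dec P) → P → (if does P? then b else true) ≡ true → b ≡ true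
    guard (yes _) _ eq = eq
    guard (no ¬p) p _ = contradiction p ¬p

    allBelow-sound : ∀ n P → allBelow n P ≡ true → ∀ {p} → p < n → P p ≡ true
    allBelow-sound (suc n) P eq (s≤s p≤n) with ∧-true eq | ℕ.m≤n⇒m<n∨m≡n p≤n
    ... | e₁ , e₂ | inj₁ p<n = allBelow-sound n P e₂ p<n
    ... | e₁ , e₂ | inj₂ refl = e₁

  -- The induction follows the one path in the search tree along which all chosen values are those
  -- of `f`; it ends at the table of `f`.
  solve-sound : ∀ {f} ls e → All (On Near f) ls → Agrees f e → solve ls e ≡ true → A (applyUpTo f n)
  solve-sound₃ : ∀ {f} ls e t → On Near f t → All (On Near f) ls → Agrees f e → ∀ {x y z} →
                 (∀ v → x ≡ just v → f (proj₁ t) ≡ v) → (∀ v → y ≡ just v → f (proj₁ (proj₂ t)) ≡ v) →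
                 (∀ v → z ≡ just v → f (proj₂ (proj₂ t)) ≡ v) →
                 solve₃ ls e t x y z ≡ true → A (applyUpTo f n)
  solve-sound {f} [] e [] ag s with ∧-true s
  ... | s₁ , s₂ = subst A (applyUpTo-cong n same) (by (accept? _) s₂)
    where
    same : ∀ {p} → p < n → value (valueAt p e) ≡ f p
    same {p} p<n with valueAt p e in found | allBelow-sound n (λ p → defined (valueAt p e)) s₁ p<n
    ... | just v | _ = sym (valueAt-agrees p ag found)
    ... | nothing | ()
  solve-sound ((a , b , c) ∷ ls) e (r ∷ ns) ag s =
    solve-sound₃ ls e (a , b , c) r ns ag
      (λ _ → valueAt-agrees a ag) (λ _ → valueAt-agrees b ag) (λ _ → valueAt-agrees c ag) s

  solve-sound₃ ls e (a , b , c) r ns ag {just x} {just y} {just z} X Y Z s =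
    solve-sound ls e ns ag (guard (near? x y z) (Near-resp (X x refl) (Y y refl) (Z z refl) r) s)
  solve-sound₃ {f} ls e (a , b , c) r ns ag {just x} {just y} {nothing} X Y Z s =
    solve-sound ls _ ns (sym eq ∷ ag) (guard (near? x y (third x y)) (Near-resp (X x refl) (Y y refl) (sym eq) r) s)
    where
    eq : third x y ≡ f c
    eq = Near⇒third (Near-resp (X x refl) (Y y refl) refl r)
  solve-sound₃ {f} ls e (a , b , c) r ns ag {just x} {nothing} {nothing} X Y Z s
    with ∧-true {solve ls ((b , suc x) ∷ (c , suc x) ∷ e)} s | f a | f b in eb | f c in ec | X x refl | r
  ... | s₁ , _ | _ | _ | _ | refl | near₁ = solve-sound ls _ ns (eb ∷ ec ∷ ag) s₁
  ... | _ , s₂ | _ | _ | _ | refl | near₂ = solve-sound ls _ ns (eb ∷ ec ∷ ag) (proj₁ (∧-true s₂))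
  ... | _ , s₂ | _ | _ | _ | refl | near₃ = solve-sound ls _ ns (eb ∷ ec ∷ ag) (proj₂ (∧-true s₂))

-- Tables

-- Entry j holds the distances from the HJ point j to the 63 points of a fixed copy of H(2)^D in HJ,
-- as decimal digits: the lowest digit belongs to point 0. The copy consists of the HJ points 0, …, 62.
labelTable : List ℕ
labelTable =
  323323333322323323333322323332222211233332233323221212323323110 ∷
  233233333322233233222211232333333322323233233323332323212212101 ∷
  332332222211332332333322333223333322332323122212332323323323011 ∷
  322333233233333322221122323233323233333322323332323332212101212 ∷
  333322322333322333112222333322232333232333332233233233101212212 ∷
  233332231223323323122332122323013333322312332323221323323332332 ∷
  123232213232232321213232233323330133233332233233332212323233332 ∷
  332332331033232123232132322321232132333232233212323323332323233 ∷
  232123103333332332212323332332321232233221122323233323323332233 ∷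
  333223112222223333322333223333322333333232011212323233332233122 ∷
  223333221122333223233233332332233233223333122101233332233332122 ∷
  321232232132233233331033213232322123232333332323233323323212323 ∷
  212323123223322333330133322123213232323233233233332233323212323 ∷
  323323122332233332231223233212103333213223233332221323332323332 ∷
  232321322123123232322123323332331033323323323323332212233323332 ∷
  233332323233233332323233332233221122332233332332221101332332221 ∷
  332233232333332233232333233323112222323323323233110212233233221 ∷
  322333321232212323013333232333122332231223323323332332212323323 ∷
  233233212323321232103333323233231223122332233332323323212323323 ∷
  333223330133323212123223231232123223332323233212332233323233233 ∷
  323212013333333223321232333223212323322132122323332332233323233 ∷
  232132322333123223333301231223323233213232323332233233323323212 ∷
  123223233233232132333310122332232333322123332233323332323323212 ∷
  332323233332323233233332332233332233221122332221332110332221332 ∷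
  323233332323332323332323221122332233332233221332332011221332332 ∷
  122323322321333310323332232312321223322333323233323323332122233 ∷
  13333323332323221322321123223231232333223332122233323233233323 ∷
  332233333223221122323332333232223333233233212233101323233122332 ∷
  221122323332332233333223322333223333332332323122011323122233332 ∷
  233221322312232333233332123232123232333301332332332332233221233 ∷
  122332332323333232233221013333122323233212221233332233332332323 ∷
  231223333232332323322132103333233212122323221332233233332323332 ∷
  330133323221323332232123212323333223231232332233122332233323233 ∷
  333301122323233212332332322333323212232123233233233332122233332 ∷
  232312123232322123232321233332323323331033233332323221233332323 ∷
  233212231232333301233323321223232312233233323323323233233122332 ∷
  322123321223232312232312330133233323323332332323233122332233323 ∷
  213232232312321223321223331033323332233323332233323122332323233 ∷
  103333233323212332231232232132322321332332323122233233233323332 ∷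
  213223323233213223232333323221333310232321323233332323332332221 ∷
  322312232333322312323233212332333301123232332332332323233233221 ∷
  223333332233232333323323323323323323112222233110233221233221233 ∷
  112222332233323332332332233233332332223333233011122332122332233 ∷
  321223232321213232123232323323233332330133323332233221323332233 ∷
  212332332332103333122323333232233221321232212233323332323233332 ∷
  222211233323233323223333333322333223333223332122122233011323323 ∷
  333322333232333232223333222211323332323332221233233122110323323 ∷
  333310233212122323333223233233232123323212323233233323122332233 ∷
  323221333223013333233212332323322132212323212332323323233233323 ∷
  232333233221233221332323333301212332212332332332332233221233233 ∷
  333232233332122332322312322312213223103333323221332332332332323 ∷
  231232333310322321233233323212322333321223233323233332332233122 ∷
  322321333301231232322333232123233233232312233323323233233332122 ∷
  233323332332222211332233332323332323333322212332212332323011323 ∷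
  333232323323333322332233233332233332222211323221323221323110323 ∷
  322132213223323233323323232321232321333310233332233332332221332 ∷
  331033212332233323323212321232332332322321233233122233233332323 ∷
  323233322132322132333232333310323221323221332323323233221332332 ∷
  233323232123331033323221233221333232232132323323212332332233323 ∷
  323332223333112222233323223333333232322333101323212233332122233 ∷
  232333223333223333333232112222233323233323110323323122221233233 ∷
  323332323212330133212332322132332323123223323332212233323233233 ∷
  332323323323231223213223213223322312013333332221323332323332332 ∷
  443233334423233344324433443344443344332233233332323221233332323 ∷
  443332324433332344334423443344443344332233323332233221323332233 ∷
  233434343243434323342343323323233332332233443332443221443332443 ∷
  323434342343434332343243233332323323332233443332443221443332443 ∷
  443323334432444433443344324433324433333322233332233332332221332 ∷
  442333234433444433443344334423334423333322332332332332233221233 ∷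
  324343433234232333233332342343342343333322434332434332434221434 ∷
  234343432334323233323323343243343243333322434332434332434221434 ∷
  332323323323343432432334432334433234223333344221344332344332344 ∷
  334444443344323344334432334432234433223333332221323332323332332 ∷
  334444443344333244234433234433334432223333323221332332332332323 ∷
  333232233332343423433234433234432334223333344221344332344332344 ∷
  234433334444223333324433334444443323333244212332323323233233323 ∷
  334423334444223333334432334444442333233344212233323332323233332 ∷
  433243332332223333343234333232324343433423212434323344443233344 ∷
  432343333223223333342334332323234343433432212434323344443233344 ∷
  334432443233333322443344443233443332444433323233323323332122233 ∷
  324433443323333322443344443332443233444433323323323233233122332 ∷
  342334323443333322233323233434323434233233323443323443434122434 ∷
  343234233443333322323332323434233434322333323443323443434122434 ∷
  323332234334332233433243234343332323344332323344212434344233443 ∷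
  443344442333332233334423443323334444332344323332212233323233233 ∷
  443344443332332233234433442333334444323344323323212332332233323 ∷
  233323324334332233432343324343333232344323323344212434344233443 ∷
  444433233344333244223333444433333244323344323323332332212323323 ∷
  444433333244233344223333444433323344333244233332323323212323323 ∷
  233233433432433423223333323233343432343423443344344344212323323 ∷
  322333433423433432223333232333343423343432443344344344212323323 ∷
  233344323344444433332233332344233344444433332323233323323212323 ∷
  333244332344444433332233233344332344444433233233332233323212323 ∷
  433423344323233233332233434323434332232333434443434443323212323 ∷
  433432344332322333332233434332434323323233434443434443323212323 ∷
  344323322333344332333322343432323233434323344434443434323323212 ∷
  344332233233344323333322343423232333434332344434443434323323212 ∷
  323344444433332344333322323344444433332344323332233233323323212 ∷
  332344444433323344333322333244444433233344332233323332323323212 ∷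
  323323323443214432233434442333323332432343323344233323332344443 ∷
  323233233443214423233434443323332332432343323344332233233344443 ∷
  323443443233212344233332324343344332332323323332434443434323233 ∷
  323443443323213244233233234343344332232333323323434443434332323 ∷
  332332333232324343234343234433342343441232233233344332332443344 ∷
  232333323332324343234343334432343243441223332323344332233443344 ∷
  432334343432323323233323433234324433231244434443323332434323332 ∷
  432334343432322333232333432334334423321244434443332332434233323 ∷
  433423332323323434122344323344233233342334233434443233323434332 ∷
  433432232333323434123244333244233323342334332434443323323434233 ∷
  333244432343323332124432343432233443322333434233323443323332434 ∷
  233344432343323233124423343423233443332332434332233443323233434 ∷
  343423234343333232323332324433433234322144323443434332332323434 ∷
  343423234343233233333232334423432334232144332443434332323233434 ∷
  333223232333433234343432343243334432442123344233332332344443233 ∷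
  323323233323433234343432342343234433442132344323233332344443332 ∷
  343234333232442123434332323332442333343243233434323233443344332 ∷
  334432343234322144332332344332234343323233434233323443323332434 ∷
  342334323233442132434332332332443323343243332434323323443344233 ∷
  324433343234232144233332344332324343333223434332323443233323434 ∷
  232333344323343243442321233323333244433234443344332233233434323 ∷
  233332344332343243443221233233323344433234443344233323332434323 ∷
  234334332344323233324421233443343423333232233332434443434233323 ∷
  234334323344333223234421233443343432233233323323434443434332323 ∷
  434332234334123244323323443233433243323332323443434332332323434 ∷
  434332324334122344332323443332433243323233323443434233323332434 ∷
  233332443332124423344323323434233233323434323323233434344344332 ∷
  332332442333124432344323233434333223323434323233332434344344233 ∷
  234343324433233443433423333223323332214423332332443323443443233 ∷
  443323342343233233333223433423324334212344434332233443323233434 ∷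
  324343334423233443433423233323322333214432233332443233443443332 ∷
  442333343243233323233323433423324334213244434332323443233323434 ∷
  323233233344234334443212332332434323324343332323344344233434323 ∷
  333223333244234334442312322333434332324343233233344344332434323 ∷
  343243433423233332324412342334233344322333434443323323434332323 ∷
  343243433432232333234412342334332344323323434443332332434233323 ∷
  332344323233432343212344434323332332233443344233332434323434233 ∷
  323344323332432343213244434332322333233443344323233434323434332 ∷
  344332323434332323214423233344342334233233323443434233323332434 ∷
  344323323434232333214432332344342334233323332443434332323233434 ∷
  234433233323441223323443333223233434234334332323323344233344344 ∷
  334423332323441232323443233233323434234334233233323344332344344 ∷
  433243434323231244323233433243443332232333434443323323434332323 ∷
  432343434323321244323323433243443233233332434443323332434323332 ∷
  443233432334342334324334323332333223124423443332332233233443443 ∷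
  443332433234342334324334322333233323124432443332233323332443443 ∷
  233434334432322333322333324334433423123244233332434443434233323 ∷
  323434234433332332323332324334433423122344323332434443434323233 ∷
  323344334444334444443323223333324433334432221332233233332323332 ∷
  333244334444334444442333223333334432324433221233332233332332323 ∷
  343432333232332323234343223333342334343234221434434233332344344 ∷
  343423332323333232324343223333343234342334221434434233332344344 ∷
  443332223333334444333244334444233344442333122323233323323332233 ∷
  442333223333334444233344334444333244443323122323332332233323233 ∷
  234334223333333223433423333223433432234343122323434344443344233 ∷
  324334223333332332433432332332433423324343122323434344443344233 ∷
  322333434323323332323344434332443221343432434344323434233323332 ∷
  324334233344324334343432332332234421323332332323443332443443332 ∷
  324334332344324334343423233332324421333232233332443233443443332 ∷
  323332434332322333333244434332442321343432434344233434323233332 ∷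
  213244334432323443322333323233433432323443233233344344332434323 ∷
  214432343234323323342343343243233332443233434233323323344332443 ∷
  212344324433323443332323333223433432233443332233344344323434233 ∷
  214423342334323233342343343243333232443323434233332332344233443 ∷
  443221332323233434324334323344343234332323233332344233233443344 ∷
  442321323323233434234334332344343234233323332323344332233443344 ∷
  324421344323233332443332344332323233434323434344323434233323332 ∷
  234421344323233233442333344323333232434323434344332434233233323 ∷
  343432233233234343333232334423232144432334332434443323323434233 ∷
  343432333232234343233233234433322144433234233434443323332434323 ∷
  323332433234232333433234432343442123334432434332233323344233443 ∷
  333232433234233323433234433243442132234433434233323323344332443 ∷
  332344443233443332443332332233443344443344332233323122332323233 ∷
  233344443332443233443233332233443344443344332323233122332233323 ∷
  434323323434233434233434332233323332233323332443443122332443443 ∷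
  434332233434323434323434332233233323323332332443443122332443443 ∷
  334423332344324433332344443344332233443344233233332212323233332 ∷
  324433233344334423233344443344332233443344323323332212233323332 ∷
  343243434332342343434332323332332233323323443443332212443443332 ∷
  342343434323343243434323233323332233233332443443332212443443332 ∷
  322333234421433432323344434323433423332332344332344443233323233 ∷
  342343442321333232344323233323333244432334323434332233443344233 ∷
  342343443221233332344332332323233344432334332434323323443344233 ∷
  332323324421433432332344434323433432232333344233344443323332233 ∷
  231244434332433243323233323233443332342343443344233323332434323 ∷
  441223332332234433343234323434324334332323233332233443344233344 ∷
  321244434332432343333232323332442333342343443344233233323434332 ∷
  441232233332334423343234323434234334322333323323233443344332344 ∷
  234412233434323323323443333244233323343234332344323323233344443 ∷
  324412233434332323233443233344332323343234323344332233233344443 ∷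
  442312233233344323443323433423434323333232344332344443233323233 ∷
  443212233332344323443233433432434323323233344323344443233332323 ∷
  434323122344324334332323443332323233433243233434443233323434332 ∷
  434323123244234334232333442333323332433243233434443323332434323 ∷
  332323124423443332432343234334323434233233233233323443344332344 ∷
  233323124432442333432343324334323434333223233332233443344233344 ∷
  232333324343324343332323333322433243433243332344344233221434434 ∷
  323233234343234343333232333322432343432343332344344233221434434 ∷
  444433442333442333334444333322334423334423332332332233221233233 ∷
  444433443323443323334444333322234433234433332323323233221332332 ∷
  333322334432324433334444444433442333443332233233233332122233332 ∷
  333322324433334432334444444433443332442333323233233323122332233 ∷
  333322343234342334332332322333234334324334443233233344122434434 ∷
  333322342334343234333223233233324334234334443233233344122434434 ∷
  234334321244434323232333342343233332443233344323443323434332323 ∷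
  324334231244434323233332342343232333443332344323443332434323332 ∷
  443332441232332323234334322333234334323434323323233344332344344 ∷
  442333441223233323234334332323234334233434332323323344233344344 ∷
  343243332332234433233233233434122344433423233434332434434233323 ∷
  342343322333334432233323233434123244433423323434332434434323233 ∷
  334423342334433234233443233233124432233323443233332332332443443 ∷
  324433342334432334233443233332124423333223443332332233233443443 ∷
  234343323323343432322333342334231244324433344323443323434332323 ∷
  234343322333343432323323343234321244334423344332443323434323233 ∷
  233323324343333232324343324433441232342343323344233323332344443 ∷
  232333324343323332324343334432441223343243332344323323233344443 ∷
  343234212344443233323233233443332323344332233434332434434233323 ∷
  343234213244443323323332323443232333344332233434323434434323332 ∷
  333232214432323443323434443233432343323332233233344332332443344 ∷
  323233214423233443323434443323432343332332233332344233233443344 ∷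
  233233323332434323234433343432343432443221344323344443233332323 ∷
  433243324334233344433234333232323332234421332443323323443332443 ∷
  433243324334332344432334323332333232324421323443332233443332443 ∷
  333223322333434332334432343432343432442321344233344443323332233 ∷
  344332433423343432324433232333233323324412443443443323332332323 ∷
  332332333223323344342343234343234343443212233233323443344332344 ∷
  323332233323333244343243234343234343442312323323233443344332344 ∷
  344332433423343423334423233323232333234412443443443233323332332 ∷
  233233433432234421234433343423332332433423434344332434233233323 ∷
  233434333232442321432343323323432334333244233332434233443233344 ∷
  233434233332443221433243333223432334233344332323434332443233344 ∷
  233332433432324421334423343423232333433432434344233434323233332 ∷
  344323332323443212324433232333343423344332233434434344332233323 ∷
  323323342343234412343234432334323323332344434332233323344233443 ∷
  332323342343324412342334432334333223323344434233332332344233443 ∷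
  344323322333442312334432332332343423344323332434434344323233233 ∷
  432343323233332344232144324343333232343423323434332434434323233 ∷
  432343333223323344322144324343233233343432233434323434434323332 ∷
  332323343243344332442132322333433234323344443233344332332323434 ∷
  232333343243344323442123323323433234333244443332344233233323434 ∷
  323434233332433423231244433234322333233344344323443332434323332 ∷
  323434232333433432321244433234323323332344344332443323434323233 ∷
  323332234334333244441223233233324343434332323344233344332323434 ∷
  323233234334233344441232333232324343434323332344323344233323434 ∷
  332233334423443344442333233344334444443233233233122233233332323 ∷
  332233234433443344443332333244334444443323332233122332233323233 ∷
  332233433243233323234334433423332332233443434233122434233344443 ∷
  332233432343323332324334433432333223323443434233122434233344443 ∷
  443344323344443344333244334432223333234433332323221323323332332 ∷
  443344333244443344323344324433223333334432233332221323332323332 ∷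
  233332343432323323343423343234223333433234434344221323344344332 ∷
  323323343423233332343432342334223333432334434344221323344344332 ∷
  332344433243433243234343234421332332233332443233332332332443443 ∷
  434332233233333223443323443221434332434332323434434344332323233 ∷
  434323333223233233442333442321434332434332233434434344332233323 ∷
  233344433243433243324343324421233332332332443332233323332443443 ∷
  443323322144343234333223433432323233234343344323233434323434332 ∷
  443233232144343234323233433432333223324343344323332434233434323 ∷
  233443442132323233343243333232343243443323332323434332443233344 ∷
  323443442123333232343243233332343243442333323323434233443332344 ∷
  322333343423432334232333232144334423343234443344332233233434323 ∷
  323323343423432334332332322144234433342334443344233233323434332 ∷
  324343323323332332432334442132433243324433323323434233443332344 ∷
  324343333223232333432334442123432343334432233332434233443233344 ∷
  433432443212332323233344323233344332343423323434434344332323233 ∷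
  433432442312322333333244333232344323343423332434434344323233233 ∷
  333232234412342343433432343234332344323323344233332332344443233 ∷
  233332324412342343433423343234323344333223344332233323344443233 ∷
  223333443344234433443233332344443323334444332122233323233233323 ∷
  223333443344334423443323323344443233334444323122233233233323332 ∷
  223333323332432343233443344332323443333223344122233443233443344 ∷
  223333233323433243323443344323233443332332344122233443233443344 ∷
  334444332233442333332344443323332344334444233212332233323233233 ∷
  334444332233443332323344443233323344334444233212323323332323233 ∷
  333223332233234334344332323443344332332323233212344443344443233 ∷
  332332332233324334344323233443344323333232233212344443344443233 ∷
  323344323332332332233434442312323443323443323323233344332344344 ∷
  343423344332344332443332324412323233323323443443443332332323332 ∷
  343432344332344332443233234412323323323233443443443323332332323 ∷
  333244332332323332323434443212323443323443233233323344332344344 ∷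
  334432233233342343332332344323212344324334344233332434323434233 ∷
  234433233323343243322333344323213244324334344323332434233434323 ∷
  433234233443334423342334323323214432322333323443332233443332443 ∷
  432334233443324433342334332323214423323332332443332332443233443 ∷
  322333443323233434233233212344344323233434332323344344233434323 ∷
  332332442333323434333223213244344323233434332233344344323434233 ∷
  342334234343443233433243214423332323233332332443332332443233443 ∷
  342334324343443332433243214432323323233233332443323323443332443 ∷
  433423343432433423233344323233324412233323443443443332332323332 ∷
  433423343423433423332344323323234412232333443443443233323332332 ∷
  233323323344333223434323323443443212234343323323233434344344332 ∷
  333223333244233323434332323443442312234343233233323434344344332 ∷
  233443333322323443322333324334233233323434233323443434434434122 ∷
  323443333322233443233233234334322333233434233323443434434434122 ∷
  443233333322443323444433443332444433443233233323323233233332122 ∷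
  443323333322443233444433442333444433443332233323233332332233122 ∷
  432334323233432334232333432343333322343243344434332323434434221 ∷
  433234232333433234323233433243333322342343344434332323434434221 ∷
  234433444433234433444433334423333322334423332332332323233233221 ∷
  334432444433334432444433234433333322324433323233332323332332221 ∷
  233233233434443323323332123244233434344323332344323344233323434 ∷
  233443443332324343344332124432233233323323332323443332443443332 ∷
  233323323434442333332332122344233434344323332344233344323233434 ∷
  233443443233234343344332124423233332332323332332443323443443233 ∷
  122344433243434332233332232333342343443332443233344332332323434 ∷
  124432234433332332433432234334332323324334323233332434344344233 ∷
  123244432343434332333232233332342343442333443233344233323332434 ∷
  124423334423233332433432234334322333234334233233323434344344332 ∷
  233233432334343423323323321244343234334423443332344233233323434 ∷
  433234232333333223343423441223334432432343323434332233443344233 ∷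
  333232432334343423333223231244342334234433443233344233323332434 ∷
  433234332332323323343423441232324433433243233434323233443344332 ∷
  322144323443334432233323232333323443433432323344233344332323434 ∷
  442123323323343234434323432343443233233332344323233332344443332 ∷
  232144323443324433332323332323233443433432332344233344323233434 ∷
  442132323233342334434323432343443323333232344332233323344443233 ∷ []

-- For each point h of H(2)^D its image in HJ, followed by the four HJ points outside the copy collinear with it.
fibreTable : List (ℕ × ℕ × ℕ × ℕ × ℕ)
fibreTable =
  (0 , 295 , 296 , 297 , 298) ∷ (1 , 95 , 96 , 97 , 98) ∷ (2 , 291 , 292 , 293 , 294) ∷
  (54 , 67 , 68 , 69 , 70) ∷ (3 , 91 , 92 , 93 , 94) ∷ (53 , 79 , 80 , 81 , 82) ∷
  (46 , 195 , 196 , 197 , 198) ∷ (4 , 87 , 88 , 89 , 90) ∷ (45 , 199 , 200 , 201 , 202) ∷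
  (23 , 63 , 64 , 65 , 66) ∷ (15 , 175 , 176 , 177 , 178) ∷ (24 , 171 , 172 , 173 , 174) ∷
  (16 , 247 , 248 , 249 , 250) ∷ (27 , 83 , 86 , 84 , 85) ∷ (28 , 243 , 244 , 245 , 246) ∷
  (41 , 71 , 74 , 72 , 73) ∷ (10 , 271 , 272 , 273 , 274) ∷ (42 , 267 , 268 , 269 , 270) ∷
  (60 , 147 , 148 , 149 , 150) ∷ (59 , 75 , 76 , 77 , 78) ∷ (9 , 151 , 152 , 153 , 154) ∷
  (55 , 219 , 222 , 220 , 221) ∷ (29 , 223 , 226 , 224 , 225) ∷ (34 , 111 , 112 , 113 , 114) ∷
  (43 , 103 , 104 , 105 , 106) ∷ (50 , 127 , 129 , 128 , 130) ∷ (62 , 143 , 144 , 145 , 146) ∷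
  (39 , 155 , 158 , 156 , 157) ∷ (40 , 287 , 288 , 289 , 290) ∷ (14 , 167 , 168 , 169 , 170) ∷
  (6 , 211 , 212 , 213 , 214) ∷ (13 , 279 , 280 , 281 , 282) ∷ (5 , 207 , 208 , 209 , 210) ∷
  (57 , 251 , 254 , 252 , 253) ∷ (49 , 275 , 278 , 276 , 277) ∷ (37 , 259 , 260 , 261 , 262) ∷
  (36 , 307 , 309 , 308 , 310) ∷ (31 , 283 , 284 , 285 , 286) ∷ (30 , 299 , 301 , 300 , 302) ∷
  (22 , 119 , 120 , 121 , 122) ∷ (21 , 131 , 132 , 133 , 134) ∷ (11 , 235 , 236 , 237 , 238) ∷
  (12 , 239 , 240 , 241 , 242) ∷ (18 , 135 , 136 , 137 , 138) ∷ (17 , 107 , 108 , 109 , 110) ∷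
  (25 , 227 , 230 , 228 , 229) ∷ (35 , 231 , 234 , 232 , 233) ∷ (58 , 115 , 117 , 116 , 118) ∷
  (61 , 139 , 140 , 141 , 142) ∷ (44 , 99 , 100 , 101 , 102) ∷ (48 , 123 , 124 , 125 , 126) ∷
  (51 , 179 , 182 , 180 , 181) ∷ (52 , 263 , 264 , 265 , 266) ∷ (7 , 255 , 256 , 257 , 258) ∷
  (19 , 203 , 204 , 205 , 206) ∷ (8 , 215 , 216 , 217 , 218) ∷ (20 , 191 , 192 , 193 , 194) ∷
  (47 , 163 , 164 , 165 , 166) ∷ (33 , 187 , 188 , 189 , 190) ∷ (56 , 311 , 313 , 312 , 314) ∷
  (32 , 183 , 185 , 184 , 186) ∷ (38 , 159 , 161 , 160 , 162) ∷ (26 , 303 , 305 , 304 , 306) ∷ []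

-- The valuations with a unique zero, at point 0, that are not induced by points of HJ.
exceptionalTable : List ℕ
exceptionalTable =
  221221212122221221121222121222222211212122212122221212221221110 ∷
  222121121222222121212122122122222211211222212122221212221221110 ∷
  121222212122121222121222221212222211222112221221221212122122110 ∷
  122122121222122122212122222112222211221212221221221212122122110 ∷ []

-- Three involutory automorphisms of H(2)^D, in base 100; they generate a transitive group.
involutionTable : List ℕ
involutionTable =
  623824091348121004075251263757080545412932441517614903223406423130431918502560143511002827390140235856215559475333465436021620 ∷
  176132220140040351343654504911060216240942315708141252355333604115250027102944075921051913624530381837482643392347205655465828 ∷
  545300011819060762611312502948353832304333274036462839473142453444493741262510110504085758161715025251232409205556222103145960 ∷
  []

-- For each point h a word in these involutions mapping 0 to h; see act.
wordTable : List ℕ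
wordTable =
  0 ∷ 32321 ∷ 2121 ∷ 13231 ∷ 21232 ∷ 21 ∷ 2131 ∷ 31313 ∷ 31 ∷ 12321 ∷ 313 ∷ 21312 ∷ 232 ∷
  323231 ∷ 32121 ∷ 12312 ∷ 2323 ∷ 1231 ∷ 131213 ∷ 12 ∷ 1 ∷ 121312 ∷ 321 ∷ 132121 ∷ 13 ∷ 23132 ∷
  2313 ∷ 31213 ∷ 2 ∷ 3132 ∷ 3213 ∷ 21213 ∷ 23 ∷ 3123 ∷ 321213 ∷ 1321 ∷ 3231 ∷ 32 ∷ 3121 ∷ 231 ∷
  2312 ∷ 1213 ∷ 123 ∷ 13132 ∷ 213 ∷ 323 ∷ 121 ∷ 131 ∷ 1312 ∷ 132 ∷ 12313 ∷ 3232 ∷ 23231 ∷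
  313121 ∷ 23232 ∷ 1313 ∷ 1232 ∷ 312 ∷ 232321 ∷ 2321 ∷ 3 ∷ 13121 ∷ 21231 ∷ []

-- The lines of H(2)^D in an order that leaves few branches in the search for valuations vanishing at 0.
program : List (ℕ × ℕ × ℕ)
program =
  (0 , 1 , 2) ∷ (0 , 10 , 12) ∷ (0 , 27 , 28) ∷ (2 , 16 , 20) ∷ (16 , 53 , 54) ∷ (20 , 55 , 56) ∷
  (56 , 23 , 58) ∷ (28 , 58 , 46) ∷ (46 , 54 , 36) ∷ (23 , 39 , 47) ∷ (1 , 39 , 40) ∷
  (36 , 40 , 59) ∷ (55 , 59 , 21) ∷ (21 , 27 , 33) ∷ (33 , 47 , 53) ∷ (53 , 29 , 41) ∷
  (10 , 29 , 30) ∷ (30 , 55 , 43) ∷ (30 , 45 , 62) ∷ (45 , 46 , 5) ∷ (39 , 62 , 38) ∷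
  (5 , 3 , 4) ∷ (3 , 21 , 22) ∷ (1 , 4 , 7) ∷ (4 , 41 , 42) ∷ (7 , 43 , 44) ∷ (42 , 56 , 31) ∷
  (12 , 31 , 32) ∷ (22 , 32 , 38) ∷ (32 , 44 , 54) ∷ (58 , 8 , 57) ∷ (7 , 8 , 6) ∷
  (6 , 33 , 34) ∷ (29 , 57 , 50) ∷ (22 , 57 , 52) ∷ (2 , 52 , 51) ∷ (34 , 45 , 51) ∷
  (40 , 50 , 25) ∷ (25 , 31 , 34) ∷ (52 , 35 , 48) ∷ (35 , 36 , 11) ∷ (10 , 11 , 9) ∷
  (3 , 9 , 15) ∷ (15 , 16 , 17) ∷ (9 , 23 , 24) ∷ (15 , 25 , 26) ∷ (26 , 43 , 48) ∷
  (6 , 11 , 18) ∷ (18 , 20 , 19) ∷ (18 , 38 , 37) ∷ (26 , 28 , 37) ∷ (5 , 19 , 13) ∷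
  (13 , 47 , 48) ∷ (12 , 13 , 14) ∷ (8 , 14 , 17) ∷ (19 , 50 , 49) ∷ (24 , 44 , 49) ∷
  (14 , 59 , 60) ∷ (24 , 51 , 60) ∷ (37 , 41 , 60) ∷ (17 , 62 , 61) ∷ (35 , 42 , 61) ∷
  (27 , 49 , 61) ∷ []

Fibre : Set
Fibre = ℕ × ℕ × ℕ × ℕ × ℕ

fibreAt : List Fibre → ℕ → Fibre
fibreAt [] _ = 0 , 0 , 0 , 0 , 0
fibreAt (f ∷ _) zero = f
fibreAt (_ ∷ fs) (suc h) = fibreAt fs h

-- Kept opaque, as unfolding these lists on open terms is expensive.
opaque
  tab : (ℕ → ℕ) → List ℕ
  tab f = applyUpTo f 63

  tab-nth : ∀ f {p} → p < 63 → nth (tab f) p ≡ f p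
  tab-nth f p<63 = nth-applyUpTo f 63 p<63

  label : ℕ → List ℕ
  label j = digits 10 63 (nth labelTable j)

  foot : ℕ → ℕ
  foot h = proj₁ (fibreAt fibreTable h)

  -- Distances inside the copy, taken from the label of the image of `h`. That they are the
  -- distances of H(2)^D is certified by `rows-distance`.
  row : ℕ → List ℕ
  row h = label (foot h)

  row-foot : ∀ h → row h ≡ label (foot h)
  row-foot h = refl

  above : ℕ → List ℕ
  above h = let _ , a , b , c , e = fibreAt fibreTable h in a ∷ b ∷ c ∷ e ∷ []

  exceptionals : List (List ℕ)
  exceptionals = map (digits 10 63) exceptionalTable

  involution : ℕ → List ℕ
  involution k = digits 100 63 (nth involutionTable k)

  word : ℕ → List ℕ
  word h = digits 10 6 (nth wordTable h)

-- All are normalised to have their zero at point 0. Type A is the distance from 0; type B comes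
-- from the four outer points of HJ collinear with 0, whose labels have minimum 1, hence `pred`.
regular valuations : List (List ℕ)
regular = row 0 ∷ map (λ b → map pred (label b)) (above 0)
valuations = regular ++ exceptionals

nth-zipWith : ∀ (t : ℕ → ℕ → ℕ) us vs {p} → p < length us → p < length vs →
              nth (zipWith t us vs) p ≡ t (nth us p) (nth vs p)
nth-zipWith t (_ ∷ _) (_ ∷ _) {zero} _ _ = refl
nth-zipWith t (_ ∷ us) (_ ∷ vs) {suc p} (s≤s u) (s≤s v) = nth-zipWith t us vs u v

length-digits : ∀ k n → length (digits 10 k n) ≡ k
length-digits zero n = refl
length-digits (suc k) n = cong suc (length-digits k (n / 10))

digits-ext : ∀ k m n → (∀ {p} → p < k → nth (digits 10 k m) p ≡ nth (digits 10 k n) p) → digits 10 k m ≡ digits 10 k n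
digits-ext zero m n _ = refl
digits-ext (suc k) m n e = cong₂ _∷_ (e (s≤s z≤n)) (digits-ext k (m / 10) (n / 10) (λ p<k → e (s≤s p<k)))

opaque
  unfolding label

  length-label : ∀ j → length (label j) ≡ 63
  length-label j = length-digits 63 (nth labelTable j)

  label-ext : ∀ i j → (∀ {p} → p < 63 → nth (label i) p ≡ nth (label j) p) → label i ≡ label j
  label-ext i j = digits-ext 63 (nth labelTable i) (nth labelTable j)

opaque
  unfolding row

  length-row : ∀ h → length (row h) ≡ 63
  length-row h = length-label (foot h)

opaque
  unfolding tab

  length-tab : ∀ g → length (tab g) ≡ 63
  length-tab g = length-applyUpTo g 63

opaque
  -- Suppose a point has distances `suc c` plus `v`, and `v` vanishes at `i`. Its neighbour towards
  -- `i` has distances `c` plus `row i`, so on the third point of their line the distances are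
  -- forced to be `c` plus these values.
  mate : ℕ → List ℕ → List ℕ
  mate i v = zipWith (λ r x → third r (suc x)) (row i) v

  nth-mate : ∀ i g {p} → p < 63 → nth (mate i (tab g)) p ≡ third (nth (row i) p) (suc (g p))
  nth-mate i g {p} p<63 = trans
    (nth-zipWith (λ r x → third r (suc x)) (row i) (tab g)
      (subst (p <_) (sym (length-row i)) p<63) (subst (p <_) (sym (length-tab g)) p<63))
    (cong (λ x → third (nth (row i) p) (suc x)) (tab-nth g p<63))

-- The second alternative disposes of type D: at some zero the forced third vector is not a
-- valuation.
Accepted : List ℕ → Set
Accepted v = v ∈ valuations ⊎ Any (λ i → nth v i ≡ 0 × ¬ Valid (nth (mate i v))) (upTo 63)

accepted? : ∀ v → Dec (Accepted v)
accepted? v = any? (≡-dec ℕ._≟_ v) valuations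
  ⊎-dec any? (λ i → nth v i ℕ.≟ 0 ×-dec ¬? (valid? (nth (mate i v)))) (upTo 63)

program⊆flags : All (_∈ flags) program
program⊆flags = by (all? (_∈? flags) program) refl

opaque
  unfolding label row above exceptionals mate

  search : Search.solve 63 accepted? program ((0 , 0) ∷ []) ≡ true
  search = refl

opaque
  unfolding tab

  accepted : ∀ g → Valid g → g 0 ≡ 0 → Accepted (tab g)
  accepted g valid g0 =
    Search.solve-sound 63 {Accepted} accepted? {g} program ((0 , 0) ∷ []) on-program (g0 ∷ []) search
    where
    on-program : All (On Near g) program
    on-program = All.map (λ t∈ → All.lookup (Valid⇒flags {g} valid) t∈) program⊆flags

HasMate : ℕ → (ℕ → ℕ) → Set
HasMate i g = ∃ λ m → Valid m × (∀ {p} → p < 63 → Near (nth (row i) p) (suc (g p)) (m p))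

mate-valid : ∀ i g → HasMate i g → Valid (nth (mate i (tab g)))
mate-valid i g (m , m-valid , near) =
  Valid-cong (λ p<63 → trans (sym (Near⇒third (near p<63))) (sym (nth-mate i g p<63))) m-valid

classify : ∀ g → Valid g → g 0 ≡ 0 → (∀ {i} → i < 63 → g i ≡ 0 → HasMate i g) →
           tab g ∈ valuations
classify g valid g0 mates = cases (accepted g valid g0)
  where
  cases : Accepted (tab g) → tab g ∈ valuations
  cases (inj₁ v∈) = v∈
  cases (inj₂ any) =
    let i , i∈ , gi≡0 , invalid = find any
        i<63 = ∈-upTo⁻ i∈
    in contradiction (mate-valid i g (mates i<63 (trans (sym (tab-nth g i<63)) gi≡0))) invalid

-- Certified facts about the tables

all<63 : ∀ {P : ℕ → Set} → All P (upTo 63) → ∀ {p} → p < 63 → P p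
all<63 ps p<63 = All.lookup ps (∈-upTo⁺ p<63)

_∈₃_ : ℕ → Triple → Set
x ∈₃ (a , b , c) = x ≡ a ⊎ x ≡ b ⊎ x ≡ c

_∈₃?_ : ∀ x t → Dec (x ∈₃ t)
x ∈₃? (a , b , c) = x ℕ.≟ a ⊎-dec (x ℕ.≟ b ⊎-dec x ℕ.≟ c)

Descends : List ℕ → ℕ → Triple → Set
Descends r j t@(a , b , c) =
  j ∈₃ t × (suc (nth r a) ≡ nth r j ⊎ suc (nth r b) ≡ nth r j ⊎ suc (nth r c) ≡ nth r j)

descends? : ∀ r j t → Dec (Descends r j t)
descends? r j t@(a , b , c) = j ∈₃? t ×-dec
  (suc (nth r a) ℕ.≟ nth r j ⊎-dec (suc (nth r b) ℕ.≟ nth r j ⊎-dec suc (nth r c) ℕ.≟ nth r j))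

-- A certificate that needs no shortest paths: validity makes `r` change by at most 1 along a line,
-- so it is a lower bound for the distance from `h`, and the descents provide walks of that length.
IsDistance : ℕ → List ℕ → Set
IsDistance h r = nth r h ≡ 0 × Valid (nth r) × All (λ j → j ≡ h ⊎ Any (Descends r j) lines) (upTo 63)

isDistance? : ∀ h r → Dec (IsDistance h r)
isDistance? h r = nth r h ℕ.≟ 0 ×-dec (valid? (nth r) ×-dec
  all? (λ j → j ℕ.≟ h ⊎-dec any? (descends? r j) lines) (upTo 63))

opaque
  unfolding label row above

  rows-distance : All (λ h → IsDistance h (row h)) (upTo 63)
  rows-distance = by (all? (λ h → isDistance? h (row h)) (upTo 63)) refl

IsAutomorphism : List ℕ → Set
IsAutomorphism s =
  All (λ p → nth s p < 63 × nth s (nth s p) ≡ p) (upTo 63) ×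
  All (λ (a , b , c) → (nth s a , nth s b , nth s c) ∈ flags) lines ×
  All (λ i → All (λ j → nth (row (nth s i)) (nth s j) ≡ nth (row i) j) (upTo 63)) (upTo 63)

isAutomorphism? : ∀ s → Dec (IsAutomorphism s)
isAutomorphism? s =
  all? (λ p → nth s p ℕ.<? 63 ×-dec nth s (nth s p) ℕ.≟ p) (upTo 63) ×-dec
  (all? (λ (a , b , c) → (nth s a , nth s b , nth s c) ∈? flags) lines ×-dec
   all? (λ i → same? (row (nth s i)) (row i)) (upTo 63))
  where
  same? : ∀ r r′ → Dec (All (λ j → nth r (nth s j) ≡ nth r′ j) (upTo 63))
  same? r r′ = all? (λ j → nth r (nth s j) ℕ.≟ nth r′ j) (upTo 63)

opaque
  unfolding label row above involution

  involutions-automorphic : All (λ k → IsAutomorphism (involution k)) (upTo 3)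
  involutions-automorphic = by (all? (λ k → isAutomorphism? (involution k)) (upTo 3)) refl

-- Digit k stands for the involution k - 1; the digit 0 only pads.
act : List ℕ → ℕ → ℕ
act [] p = p
act (zero ∷ w) p = act w p
act (suc k ∷ w) p = act w (nth (involution k) p)

opaque
  unfolding word

  word-letters : All (λ h → All (_< 4) (word h)) (upTo 63)
  word-letters = by (all? (λ h → all? (ℕ._<? 4) (word h)) (upTo 63)) refl

opaque
  unfolding word involution

  word-transitive : All (λ h → act (word h) 0 ≡ h) (upTo 63)
  word-transitive = by (all? (λ h → act (word h) 0 ℕ.≟ h) (upTo 63)) refl

opaque
  unfolding label row above word involution

  -- The classification is carried out at point 0 only; this carries the type B labels found there
  -- to labels at `h`.
  fibres-conjugate : All (λ h → All (λ b → Any (λ j → All (λ q → nth (label j) (act (word h) q) ≡ nth (label b) q) (upTo 63)) (above h)) (above 0)) (upTo 63)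
  fibres-conjugate = by (all? (λ h → all? (λ b → any? (λ j → conjugate? (word h) (label j) (label b)) (above h)) (above 0)) (upTo 63)) refl
    where
    conjugate? : ∀ w u v → Dec (All (λ q → nth u (act w q) ≡ nth v q) (upTo 63))
    conjugate? w u v = all? (λ q → nth u (act w q) ℕ.≟ nth v q) (upTo 63)

zeroOnlyAt? : ∀ q x → Dec (x ≡ 0 → q ≡ 0)
zeroOnlyAt? zero x = yes λ _ → refl
zeroOnlyAt? (suc q) zero = no λ f → contradiction (f refl) λ ()
zeroOnlyAt? (suc q) (suc x) = yes λ ()

far? : ∀ v q → Dec (nth v q ≡ 1 × ¬ (nth (row 0) q ≡ 1))
far? v q = nth v q ℕ.≟ 1 ×-dec ¬? (nth (row 0) q ℕ.≟ 1)

-- If v is the distance vector of z, less a constant, then z has a separate neighbour for each of these points.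
far : List ℕ → List ℕ
far v = filter (far? v) (upTo 63)

opaque
  unfolding label row above exceptionals

  unique-zero : All (λ v → All (λ q → nth v q ≡ 0 → q ≡ 0) (upTo 63)) valuations
  unique-zero = by (all? (λ v → all? (λ q → zeroOnlyAt? q (nth v q)) (upTo 63)) valuations) refl

  far-large : All (λ v → 10 < length (far v)) exceptionals
  far-large = by (all? (λ v → 10 ℕ.<? length (far v)) exceptionals) refl

  labels-positive : All (λ b → All (λ p → nth (label b) p ≢ 0) (upTo 63)) (above 0)
  labels-positive = by (all? (λ b → all? (λ p → ¬? (nth (label b) p ℕ.≟ 0)) (upTo 63)) (above 0)) refl

  -- At distance 2 from the copy these values would occur increased by 1, and 5 exceeds the
  -- diameter.
  labels-reach-4 : All (λ b → Any (λ p → nth (label b) p ≡ 4) (upTo 63)) (above 0)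
  labels-reach-4 = by (all? (λ b → any? (λ p → nth (label b) p ℕ.≟ 4) (upTo 63)) (above 0)) refl

  row₀-reaches-3 : Any (λ p → nth (row 0) p ≡ 3) (upTo 63)
  row₀-reaches-3 = by (any? (λ p → nth (row 0) p ℕ.≟ 3) (upTo 63)) refl

-- Isometric copies of H(2)^D and the points near them

Near-pred : ∀ {a b c} → Near (suc a) (suc b) (suc c) → Near a b c
Near-pred near₁ = near₁
Near-pred near₂ = near₂
Near-pred near₃ = near₃

Near-∸ : ∀ k {a b c} → k ≤ a → k ≤ b → k ≤ c → Near a b c → Near (a ∸ k) (b ∸ k) (c ∸ k)
Near-∸ zero _ _ _ n = n
Near-∸ (suc k) (s≤s a) (s≤s b) (s≤s c) n = Near-∸ k a b c (Near-pred n)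

Valid-∸ : ∀ k {f} → (∀ {p} → p < 63 → k ≤ f p) → Valid f → Valid (λ p → f p ∸ k)
Valid-∸ k {f} k≤ v = go lines lines<63 v
  where
  go : ∀ ls → All (On (λ a b c → a < 63 × b < 63 × c < 63) (λ p → p)) ls → All (On Near f) ls → All (On Near (λ p → f p ∸ k)) ls
  go [] [] [] = []
  go (_ ∷ ls) ((a , b , c) ∷ bs) (n ∷ ns) = Near-∸ k (k≤ a) (k≤ b) (k≤ c) n ∷ go ls bs ns

Near-descend : ∀ {a b t} → Near (suc a) (suc (suc b)) t → ∃ λ t′ → t ≡ suc t′ × Near a (suc b) t′
Near-descend near₁ = _ , refl , near₁
Near-descend near₂ = _ , refl , near₂
Near-descend near₃ = _ , refl , near₃

-- A third entry below `k` would be the minimum and keep both others at most `k`, but the second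
-- exceeds `k`.
Near-shift : ∀ k {r g t} → Near (k + r) (suc (k + g)) t → k ≤ t × Near r (suc g) (t ∸ k)
Near-shift zero n = z≤n , n
Near-shift (suc k) n with Near-descend n
... | t′ , refl , n′ with Near-shift k n′
...   | le , n″ = s≤s le , n″

nth-map-pred : ∀ v p → nth (map pred v) p ≡ pred (nth v p)
nth-map-pred [] p = refl
nth-map-pred (x ∷ v) zero = refl
nth-map-pred (x ∷ v) (suc p) = nth-map-pred v p

σ : ℕ → ℕ → ℕ
σ k = nth (involution k)

involution-automorphic : ∀ {k} → k < 3 → IsAutomorphism (involution k)
involution-automorphic k<3 = All.lookup involutions-automorphic (∈-upTo⁺ k<3)

σ<63 : ∀ {k p} → k < 3 → p < 63 → σ k p < 63
σ<63 k<3 p<63 = proj₁ (all<63 (proj₁ (involution-automorphic k<3)) p<63)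

σσ : ∀ {k p} → k < 3 → p < 63 → σ k (σ k p) ≡ p
σσ k<3 p<63 = proj₂ (all<63 (proj₁ (involution-automorphic k<3)) p<63)

row-σ : ∀ {k i j} → k < 3 → i < 63 → j < 63 → nth (row (σ k i)) (σ k j) ≡ nth (row i) j
row-σ k<3 i<63 j<63 = all<63 (all<63 (proj₂ (proj₂ (involution-automorphic k<3))) i<63) j<63

act<63 : ∀ {w p} → All (_< 4) w → p < 63 → act w p < 63
act<63 [] p<63 = p<63
act<63 {zero ∷ w} (_ ∷ ks) p<63 = act<63 ks p<63
act<63 {suc k ∷ w} (s≤s k<3 ∷ ks) p<63 = act<63 ks (σ<63 k<3 p<63)

act-surjective : ∀ {w p} → All (_< 4) w → p < 63 → ∃ λ q → q < 63 × act w q ≡ p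
act-surjective [] p<63 = _ , p<63 , refl
act-surjective {zero ∷ w} (_ ∷ ks) p<63 = act-surjective ks p<63
act-surjective {suc k ∷ w} (s≤s k<3 ∷ ks) p<63 =
  let q , q<63 , e = act-surjective ks p<63
  in σ k q , σ<63 k<3 q<63 , trans (cong (act w) (σσ k<3 q<63)) e

letters : ∀ {h} → h < 63 → All (_< 4) (word h)
letters = all<63 word-letters

row-self : ∀ {h} → h < 63 → nth (row h) h ≡ 0
row-self h<63 = proj₁ (all<63 rows-distance h<63)

module Frames (N : Geometry) (oct : IsNearOctagon N) (order : HasOrder N 2 4) where
  open Geometry N using (Point)
  open NearOctagon N oct order

  -- An isometric copy of H(2)^D; only the values at 0, …, 62 matter.
  record Frame (φ : ℕ → Point) : Set where
    field
      dist : ∀ {i j} → i < 63 → j < 63 → d (φ i) (φ j) ≡ nth (row i) j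
      valid : ∀ x → Valid (λ p → d x (φ p))

  open Frame public

  frame-σ : ∀ {φ k} → k < 3 → Frame φ → Frame (λ p → φ (σ k p))
  frame-σ k<3 F .dist i<63 j<63 = trans (dist F (σ<63 k<3 i<63) (σ<63 k<3 j<63)) (row-σ k<3 i<63 j<63)
  frame-σ {φ} k<3 F .valid x =
    All.map (λ t∈ → All.lookup (Valid⇒flags {λ p → d x (φ p)} (valid F x)) t∈) (proj₁ (proj₂ (involution-automorphic k<3)))

  module Act (Good : (ℕ → Point) → Set)
             (good-σ : ∀ {φ k} → k < 3 → Good φ → Good (λ p → φ (σ k p))) where
    good-act : ∀ {φ} w → All (_< 4) w → Good φ → Good (λ p → φ (act w p))
    good-act [] [] G = G
    good-act (zero ∷ w) (_ ∷ ks) G = good-act w ks G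
    good-act (suc k ∷ w) (s≤s k<3 ∷ ks) G = good-σ k<3 (good-act w ks G)

  Above : ℕ → (ℕ → Point) → Point → Set
  Above c φ z = ∀ {p} → p < 63 → suc c ≤ d z (φ p)

  -- Seen from the copy, `a` looks like its point `k` moved away by `c`. For `c = 0` it is that
  -- point; for `c = 1` this is type A.
  Clone : ℕ → (ℕ → Point) → Point → ℕ → Set
  Clone c φ a k = ∀ {p} → p < 63 → d a (φ p) ≡ c + nth (row k) p

  distinct-neighbours : ∀ {z} (P : ℕ → Point → Set) → (∀ {p q a} → p < 63 → q < 63 → P p a → P q a → p ≡ q) →
                        ∀ qs → All (_< 63) qs → Unique qs → All (λ q → ∃ λ a → Adj z a × P q a) qs → length qs ≤ 10
  distinct-neighbours {z} P P-unique qs bounds unique found =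
    subst (_≤ 10) (length-points found) (Neighbours.neighbours≤10 z (points found) (adjacent found) (apart bounds unique found))
    where
    Found : ℕ → Set
    Found q = ∃ λ a → Adj z a × P q a

    points : ∀ {qs} → All Found qs → List Point
    points [] = []
    points ((a , _) ∷ fs) = a ∷ points fs

    length-points : ∀ {qs} (fs : All Found qs) → length (points fs) ≡ length qs
    length-points [] = refl
    length-points (_ ∷ fs) = cong suc (length-points fs)

    adjacent : ∀ {qs} (fs : All Found qs) → All (Adj z) (points fs)
    adjacent [] = []
    adjacent ((_ , za , _) ∷ fs) = za ∷ adjacent fs

    new : ∀ {q a qs} → q < 63 → P q a → All (_< 63) qs → All (q ≢_) qs → (fs : All Found qs) → All (a ≢_) (points fs)
    new q<63 Pqa [] [] [] = []
    new q<63 Pqa (b ∷ bs) (q≢ ∷ ne) ((a′ , _ , P′) ∷ fs) =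
      (λ { refl → q≢ (P-unique q<63 b Pqa P′) }) ∷ new q<63 Pqa bs ne fs

    apart : ∀ {qs} → All (_< 63) qs → Unique qs → (fs : All Found qs) → AllPairs _≢_ (points fs)
    apart [] [] [] = []
    apart (b ∷ bs) (ne ∷ u) ((a , _ , Pqa) ∷ fs) = new b Pqa bs ne fs ∷ apart bs u fs

  -- Classification of the points at distance suc c from a copy of H(2)^D, given that their
  -- neighbours closer to the copy have the distances of a point of the copy, increased by c.
  module Layer (c : ℕ) (Good : (ℕ → Point) → Set) (frame : ∀ {φ} → Good φ → Frame φ)
               (good-σ : ∀ {φ k} → k < 3 → Good φ → Good (λ p → φ (σ k p)))
               (layer : ∀ {φ} → Good φ → ∀ {z a} → Above c φ z → Adj z a →
                        Above c φ a ⊎ (∃ λ k → k < 63 × Clone c φ a k)) where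
    open Act Good good-σ

    excess : (ℕ → Point) → Point → ℕ → ℕ
    excess φ z p = d z (φ p) ∸ suc c

    excess-zero : ∀ {φ z p} → Above c φ z → p < 63 → excess φ z p ≡ 0 → d z (φ p) ≡ suc c
    excess-zero above p<63 e = ℕ.≤-antisym (ℕ.m∸n≡0⇒m≤n e) (above p<63)

    from-excess : ∀ {φ z p n} → Above c φ z → p < 63 → excess φ z p ≡ n → d z (φ p) ≡ suc c + n
    from-excess above p<63 refl = sym (ℕ.m+[n∸m]≡n (above p<63))

    clone-at : ∀ {φ a i k} → Good φ → k < 63 → i < 63 → Clone c φ a k → d a (φ i) ≡ c → Clone c φ a i
    clone-at {φ} {a} {i} {k} G k<63 i<63 clone da {p} p<63 =
      trans (clone p<63) (cong (c +_)
        (trans (sym (dist (frame G) k<63 p<63)) (trans (cong (λ x → d x (φ p)) same) (dist (frame G) i<63 p<63))))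
      where
      same : φ k ≡ φ i
      same = d≡0⇒≡ (trans (dist (frame G) k<63 i<63)
        (ℕ.+-cancelˡ-≡ c _ _ (trans (sym (clone i<63)) (trans da (sym (ℕ.+-identityʳ c))))))

    -- The neighbour `a` of `z` towards `φ i` is at distance `c` from it, too close for `Above c`,
    -- so `layer` makes it a clone, necessarily of `i`. The third point of the line on `z` and `a`
    -- supplies the mate.
    has-mate : ∀ {φ z i} → Good φ → Above c φ z → i < 63 → excess φ z i ≡ 0 → HasMate i (excess φ z)
    has-mate {φ} {z} {i} G above i<63 e with neighbour-towards (excess-zero {φ} {z} above i<63 e)
    ... | a , za , da with layer {φ} G {z} {a} above za
    ...   | inj₁ a-above = contradiction (a-above i<63) (ℕ.<⇒≱ (s≤s (ℕ.≤-reflexive da)))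
    ...   | inj₂ (k , k<63 , clone) with line-of za
    ...     | b , ℓ = (λ p → d b (φ p) ∸ c) , Valid-∸ c {λ p → d b (φ p)} (λ p<63 → proj₁ (shifted p<63)) (valid (frame G) b) , λ p<63 → proj₂ (shifted p<63)
      where
      shifted : ∀ {p} → p < 63 → c ≤ d b (φ p) × Near (nth (row i) p) (suc (excess φ z p)) (d b (φ p) ∸ c)
      shifted {p} p<63 = Near-shift c (Near-resp (clone-at {φ} {a} G k<63 i<63 clone da p<63) (from-excess {φ} {z} above p<63 refl) refl
                                        (near′ (flip ℓ) (φ p)))

    classified : ∀ {φ z} → Good φ → Above c φ z → d z (φ 0) ≡ suc c → tab (excess φ z) ∈ valuations
    classified {φ} {z} G above dz = classify (excess φ z) (Valid-∸ (suc c) {λ p → d z (φ p)} above (valid (frame G) z))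
      (trans (cong (_∸ suc c) dz) (ℕ.n∸n≡0 c)) (λ i<63 e → has-mate {φ} {z} G above i<63 e)

    above-act : ∀ {φ z h} → h < 63 → Above c φ z → Above c (λ p → φ (act (word h) p)) z
    above-act h<63 above p<63 = above (act<63 (letters h<63) p<63)

    act-0 : ∀ {h} → h < 63 → act (word h) 0 ≡ h
    act-0 = all<63 word-transitive

    move : ∀ {φ : ℕ → Point} {z h n} → h < 63 → d z (φ h) ≡ n → d z (φ (act (word h) 0)) ≡ n
    move {φ} {z} h<63 e = trans (cong (λ q → d z (φ q)) (act-0 h<63)) e

    -- Composing the frame with the word of `h` moves this nearest point to 0, and every listed
    -- valuation vanishes only there.
    unique : ∀ {φ z h h′} → Good φ → Above c φ z → h < 63 → h′ < 63 →
             d z (φ h) ≡ suc c → d z (φ h′) ≡ suc c → h ≡ h′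
    unique {φ} {z} {h} {h′} G above h<63 h′<63 e e′ =
      let q , q<63 , q↦ = act-surjective (letters h<63) h′<63
          ψ p = φ (act (word h) p)
          v∈ = classified {ψ} {z} (good-act (word h) (letters h<63) G) (above-act {φ} {z} h<63 above) (move {φ} {z} h<63 e)
          q≡0 = all<63 (All.lookup unique-zero v∈) q<63
                  (trans (tab-nth (excess ψ z) q<63)
                    (trans (cong (λ r → d z (φ r) ∸ suc c) q↦) (trans (cong (_∸ suc c) e′) (ℕ.n∸n≡0 c))))
      in trans (sym (act-0 h<63)) (trans (cong (act (word h)) (sym q≡0)) q↦)

    -- Each point of `far v` is at distance `2 + c` from `z`, and a neighbour of `z` is at distance
    -- `1 + c` from it. These neighbours are `Above c` and, by `unique`, different for different
    -- points, so there would be more than ten.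
    not-exceptional : ∀ {φ z} → Good φ → Above c φ z → d z (φ 0) ≡ suc c → ¬ (tab (excess φ z) ∈ exceptionals)
    not-exceptional {φ} {z} G above dz v∈ = contradiction
      (distinct-neighbours P (λ {_} {_} {a} p<63 q<63 (ab , e) (_ , e′) → unique {φ} {a} G ab p<63 q<63 e e′)
        qs (All.tabulate far<63) (filter⁺ (far? v) (upTo⁺ 63)) (All.tabulate neighbour))
      (ℕ.<⇒≱ (All.lookup far-large v∈))
      where
      v = tab (excess φ z)
      qs = far v

      P : ℕ → Point → Set
      P q a = Above c φ a × d a (φ q) ≡ suc c

      far<63 : ∀ {q} → q ∈ qs → q < 63
      far<63 q∈ = ∈-upTo⁻ (proj₁ (∈-filter⁻ (far? v) q∈))

      neighbour : ∀ {q} → q ∈ qs → ∃ λ a → Adj z a × P q a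
      neighbour {q} q∈ = find-neighbour (neighbour-towards dzq)
        where
        q<63 = far<63 q∈
        tests : nth v q ≡ 1 × ¬ (nth (row 0) q ≡ 1)
        tests = proj₂ (∈-filter⁻ (far? v) {xs = upTo 63} q∈)

        dzq : d z (φ q) ≡ suc (suc c)
        dzq = trans (from-excess {φ} {z} above q<63 (trans (sym (tab-nth (excess φ z) q<63)) (proj₁ tests))) (ℕ.+-comm (suc c) 1)

        find-neighbour : (∃ λ a → Adj z a × d a (φ q) ≡ suc c) → ∃ λ a → Adj z a × P q a
        find-neighbour (a , za , da) with layer {φ} G {z} {a} above za
        ... | inj₁ a-above = a , za , a-above , da
        -- A clone of `k` next to `z` makes `φ k` nearest to `z`, so `k` is 0 and `q` would be
        -- collinear with 0, which `far` excludes.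
        ... | inj₂ (k , k<63 , clone) = contradiction (trans (cong (λ h → nth (row h) q) (sym k≡0)) row-k) (proj₂ tests)
          where
          row-k : nth (row k) q ≡ 1
          row-k = ℕ.+-cancelˡ-≡ c _ _ (trans (sym (clone q<63)) (trans da (sym (ℕ.+-comm c 1))))
          dzk : d z (φ k) ≡ suc c
          dzk = ℕ.≤-antisym
            (ℕ.≤-trans (Adj-step za (φ k))
              (s≤s (ℕ.≤-reflexive (trans (clone k<63) (trans (cong (c +_) (row-self k<63)) (ℕ.+-identityʳ c))))))
            (above k<63)
          k≡0 : k ≡ 0
          k≡0 = unique {φ} {z} G above k<63 (s≤s z≤n) dzk dz

    -- The second case adds `c` and not `suc c` because labels of outer points start at 1.
    Regular : (ℕ → Point) → Point → Set
    Regular φ z = Clone (suc c) φ z 0 ⊎ (∃ λ b → b ∈ above 0 × (∀ {p} → p < 63 → d z (φ p) ≡ c + nth (label b) p))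

    regularity : ∀ {φ z} → Good φ → Above c φ z → d z (φ 0) ≡ suc c → Regular φ z
    regularity {φ} {z} G ab dz = cases (∈-++⁻ regular (classified {φ} {z} G ab dz))
      where
      at : ∀ {v} → tab (excess φ z) ≡ v → ∀ {p} → p < 63 → d z (φ p) ≡ suc c + nth v p
      at e p<63 = from-excess {φ} {z} ab p<63 (trans (sym (tab-nth (excess φ z) p<63)) (cong (λ u → nth u _) e))

      suc-pred : ∀ {x} → x ≢ 0 → suc c + pred x ≡ c + x
      suc-pred {zero} x≢0 = contradiction refl x≢0
      suc-pred {suc x} _ = sym (ℕ.+-suc c x)

      cases : (tab (excess φ z) ∈ regular) ⊎ (tab (excess φ z) ∈ exceptionals) → Regular φ z
      cases (inj₂ v∈) = contradiction v∈ (not-exceptional {φ} {z} G ab dz)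
      cases (inj₁ (here e)) = inj₁ (at e)
      cases (inj₁ (there v∈)) with ∈-map⁻ (λ b → map pred (label b)) v∈
      ... | b , b∈ , e = inj₂ (b , b∈ , λ {p} p<63 → trans (at e p<63)
        (trans (cong (suc c +_) (nth-map-pred (label b) p)) (suc-pred (all<63 (All.lookup labels-positive b∈) p<63))))

-- Distances of H(2)^D from its line table, and the frame of the embedding

All-toList⁻ : ∀ {A : Set} {P : A → Set} {n} (xs : Vec A n) → All P (toList xs) → ∀ l → P (lookup xs l)
All-toList⁻ (_ ∷ _) (p ∷ _) zero = p
All-toList⁻ (_ ∷ xs) (_ ∷ ps) (suc l) = All-toList⁻ xs ps l

All-toList⁺ : ∀ {A : Set} {P : A → Set} {n} (xs : Vec A n) → (∀ l → P (lookup xs l)) → All P (toList xs)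
All-toList⁺ [] _ = []
All-toList⁺ (_ ∷ xs) f = f zero ∷ All-toList⁺ xs (λ l → f (suc l))

Any-toList : ∀ {A : Set} {P : A → Set} {n} (xs : Vec A n) → Any P (toList xs) → ∃ λ l → P (lookup xs l)
Any-toList (_ ∷ _) (here p) = zero , p
Any-toList (_ ∷ xs) (there any) = let l , p = Any-toList xs any in suc l , p

≡ᵇ⇒≡ : ∀ {m n} → (m ≡ᵇ n) ≡ true → m ≡ n
≡ᵇ⇒≡ {m} {n} e = ℕ.≡ᵇ⇒≡ m n (subst T (sym e) _)

≡⇒≡ᵇ : ∀ {m n} → m ≡ n → (m ≡ᵇ n) ≡ true
≡⇒≡ᵇ {zero} refl = refl
≡⇒≡ᵇ {suc m} refl = ≡⇒≡ᵇ {m} refl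

∨-true : ∀ {a b} → a ∨ b ≡ true → a ≡ true ⊎ b ≡ true
∨-true {true} _ = inj₁ refl
∨-true {false} e = inj₂ e

∨-trueˡ : ∀ {a b} → a ≡ true → a ∨ b ≡ true
∨-trueˡ refl = refl

∨-trueʳ : ∀ {a b} → b ≡ true → a ∨ b ≡ true
∨-trueʳ {true} _ = refl
∨-trueʳ {false} e = e

module _ {np nl : ℕ} (tbl : Vec (ℕ × ℕ × ℕ) nl) where
  inc⇒∈₃ : ∀ p l → Geometry.inc (tableGeometry np nl tbl) p l ≡ true → toℕ p ∈₃ lookup tbl l
  inc⇒∈₃ p l e with ∨-true e
  ... | inj₁ e₁ = inj₁ (≡ᵇ⇒≡ e₁)
  ... | inj₂ e₂ with ∨-true e₂
  ...   | inj₁ e₃ = inj₂ (inj₁ (≡ᵇ⇒≡ e₃))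
  ...   | inj₂ e₄ = inj₂ (inj₂ (≡ᵇ⇒≡ e₄))

  ∈₃⇒inc : ∀ p l → toℕ p ∈₃ lookup tbl l → Geometry.inc (tableGeometry np nl tbl) p l ≡ true
  ∈₃⇒inc p l (inj₁ e) = ∨-trueˡ (≡⇒≡ᵇ e)
  ∈₃⇒inc p l (inj₂ (inj₁ e)) = ∨-trueʳ {toℕ p ≡ᵇ proj₁ (lookup tbl l)} (∨-trueˡ (≡⇒≡ᵇ e))
  ∈₃⇒inc p l (inj₂ (inj₂ e)) =
    ∨-trueʳ {toℕ p ≡ᵇ proj₁ (lookup tbl l)} (∨-trueʳ {toℕ p ≡ᵇ proj₁ (proj₂ (lookup tbl l))} (≡⇒≡ᵇ e))

toℕ-mod : ∀ {n} → n < 63 → toℕ (n mod 63) ≡ n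
toℕ-mod {n} n<63 = trans (Fin.toℕ-fromℕ< (m%n<n n 63)) (m<n⇒m%n≡m n<63)

Distinct : Triple → Set
Distinct (a , b , c) = a ≢ b × a ≢ c × b ≢ c

lines-distinct : All Distinct lines
lines-distinct = by (all? (λ (a , b , c) → ¬? (a ℕ.≟ b) ×-dec (¬? (a ℕ.≟ c) ×-dec ¬? (b ℕ.≟ c))) lines) refl

Near-close : ∀ {x y z} → Near x y z →
             (x ≤ suc y × x ≤ suc z) × (y ≤ suc x × y ≤ suc z) × (z ≤ suc x × z ≤ suc y)
Near-close (near₁ {k}) = (ℕ.m≤n+m k 2 , ℕ.m≤n+m k 2) , (ℕ.≤-refl , ℕ.n≤1+n _) , (ℕ.≤-refl , ℕ.n≤1+n _)
Near-close (near₂ {k}) = (ℕ.≤-refl , ℕ.n≤1+n _) , (ℕ.m≤n+m k 2 , ℕ.m≤n+m k 2) , (ℕ.n≤1+n _ , ℕ.≤-refl)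
Near-close (near₃ {k}) = (ℕ.n≤1+n _ , ℕ.≤-refl) , (ℕ.n≤1+n _ , ℕ.≤-refl) , (ℕ.m≤n+m k 2 , ℕ.m≤n+m k 2)

On-close : ∀ {f t x y} → On Near f t → x ∈₃ t → y ∈₃ t → f x ≤ suc (f y)
On-close n (inj₁ refl) (inj₁ refl) = ℕ.n≤1+n _
On-close n (inj₁ refl) (inj₂ (inj₁ refl)) = proj₁ (proj₁ (Near-close n))
On-close n (inj₁ refl) (inj₂ (inj₂ refl)) = proj₂ (proj₁ (Near-close n))
On-close n (inj₂ (inj₁ refl)) (inj₁ refl) = proj₁ (proj₁ (proj₂ (Near-close n)))
On-close n (inj₂ (inj₁ refl)) (inj₂ (inj₁ refl)) = ℕ.n≤1+n _
On-close n (inj₂ (inj₁ refl)) (inj₂ (inj₂ refl)) = proj₂ (proj₁ (proj₂ (Near-close n)))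
On-close n (inj₂ (inj₂ refl)) (inj₁ refl) = proj₁ (proj₂ (proj₂ (Near-close n)))
On-close n (inj₂ (inj₂ refl)) (inj₂ (inj₁ refl)) = proj₂ (proj₂ (proj₂ (Near-close n)))
On-close n (inj₂ (inj₂ refl)) (inj₂ (inj₂ refl)) = ℕ.n≤1+n _

row-valid : ∀ {h} → h < 63 → Valid (nth (row h))
row-valid h<63 = proj₁ (proj₂ (all<63 rows-distance h<63))

line<63 : ∀ l {x} → x ∈₃ lookup h2dLineTable l → x < 63
line<63 l x∈ with All-toList⁻ h2dLineTable lines<63 l
line<63 l (inj₁ refl) | a , _ , _ = a
line<63 l (inj₂ (inj₁ refl)) | _ , b , _ = b
line<63 l (inj₂ (inj₂ refl)) | _ , _ , c = c

module _ {h : ℕ} (h<63 : h < 63) where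
  private
    r : ℕ → ℕ
    r = nth (row h)

  -- `row h` is a valuation, so a step changes it by at most 1.
  walk-lower : ∀ {m i j} → Walk H2D m i j → r (toℕ i) ≤ m + r (toℕ j)
  walk-lower here = ℕ.≤-refl
  walk-lower (step {x = i} {y = j} (l , il , jl) w) =
    ℕ.≤-trans (On-close {r} {lookup h2dLineTable l} (All-toList⁻ h2dLineTable (row-valid h<63) l)
                (inc⇒∈₃ h2dLineTable i l il) (inc⇒∈₃ h2dLineTable j l jl))
              (s≤s (walk-lower w))

  descent : ∀ {j} → j < 63 → j ≡ h ⊎ ∃ λ l → ∃ λ i → j ∈₃ lookup h2dLineTable l × i ∈₃ lookup h2dLineTable l × suc (r i) ≡ r j
  descent {j} j<63 with all<63 (proj₂ (proj₂ (all<63 rows-distance h<63))) j<63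
  ... | inj₁ e = inj₁ e
  ... | inj₂ any with Any-toList h2dLineTable any
  ...   | l , j∈ , inj₁ e = inj₂ (l , _ , j∈ , inj₁ refl , e)
  ...   | l , j∈ , inj₂ (inj₁ e) = inj₂ (l , _ , j∈ , inj₂ (inj₁ refl) , e)
  ...   | l , j∈ , inj₂ (inj₂ e) = inj₂ (l , _ , j∈ , inj₂ (inj₂ refl) , e)

  walk-upper : ∀ n {j} → j < 63 → r j ≡ n → Walk H2D n (j mod 63) (h mod 63)
  walk-upper n {j} j<63 e with descent j<63
  walk-upper n {j} j<63 e | inj₁ refl with trans (sym e) (row-self h<63)
  ... | refl = here
  walk-upper zero {j} j<63 e | inj₂ (l , i , j∈ , i∈ , e′) with trans e′ e
  ... | ()
  walk-upper (suc n) {j} j<63 e | inj₂ (l , i , j∈ , i∈ , e′) =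
    step (l , ∈₃⇒inc h2dLineTable (j mod 63) l (subst (_∈₃ lookup h2dLineTable l) (sym (toℕ-mod j<63)) j∈)
            , ∈₃⇒inc h2dLineTable (i mod 63) l (subst (_∈₃ lookup h2dLineTable l) (sym (toℕ-mod i<63)) i∈))
         (walk-upper n i<63 (ℕ.suc-injective (trans e′ e)))
    where
    i<63 = line<63 l i∈

  H2D-dist : ∀ {j} → j < 63 → Dist H2D (j mod 63) (h mod 63) (r j)
  H2D-dist {j} j<63 = walk-upper (r j) j<63 refl , λ m m<r w →
    ℕ.<⇒≱ m<r (ℕ.≤-trans (ℕ.≤-reflexive (cong r (sym (toℕ-mod j<63))))
                (ℕ.≤-trans (walk-lower w) (ℕ.≤-reflexive
                  (trans (cong (m +_) (trans (cong r (toℕ-mod h<63)) (row-self h<63))) (ℕ.+-identityʳ m)))))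

module Embedded (N : Geometry) (oct : IsNearOctagon N) (order : HasOrder N 2 4)
                (S : IsometricSubgeometry H2D N) where
  open Geometry N
  open NearOctagon N oct order
  open Frames N oct order
  open IsometricSubgeometry S using (ψ; φ-inj; inc-eq; isom)

  -- Reducing modulo 63 makes the embedding total on ℕ, as `Frame` wants it.
  φ : ℕ → Point
  φ p = IsometricSubgeometry.φ S (p mod 63)

  φ-on : ∀ l {p} → p ∈₃ lookup h2dLineTable l → inc (φ p) (ψ l) ≡ true
  φ-on l {p} p∈ = trans (sym (inc-eq (p mod 63) l))
    (∈₃⇒inc h2dLineTable (p mod 63) l (subst (_∈₃ lookup h2dLineTable l) (sym (toℕ-mod (line<63 l p∈))) p∈))

  φ-injective : ∀ {p q} → p < 63 → q < 63 → φ p ≡ φ q → p ≡ q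
  φ-injective p<63 q<63 e = trans (sym (toℕ-mod p<63)) (trans (cong toℕ (φ-inj _ _ e)) (toℕ-mod q<63))

  frame₀ : Frame φ
  frame₀ .dist {i} {j} i<63 j<63 =
    trans (d-sym (φ i) (φ j)) (Dist⇒d (proj₁ (isom (j mod 63) (i mod 63) _) (H2D-dist i<63 j<63)))
  frame₀ .valid x = All-toList⁺ h2dLineTable λ l →
    let a≢b , a≢c , b≢c = All-toList⁻ h2dLineTable lines-distinct l
        a∈ = inj₁ refl
        b∈ = inj₂ (inj₁ refl)
        c∈ = inj₂ (inj₂ refl)
    in near (line₃ (φ-on l a∈) (φ-on l b∈) (φ-on l c∈)
              (λ e → a≢b (φ-injective (line<63 l a∈) (line<63 l b∈) e))
              (λ e → a≢c (φ-injective (line<63 l a∈) (line<63 l c∈) e))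
              (λ e → b≢c (φ-injective (line<63 l b∈) (line<63 l c∈) e))) x

-- Points outside the copy: types at distance 1, and nothing at distance 2

module Outer (N : Geometry) (oct : IsNearOctagon N) (order : HasOrder N 2 4) where
  open Geometry N using (Point)
  open NearOctagon N oct order
  open Frames N oct order

  on-copy? : ∀ φ x → (∃ λ p → p < 63 × x ≡ φ p) ⊎ Above 0 φ x
  on-copy? φ x with ℕ.anyUpTo? (λ p → d x (φ p) ℕ.≟ 0) 63
  ... | yes (p , p<63 , e) = inj₁ (p , p<63 , d≡0⇒≡ e)
  ... | no none = inj₂ λ p<63 → ℕ.n≢0⇒n>0 λ e → none (_ , p<63 , e)

  layer₀ : ∀ {φ} → Frame φ → ∀ {z a} → Above 0 φ z → Adj z a →
           Above 0 φ a ⊎ (∃ λ k → k < 63 × Clone 0 φ a k)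
  layer₀ {φ} F {z} {a} above za with on-copy? φ a
  ... | inj₁ (p , p<63 , refl) = inj₂ (p , p<63 , dist F p<63)
  ... | inj₂ a-above = inj₁ a-above

  module L₀ = Layer 0 Frame (λ F → F) frame-σ layer₀

  HasLabel : (ℕ → Point) → Point → ℕ → Set
  HasLabel φ x j = ∀ {p} → p < 63 → d x (φ p) ≡ nth (label j) p

  -- `regularity` is about point 0. The word of `h` moves `h` there; the distances of type A are
  -- carried back by isometry, those of type B by `fibres-conjugate`.
  type-at : ∀ {φ z h} → Frame φ → Above 0 φ z → h < 63 → d z (φ h) ≡ 1 →
            Clone 1 φ z h ⊎ (∃ λ j → j ∈ above h × HasLabel φ z j)
  type-at {φ} {z} {h} F ab h<63 dz = cases (L₀.regularity {ψ} {z} G (L₀.above-act {φ} {z} h<63 ab) (L₀.move {φ} {z} h<63 dz))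
    where
    open Act Frame frame-σ
    ψ : ℕ → Point
    ψ p = φ (act (word h) p)

    G : Frame ψ
    G = good-act (word h) (letters h<63) F

    cases : L₀.Regular ψ z → Clone 1 φ z h ⊎ (∃ λ j → j ∈ above h × HasLabel φ z j)
    cases (inj₁ clone) = inj₁ λ {p} p<63 →
      let q , q<63 , q↦p = act-surjective (letters h<63) p<63
      in trans (cong (λ r → d z (φ r)) (sym q↦p)) (trans (clone q<63) (cong suc
           (trans (sym (dist G (s≤s z≤n) q<63))
             (trans (cong₂ (λ r s → d (φ r) (φ s)) (L₀.act-0 h<63) q↦p) (dist F h<63 p<63)))))
    cases (inj₂ (b , b∈ , eq)) =
      let j , j∈ , conj = find (All.lookup (all<63 fibres-conjugate h<63) b∈)
      in inj₂ (j , j∈ , λ {p} p<63 →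
        let q , q<63 , q↦p = act-surjective (letters h<63) p<63
        in trans (cong (λ r → d z (φ r)) (sym q↦p))
             (trans (eq q<63) (trans (sym (all<63 conj q<63)) (cong (nth (label j)) q↦p))))

  AllClones : (ℕ → Point) → Set
  AllClones φ = ∀ {z h} → Above 0 φ z → h < 63 → d z (φ h) ≡ 1 → Clone 1 φ z h

  Good₁ : (ℕ → Point) → Set
  Good₁ φ = Frame φ × AllClones φ

  good₁-σ : ∀ {φ k} → k < 3 → Good₁ φ → Good₁ (λ p → φ (σ k p))
  good₁-σ {φ} {k} k<3 (F , clones) = frame-σ k<3 F , λ {z} {h} ab h<63 dz {p} p<63 →
    trans (clones {z} {σ k h} (λ {q} q<63 → subst (λ r → 1 ≤ d z (φ r)) (σσ k<3 q<63) (ab (σ<63 k<3 q<63)))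
                  (σ<63 k<3 h<63) dz (σ<63 k<3 p<63))
          (cong suc (row-σ k<3 h<63 p<63))

  -- When only clones occur at distance 1, they play for points at distance 2 the part that the copy
  -- plays for points at distance 1.
  layer₁ : ∀ {φ} → Good₁ φ → ∀ {z a} → Above 1 φ z → Adj z a →
           Above 1 φ a ⊎ (∃ λ k → k < 63 × Clone 1 φ a k)
  layer₁ {φ} (F , clones) {z} {a} above za with on-copy? φ a
  ... | inj₁ (p , p<63 , refl) = contradiction (above p<63) (ℕ.<⇒≱ (s≤s (ℕ.≤-reflexive za)))
  ... | inj₂ a-above with ℕ.anyUpTo? (λ p → d a (φ p) ℕ.≟ 1) 63
  ...   | yes (k , k<63 , e) = inj₂ (k , k<63 , clones {a} a-above k<63 e)
  ...   | no none = inj₁ λ p<63 → ℕ.≤∧≢⇒< (a-above p<63) λ e → none (_ , p<63 , sym e)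

  module L₁ = Layer 1 Good₁ proj₁ good₁-σ layer₁

  -- Either type would put a point of the copy at distance 5: 2 + 3 for type A, 1 + 4 for type B.
  no-second-layer₀ : ∀ {φ z} → Good₁ φ → Above 1 φ z → d z (φ 0) ≢ 2
  no-second-layer₀ {φ} {z} G ab dz with L₁.regularity {φ} {z} G ab dz
  ... | inj₁ clone =
    let p , p∈ , e = find row₀-reaches-3
    in ℕ.<⇒≱ (ℕ.≤-reflexive (sym (trans (clone (∈-upTo⁻ p∈)) (cong (2 +_) e)))) (d≤4 z (φ p))
  ... | inj₂ (b , b∈ , eq) =
    let p , p∈ , e = find (All.lookup labels-reach-4 b∈)
    in ℕ.<⇒≱ (ℕ.≤-reflexive (sym (trans (eq (∈-upTo⁻ p∈)) (cong suc e)))) (d≤4 z (φ p))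

  no-second-layer : ∀ {φ z h} → Good₁ φ → Above 1 φ z → h < 63 → d z (φ h) ≢ 2
  no-second-layer {φ} {z} {h} G ab h<63 dz =
    no-second-layer₀ {λ p → φ (act (word h) p)} {z} (Act.good-act Good₁ good₁-σ (word h) (letters h<63) G)
      (L₁.above-act {φ} {z} h<63 ab) (L₁.move {φ} {z} h<63 dz)

  OnOrClone : (ℕ → Point) → Point → Set
  OnOrClone φ x = ∃ λ k → k < 63 × (x ≡ φ k ⊎ Clone 1 φ x k)

  -- Along a path from `φ 0` the distance to the copy grows by at most 1 per step, and it never
  -- becomes 2.
  on-or-clone : ∀ {φ} → Good₁ φ → ∀ x → OnOrClone φ x
  on-or-clone {φ} G@(F , clones) x = go _ x refl
    where
    settle : ∀ {x k} → k < 63 → d x (φ k) ≤ 2 → OnOrClone φ x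
    settle {x} {k} k<63 le with on-copy? φ x
    ... | inj₁ (p , p<63 , e) = p , p<63 , inj₁ e
    ... | inj₂ ab with ℕ.anyUpTo? (λ p → d x (φ p) ℕ.≟ 1) 63
    ...   | yes (p , p<63 , e) = p , p<63 , inj₂ (clones {x} ab p<63 e)
    ...   | no none = contradiction (ℕ.≤-antisym le (ab₁ k<63)) (no-second-layer {φ} {x} G ab₁ k<63)
      where
      ab₁ : Above 1 φ x
      ab₁ p<63 = ℕ.≤∧≢⇒< (ab p<63) λ e → none (_ , p<63 , sym e)

    extend : ∀ {x y} → Adj x y → OnOrClone φ y → OnOrClone φ x
    extend {x} {y} xy (k , k<63 , inj₁ refl) = settle k<63 (ℕ.≤-trans (ℕ.≤-reflexive xy) (s≤s z≤n))
    extend {x} {y} xy (k , k<63 , inj₂ clone) = settle k<63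
      (ℕ.≤-trans (Adj-step xy (φ k)) (s≤s (ℕ.≤-reflexive (trans (clone k<63) (cong suc (row-self k<63))))))

    go : ∀ n x → d x (φ 0) ≡ n → OnOrClone φ x
    go zero x e = 0 , s≤s z≤n , inj₁ (d≡0⇒≡ e)
    go (suc n) x e = let y , xy , dy = neighbour-towards e in extend xy (go n y dy)

-- The case of classical valuations

opaque
  -- One further point on each of the three lines through g.
  arm : ℕ → Fin 3 → ℕ
  arm g j = nth (concatMap other lines) (toℕ j)
    where
    other : Triple → List ℕ
    other (a , b , c) = if g ≡ᵇ a then b ∷ [] else if g ≡ᵇ b then a ∷ [] else if g ≡ᵇ c then a ∷ [] else []

δ : ℕ → ℕ → ℕ
δ i j = nth (row i) j

-- With `rk` the row of a neighbour `k` of `g`, this says that `k` is on the line of the arm `j`.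
Towards : ℕ → List ℕ → Fin 3 → Set
Towards g rk j = nth rk (arm g j) ≤ 1 × (∀ l → l ≢ j → nth rk (arm g l) ≡ 2)

towards? : ∀ g rk j → Dec (Towards g rk j)
towards? g rk j = nth rk (arm g j) ℕ.≤? 1 ×-dec Fin.all? λ l → ¬? (l Fin.≟ j) →-dec nth rk (arm g l) ℕ.≟ 2

-- The generalised hexagon property: a path `h`, `g`, `q`, `r` that changes lines at `g` and at `q`
-- is a geodesic.
Straight : List ℕ → List ℕ → List ℕ → Set
Straight rq rg rr = All (λ h → nth rg h ≡ 1 → nth rq h ≡ 2 → nth rr h ≡ 3) (upTo 63)

Straights : List ℕ → ℕ → List ℕ → Set
Straights rq g rg = All (λ r → nth rq r ≡ 1 → nth rg r ≤ 1 ⊎ Straight rq rg (row r)) (upTo 63)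

straights? : ∀ rq g rg → Dec (Straights rq g rg)
straights? rq g rg = all? (λ r → nth rq r ℕ.≟ 1 →-dec (nth rg r ℕ.≤? 1 ⊎-dec straight? (row r))) (upTo 63)
  where
  straight? : ∀ rr → Dec (Straight rq rg rr)
  straight? rr = all? (λ h → nth rg h ℕ.≟ 1 →-dec (nth rq h ℕ.≟ 2 →-dec nth rr h ℕ.≟ 3)) (upTo 63)

opaque
  unfolding row arm

  arms-adjacent : All (λ g → ∀ j → arm g j < 63 × δ g (arm g j) ≡ 1) (upTo 63)
  arms-adjacent = by (all? (λ g → Fin.all? λ j → arm g j ℕ.<? 63 ×-dec δ g (arm g j) ℕ.≟ 1) (upTo 63)) refl

  rows≤3 : All (λ h → All (λ p → δ h p ≤ 3) (upTo 63)) (upTo 63)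
  rows≤3 = by (all? (λ h → bounded? (row h)) (upTo 63)) refl
    where
    bounded? : ∀ r → Dec (All (λ p → nth r p ≤ 3) (upTo 63))
    bounded? r = all? (λ p → nth r p ℕ.≤? 3) (upTo 63)

  arms-towards : All (λ g → All (λ k → δ g k ≡ 1 → ∃ (Towards g (row k))) (upTo 63)) (upTo 63)
  arms-towards = by (all? (λ g → neighbours? g (row g)) (upTo 63)) refl
    where
    neighbours? : ∀ g rg → Dec (All (λ k → nth rg k ≡ 1 → ∃ (Towards g (row k))) (upTo 63))
    neighbours? g rg = all? (λ k → nth rg k ℕ.≟ 1 →-dec Fin.any? (towards? g (row k))) (upTo 63)

  straight : All (λ q → All (λ g → δ q g ≡ 1 → Straights (row q) g (row g)) (upTo 63)) (upTo 63)
  straight = by (all? (λ q → from? (row q)) (upTo 63)) refl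
    where
    from? : ∀ rq → Dec (All (λ g → nth rq g ≡ 1 → Straights rq g (row g)) (upTo 63))
    from? rq = all? (λ g → nth rq g ℕ.≟ 1 →-dec straights? rq g (row g)) (upTo 63)

opaque
  δ≡0⇒≡ : ∀ {h j} → h < 63 → j < 63 → δ h j ≡ 0 → j ≡ h
  δ≡0⇒≡ h<63 j<63 e with descent h<63 j<63
  ... | inj₁ eq = eq
  ... | inj₂ (_ , _ , _ , _ , e′) with trans e′ e
  ...   | ()

-- Points over the copy with two neighbours over the same point

module Clones (N : Geometry) (oct : IsNearOctagon N) (order : HasOrder N 2 4) where
  open Geometry N using (Point)
  open NearOctagon N oct order
  open Frames N oct order
  open Outer N oct order

  module AllOver {φ : ℕ → Point} (G : Good₁ φ) where
    F : Frame φ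
    F = proj₁ G

    record Over (x : Point) (h : ℕ) : Set where
      constructor over
      field
        bound : h < 63
        at : Clone 1 φ x h
    open Over

    opaque
      on-or-over : ∀ x → ∃ λ k → k < 63 × (x ≡ φ k ⊎ Over x k)
      on-or-over x with on-or-clone G x
      ... | k , k<63 , inj₁ e = k , k<63 , inj₁ e
      ... | k , k<63 , inj₂ c = k , k<63 , inj₂ (over k<63 c)

    opaque
      δ-sym : ∀ {i j} → i < 63 → j < 63 → δ i j ≡ δ j i
      δ-sym {i} {j} i<63 j<63 = trans (sym (dist F i<63 j<63)) (trans (d-sym (φ i) (φ j)) (dist F j<63 i<63))

    foot-adjacent : ∀ {x h} → Over x h → Adj x (φ h)
    foot-adjacent o = trans (at o (bound o)) (cong suc (row-self (bound o)))

    not-on : ∀ {x h k} → Over x h → k < 63 → x ≢ φ k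
    not-on {k = k} o k<63 refl with trans (sym (d-refl (φ k))) (at o k<63)
    ... | ()

    opaque
      foot-of : ∀ {x h k} → Over x h → k < 63 → Adj x (φ k) → k ≡ h
      foot-of o k<63 e = δ≡0⇒≡ (bound o) k<63 (ℕ.suc-injective (trans (sym (at o k<63)) e))

    over-d : ∀ {x h k n} → Over x h → k < 63 → δ h k ≡ n → d x (φ k) ≡ suc n
    over-d o k<63 e = trans (at o k<63) (cong suc e)

    opaque
      feet-close : ∀ {x y h k} → Over x h → Over y k → Adj x y → δ h k ≤ 1
      feet-close {k = k} ox oy xy = ℕ.≤-pred (ℕ.≤-trans (ℕ.≤-reflexive (sym (at ox (bound oy))))
        (ℕ.≤-trans (Adj-step xy (φ k)) (s≤s (ℕ.≤-reflexive (foot-adjacent oy)))))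

    near-third : ∀ {a b c a′ b′} → Near a b c → a ≡ a′ → b ≡ b′ → third a′ b′ ≡ c
    near-third n refl refl = Near⇒third n

    opaque
      third-d : ∀ {x y z a b} p → Line₃ x y z → d x p ≡ a → d y p ≡ b → d z p ≡ third a b
      third-d p ℓ ex ey = sym (near-third (near′ ℓ p) ex ey)

    opaque
      third-d′ : ∀ {x y z a b} p → Line₃ x y z → d p x ≡ a → d p y ≡ b → d p z ≡ third a b
      third-d′ p ℓ ex ey = sym (near-third (near ℓ p) ex ey)

    HLine : ℕ → ℕ → ℕ → Set
    HLine h k j = h < 63 × k < 63 × j < 63 × Line₃ (φ h) (φ k) (φ j)

    opaque
      -- A third point outside the copy would be adjacent to both `φ h` and `φ k`, but its foot is
      -- unique.
      hline : ∀ {h k} → h < 63 → k < 63 → δ h k ≡ 1 → ∃ λ j → HLine h k j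
      hline {h} {k} h<63 k<63 e with line-of (trans (dist F h<63 k<63) e)
      ... | m , ℓ with on-or-over m
      ...   | j , j<63 , inj₁ refl = j , h<63 , k<63 , j<63 , ℓ
      ...   | j , j<63 , inj₂ o =
        contradiction (cong φ (trans (foot-of o h<63 (Adj-sym (adj₁₃ ℓ))) (sym (foot-of o k<63 (Adj-sym (adj₂₃ ℓ)))))) (ne₁₂ ℓ)

    rotate-h : ∀ {h k j} → HLine h k j → HLine k j h
    rotate-h (a , b , c , ℓ) = b , c , a , rotate ℓ

    flip-h : ∀ {h k j} → HLine h k j → HLine k h j
    flip-h (a , b , c , ℓ) = b , a , c , flip ℓ

    δ₁₂ : ∀ {h k j} → HLine h k j → δ h k ≡ 1
    δ₁₂ (a , b , _ , ℓ) = trans (sym (dist F a b)) (adj₁₂ ℓ)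

    δ₁₃ : ∀ {h k j} → HLine h k j → δ h j ≡ 1
    δ₁₃ (a , _ , c , ℓ) = trans (sym (dist F a c)) (adj₁₃ ℓ)

    opaque
      same-foot-line : ∀ {x y h} → Over x h → Over y h → Adj x y → Line₃ x y (φ h)
      same-foot-line {x} {y} {h} ox oy xy with line-of xy
      ... | z , ℓ = subst (Line₃ x y) (d≡0⇒≡ (third-d (φ h) ℓ (foot-adjacent ox) (foot-adjacent oy))) ℓ

    opaque
      third-over : ∀ {x y w h k j} → HLine h k j → Over x h → Over y k → Line₃ x y w → Over w j
      third-over {x} {y} {w} {h} {k} {j} L@(h<63 , k<63 , j<63 , _) ox oy ℓ with on-or-over w
      ... | i , i<63 , inj₁ refl with foot-of ox i<63 (adj₁₃ ℓ) | foot-of oy i<63 (adj₂₃ ℓ)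
      ...   | refl | refl with trans (sym (row-self h<63)) (δ₁₂ L)
      ...     | ()
      third-over {x} {y} {w} {h} {k} {j} L@(h<63 , k<63 , j<63 , _) ox oy ℓ
        | i , i<63 , inj₂ o with foot-of o j<63 (third-d (φ j) ℓ (over-d ox j<63 (δ₁₃ L)) (over-d oy j<63 (δ₁₂ (rotate-h L))))
      ...   | refl = o

    Mate : ℕ → Point → Point → Set
    Mate h x x′ = Line₃ (φ h) x x′ × Over x′ h

    opaque
      mate-of : ∀ {x h} → Over x h → ∃ (Mate h x)
      mate-of {x} {h} ox with line-of (Adj-sym (foot-adjacent ox))
      ... | x′ , ℓ with on-or-over x′
      ...   | i , i<63 , inj₁ refl = contradiction (cong φ (sym (foot-of ox i<63 (adj₂₃ ℓ)))) (ne₁₃ ℓ)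
      ...   | i , i<63 , inj₂ o with foot-of o (bound ox) (Adj-sym (adj₁₃ ℓ))
      ...     | refl = x′ , ℓ , o

    mate-sym : ∀ {x x′ h} → Over x h → Mate h x x′ → Mate h x′ x
    mate-sym ox (ℓ , _) = rotate (flip ℓ) , ox

    mate-unique : ∀ {x y z h} → Mate h x y → Mate h x z → y ≡ z
    mate-unique (ℓ , _) (m , _) = third-unique ℓ m

    opaque
      Adj⇒Mate : ∀ {x y h} → Over x h → Over y h → Adj x y → Mate h x y
      Adj⇒Mate ox oy xy = rotate (rotate (same-foot-line ox oy xy)) , oy

    opaque
      -- From `y` the points `φ h` and `x` are at distances 2 and 1, hence `x′` is at 2. From `x′`
      -- both `φ k` and `y` are at distance 2, hence `y′` is at 1.
      parallel : ∀ {x x′ y y′ h k} → δ h k ≡ 1 → Over x h → Over y k → Adj x y →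
                 Mate h x x′ → Mate k y y′ → Adj x′ y′
      parallel {x} {x′} {y} {y′} {h} {k} e ox oy xy (ℓ , ox′) (m , oy′) =
        third-d′ x′ m (over-d ox′ (bound oy) e)
          (trans (d-sym x′ y) (third-d′ y ℓ (over-d oy (bound ox) (trans (δ-sym (bound oy) (bound ox)) e)) (Adj-sym xy)))

    Apart : Point → Point → Set
    Apart x y = x ≢ y × ¬ Adj x y

    Apart-sym : ∀ {x y} → Apart x y → Apart y x
    Apart-sym (ne , na) = (λ e → ne (sym e)) , λ a → na (Adj-sym a)

    same-foot-apart : ∀ {x y h} → Over x h → Over y h → Apart x y → d x y ≡ 2
    same-foot-apart {x} {y} {h} ox oy (ne , na) with d x y in e | Adj-step (foot-adjacent ox) y
    ... | 0 | _ = contradiction (d≡0⇒≡ e) ne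
    ... | 1 | _ = contradiction refl na
    ... | 2 | _ = refl
    ... | suc (suc (suc n)) | le with ℕ.≤-trans le (s≤s (ℕ.≤-reflexive (Adj-sym (foot-adjacent oy))))
    ...   | s≤s (s≤s ())

    arm<63 : ∀ {g} → g < 63 → ∀ j → arm g j < 63
    arm<63 g<63 j = proj₁ (all<63 arms-adjacent g<63 j)

    δ-arm : ∀ {g} → g < 63 → ∀ j → δ g (arm g j) ≡ 1
    δ-arm g<63 j = proj₂ (all<63 arms-adjacent g<63 j)

    opaque
      towards : ∀ {g k} → g < 63 → k < 63 → δ g k ≡ 1 → ∃ (Towards g (row k))
      towards g<63 k<63 e = all<63 (all<63 arms-towards g<63) k<63 e

    opaque
      arms-apart : ∀ {g} → g < 63 → ∀ {j l} → l ≢ j → δ (arm g j) (arm g l) ≡ 2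
      arms-apart {g} g<63 {j} {l} l≢j with towards g<63 (arm<63 g<63 j) (δ-arm g<63 j)
      ... | i , _ , others with j Fin.≟ i
      ...   | yes refl = others l l≢j
      ...   | no j≢i with trans (sym (row-self (arm<63 g<63 j))) (others j j≢i)
      ...     | ()

    opaque
      -- Three of the five lines on `φ k` lie in the copy, so all points over `k` are on the
      -- remaining two.
      three-apart : ∀ {u v w k} → Over u k → Over v k → Over w k → Apart u v → Apart u w → Apart v w → ⊥
      three-apart {u} {v} {w} {k} ou ov ow uv uw vw = ℕ.<⇒≱ (ℕ.≤-refl {6})
        (Neighbours.non-collinear≤5 (φ k) (a 0F ∷ a 1F ∷ a 2F ∷ u ∷ v ∷ w ∷ [])
          (adj 0F ∷ adj 1F ∷ adj 2F ∷ Adj-sym (foot-adjacent ou) ∷ Adj-sym (foot-adjacent ov) ∷ Adj-sym (foot-adjacent ow) ∷ [])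
          ((aa 0F 1F (λ ()) ∷ aa 0F 2F (λ ()) ∷ ao 0F ou ∷ ao 0F ov ∷ ao 0F ow ∷ []) ∷
           (aa 1F 2F (λ ()) ∷ ao 1F ou ∷ ao 1F ov ∷ ao 1F ow ∷ []) ∷
           (ao 2F ou ∷ ao 2F ov ∷ ao 2F ow ∷ []) ∷
           (uv ∷ uw ∷ []) ∷ (vw ∷ []) ∷ [] ∷ []))
        where
        k<63 : k < 63
        k<63 = bound ou
        a : Fin 3 → Point
        a j = φ (arm k j)

        adj : ∀ j → Adj (φ k) (a j)
        adj j = trans (dist F k<63 (arm<63 k<63 j)) (δ-arm k<63 j)

        at-distance-2 : ∀ {x y} → d x y ≡ 2 → Apart x y
        at-distance-2 {x} e = (λ { refl → contradiction (trans (sym e) (d-refl x)) λ () }) , λ e′ → contradiction (trans (sym e) e′) λ ()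

        aa : ∀ j l → l ≢ j → Apart (a j) (a l)
        aa j l l≢j = at-distance-2 (trans (dist F (arm<63 k<63 j) (arm<63 k<63 l)) (arms-apart k<63 l≢j))

        ao : ∀ j {x} → Over x k → Apart (a j) x
        ao j {x} o = at-distance-2 (trans (d-sym (a j) x) (over-d o (arm<63 k<63 j) (δ-arm k<63 j)))

    opaque
      compare : ∀ {x y h} → Over x h → Over y h → x ≡ y ⊎ Mate h x y ⊎ Apart x y
      compare {x} {y} ox oy with x ≟ₚ y
      ... | yes e = inj₁ e
      ... | no ne with d x y ℕ.≟ 1
      ...   | yes a = inj₂ (inj₁ (Adj⇒Mate ox oy a))
      ...   | no na = inj₂ (inj₂ (ne , na))

    -- For `x` over a point of the copy, `Two-apart` puts the two neighbours on different lines, so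
    -- they meet both lines leaving the copy at `φ k`.
    record Two (x : Point) (k : ℕ) : Set where
      constructor two
      field
        {y₁ y₂} : Point
        over₁ : Over y₁ k
        over₂ : Over y₂ k
        y₁≢y₂ : y₁ ≢ y₂
        adj₁ : Adj x y₁
        adj₂ : Adj x y₂

    Two-apart : ∀ {x h k y₁ y₂} → Over x h → Over y₁ k → Over y₂ k → y₁ ≢ y₂ → Adj x y₁ → Adj x y₂ → Apart y₁ y₂
    Two-apart {x} {h} {k} ox o₁ o₂ ne a₁ a₂ = ne , λ a → not-on ox (bound o₁) (no-triangle (same-foot-line o₁ o₂ a) a₁ a₂)

    Two-third : ∀ {x h k j} → HLine h k j → Over x h → Two x k → Two x j
    Two-third {x} L ox (two {y₁} o₁ o₂ ne a₁ a₂) =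
      let w₁ , ℓ₁ = line-of a₁
          w₂ , ℓ₂ = line-of a₂
      in two (third-over L ox o₁ ℓ₁) (third-over L ox o₂ ℓ₂)
             (λ e → ne (third-unique (rotate (flip (subst (Line₃ x y₁) e ℓ₁))) (rotate (flip ℓ₂))))
             (adj₁₃ ℓ₁) (adj₁₃ ℓ₂)

    Two-mate : ∀ {x x′ h k} → δ h k ≡ 1 → Over x h → Mate h x x′ → Two x k → Two x′ k
    Two-mate {k = k} e ox mx (two {y₁} o₁ o₂ ne a₁ a₂) =
      let z₁ , m₁ = mate-of o₁
          z₂ , m₂ = mate-of o₂
      in two (proj₂ m₁) (proj₂ m₂)
             (λ e′ → ne (mate-unique (subst (λ z → Mate k z y₁) e′ (mate-sym o₁ m₁)) (mate-sym o₂ m₂)))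
             (parallel e ox o₁ a₁ mx m₁) (parallel e ox o₂ a₂ mx m₂)

    opaque
      -- w₁ is on the other line through h, so both lines through k meet both lines through h.
      Two-other : ∀ {x h k j} → HLine h k j → Over x h → (t : Two x k) →
                  ∃ λ w → Over w h × Apart w x × Two w k × Adj (Two.y₁ t) w
      Two-other {x} {h} {k} {j} L ox (two {y₁} {y₂} o₁ o₂ ne a₁ a₂) =
        let w₁ , ow₁ , apart₁ , c₁ = partner o₁ o₂ y₁y₂ a₁ a₂
            w₂ , ow₂ , apart₂ , c₂ = partner o₂ o₁ (Apart-sym y₁y₂) a₂ a₁
        in w₁ , ow₁ , apart₁ , both w₁ w₂ ow₁ ow₂ apart₁ apart₂ c₁ c₂ , c₁
        where
        e : δ h k ≡ 1
        e = δ₁₂ L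
        e′ : δ k h ≡ 1
        e′ = δ₁₂ (flip-h L)
        y₁y₂ : Apart y₁ y₂
        y₁y₂ = Two-apart ox o₁ o₂ ne a₁ a₂

        across : ∀ {u v v′} → Over u k → Over v k → Apart u v → Mate k v v′ → d u v′ ≡ 2
        across {u} ou ov uv (ℓ , _) = third-d′ u ℓ (foot-adjacent ou) (same-foot-apart ou ov uv)

        -- The mates `x′` of `x` and `z` of `v` are adjacent and both at distance 2 from `u`, so the
        -- third point `t` of their line is adjacent to `u`. The third point of the line on `u` and
        -- `t` is over `h` again.
        partner : ∀ {u v} → Over u k → Over v k → Apart u v → Adj x u → Adj x v →
                  ∃ λ w → Over w h × Apart w x × Adj u w
        partner {u} {v} ou ov uv xu xv =
          let x′ , mx = mate-of ox
              z , mz = mate-of ov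
              x′z = parallel e ox ov xv mx mz
              t , ℓ = line-of x′z
              ot = third-over L (proj₂ mx) (proj₂ mz) ℓ
              ux′ : d u x′ ≡ 2
              ux′ = third-d′ u (proj₁ mx) (over-d ou (bound ox) e′) (Adj-sym xu)
              ut : Adj u t
              ut = third-d′ u ℓ ux′ (across ou ov uv mz)
              w , ℓ′ = line-of ut
              ow = third-over (rotate-h L) ou ot ℓ′
          in w , ow ,
             ((λ e″ → not-on ot (bound ox) (no-triangle (rotate (proj₁ mx)) (subst (Adj t) e″ (adj₂₃ ℓ′)) (Adj-sym (adj₁₃ ℓ)))) ,
              λ wx → contradiction (trans (sym ux′) (subst (Adj u) (mate-unique (Adj⇒Mate ox ow (Adj-sym wx)) mx) (adj₁₃ ℓ′))) λ ()) ,
             adj₁₃ ℓ′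

        both : ∀ w₁ w₂ → Over w₁ h → Over w₂ h → Apart w₁ x → Apart w₂ x → Adj y₁ w₁ → Adj y₂ w₂ → Two w₁ k
        both w₁ w₂ ow₁ ow₂ apart₁ apart₂ c₁ c₂ with compare ow₁ ow₂
        ... | inj₁ refl = two o₁ o₂ ne (Adj-sym c₁) (Adj-sym c₂)
        ... | inj₂ (inj₂ apart) = ⊥-elim (three-apart ow₁ ow₂ ox apart apart₁ apart₂)
        -- If `w₁` and `w₂` are mates, passing to mates at both ends of the edge from `w₂` to `y₂`
        -- gives a second neighbour of `w₁`.
        ... | inj₂ (inj₁ m) =
          let z₂ , mz₂ = mate-of o₂
          in two o₁ (proj₂ mz₂)
               (λ e″ → contradiction (trans (sym (d-refl y₁)) (trans (cong (d y₁) e″) (across o₁ o₂ y₁y₂ mz₂))) λ ())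
               (Adj-sym c₁) (parallel e ow₂ o₂ (Adj-sym c₂) (mate-sym ow₁ m) mz₂)

    TwoLine : ℕ → ℕ → Set
    TwoLine h k = ∀ {w} → Over w h → Two w k

    opaque
      -- `x` and the point `w₁` of `Two-other` are on the two lines leaving the copy at `φ h`, so
      -- every point over `h` is one of them or a mate of one.
      Two⇒TwoLine : ∀ {x h k j} → HLine h k j → Over x h → Two x k → TwoLine h k
      Two⇒TwoLine L ox t {w} ow with Two-other L ox t
      ... | w₁ , ow₁ , apart₁ , t₁ , _ with compare ox ow | compare ow₁ ow
      ...   | inj₁ refl | _ = t
      ...   | inj₂ (inj₁ m) | _ = Two-mate (δ₁₂ L) ox m t
      ...   | _ | inj₁ refl = t₁
      ...   | _ | inj₂ (inj₁ m) = Two-mate (δ₁₂ L) ow₁ m t₁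
      ...   | inj₂ (inj₂ a) | inj₂ (inj₂ b) = ⊥-elim (three-apart ow₁ ox ow apart₁ b a)

      -- The first neighbour of `x` over `k` is adjacent to `x` and to the point `w₁` of
      -- `Two-other`, both over `h`.
      TwoLine-back : ∀ {x h k j} → HLine h k j → Over x h → Two x k → TwoLine k h
      TwoLine-back L ox t with Two-other L ox t
      ... | w₁ , ow₁ , (ne , _) , _ , c₁ =
        Two⇒TwoLine (flip-h L) (Two.over₁ t) (two ox ow₁ (λ e → ne (sym e)) (Adj-sym (Two.adj₁ t)) c₁)

      -- If y and z are both at distance at most 1 + m from a, while the foot k is at distance 2 + m,
      -- then they are on different lines through k; so at most two points over k are that close.
      close-apart : ∀ {a y z k m} → d a (φ k) ≡ 2 + m → Over y k → Over z k → y ≢ z →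
                    d a y ≤ 1 + m → d a z ≤ 1 + m → Apart y z
      close-apart {a} {y} {z} {k} {m} e oy oz ne ly lz = ne , λ yz → impossible (near (same-foot-line oy oz yz) a) ly lz e
        where
        impossible : ∀ {p q r} → Near p q r → p ≤ 1 + m → q ≤ 1 + m → r ≡ 2 + m → ⊥
        impossible near₁ lp lq refl = ℕ.<⇒≱ (ℕ.n<1+n _) lq
        impossible near₂ lp lq refl = ℕ.<⇒≱ (ℕ.n<1+n _) lp
        impossible near₃ lp lq refl = ℕ.<⇒≱ (ℕ.n≤1+n _) lp

      among-two : ∀ {a y₁ y₂ z k m} → d a (φ k) ≡ 2 + m → Over y₁ k → Over y₂ k → y₁ ≢ y₂ → Over z k →
                  d a y₁ ≤ 1 + m → d a y₂ ≤ 1 + m → d a z ≤ 1 + m → z ≡ y₁ ⊎ z ≡ y₂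
      among-two {y₁ = y₁} {y₂} {z} e o₁ o₂ ne oz l₁ l₂ lz with z ≟ₚ y₁ | z ≟ₚ y₂
      ... | yes p | _ = inj₁ p
      ... | _ | yes p = inj₂ p
      ... | no p | no q = ⊥-elim (three-apart o₁ o₂ oz (close-apart e o₁ o₂ ne l₁ l₂)
              (close-apart e o₁ oz (λ r → p (sym r)) l₁ lz) (close-apart e o₂ oz (λ r → q (sym r)) l₂ lz))

      -- At most two points over `k`, and at most two over `j`, are within `1 + m` of `a`. So `x₁`
      -- and `x₂` have the same neighbours over `k`, and the third points over `j` on the joining
      -- lines are shared as well. Then `x₂` is adjacent to two points of a line through `x₁`, and
      -- coincides with it.
      no-common-approach : ∀ {a x₁ x₂ h k j m} → HLine h k j → Over x₁ h → Over x₂ h → x₁ ≢ x₂ →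
                           Two x₁ k → Two x₂ k → d a x₁ ≤ m → d a x₂ ≤ m →
                           d a (φ k) ≡ 2 + m → d a (φ j) ≡ 2 + m → ⊥
      no-common-approach {a} {x₁} {x₂} {h} {k} {j} {m} L ox₁ ox₂ x₁≢x₂
        (two {y₁} {y₂} o₁ o₂ ne a₁ a₂) (two {z₁} {z₂} p₁ p₂ ne′ b₁ b₂) l₁ l₂ ek ej =
        finish (among p₁ b₁) (among p₂ b₂)
        where
        step≤ : ∀ {x y} → d a x ≤ m → Adj x y → d a y ≤ 1 + m
        step≤ {x} {y} l xy = ℕ.≤-trans (ℕ.≤-reflexive (d-sym a y))
          (ℕ.≤-trans (Adj-step (Adj-sym xy) a) (s≤s (ℕ.≤-trans (ℕ.≤-reflexive (d-sym x a)) l)))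

        among : ∀ {z} → Over z k → Adj x₂ z → z ≡ y₁ ⊎ z ≡ y₂
        among oz b = among-two ek o₁ o₂ ne oz (step≤ l₁ a₁) (step≤ l₁ a₂) (step≤ l₂ b)

        shared : Adj x₂ y₁ → Adj x₂ y₂ → ⊥
        shared c₁ c₂ =
          let w₁ , ℓ₁ = line-of a₁
              w₂ , ℓ₂ = line-of a₂
              v , ℓ = line-of c₁
              w₁≢w₂ = λ e → ne (third-unique (rotate (flip (subst (Line₃ x₁ y₁) e ℓ₁))) (rotate (flip ℓ₂)))
          in case (among-two ej (third-over L ox₁ o₁ ℓ₁) (third-over L ox₁ o₂ ℓ₂) w₁≢w₂ (third-over L ox₂ o₁ ℓ)
                    (step≤ l₁ (adj₁₃ ℓ₁)) (step≤ l₁ (adj₁₃ ℓ₂)) (step≤ l₂ (adj₁₃ ℓ))) ℓ₁ ℓ₂ ℓ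
          where
          case : ∀ {v w₁ w₂} → v ≡ w₁ ⊎ v ≡ w₂ → Line₃ x₁ y₁ w₁ → Line₃ x₁ y₂ w₂ → Line₃ x₂ y₁ v → ⊥
          case (inj₁ refl) ℓ₁ ℓ₂ ℓ = x₁≢x₂ (sym (no-triangle (rotate ℓ₁) c₁ (adj₁₃ ℓ)))
          case (inj₂ refl) ℓ₁ ℓ₂ ℓ = x₁≢x₂ (sym (no-triangle (rotate ℓ₂) c₂ (adj₁₃ ℓ)))

        finish : z₁ ≡ y₁ ⊎ z₁ ≡ y₂ → z₂ ≡ y₁ ⊎ z₂ ≡ y₂ → ⊥
        finish (inj₁ refl) (inj₁ refl) = ne′ refl
        finish (inj₁ refl) (inj₂ refl) = shared b₁ b₂
        finish (inj₂ refl) (inj₁ refl) = shared b₂ b₁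
        finish (inj₂ refl) (inj₂ refl) = ne′ refl

    H-third : ∀ {h k j a} → HLine h k j → a < 63 → δ h a ≡ 1 → δ k a ≡ 1 → a ≡ j
    H-third (h<63 , k<63 , j<63 , ℓ) a<63 ha ka = δ≡0⇒≡ j<63 a<63 (trans (sym (dist F j<63 a<63))
      (trans (cong (d (φ _)) (no-triangle ℓ (Adj-sym (trans (dist F h<63 a<63) ha)) (Adj-sym (trans (dist F k<63 a<63) ka))))
             (d-refl (φ _))))

    data AtMost1 (n : ℕ) : Set where
      is-0 : n ≡ 0 → AtMost1 n
      is-1 : n ≡ 1 → AtMost1 n

    atMost1 : ∀ {n} → n ≤ 1 → AtMost1 n
    atMost1 z≤n = is-0 refl
    atMost1 (s≤s z≤n) = is-1 refl

    -- A line on a point over `g` goes to its foot or lies over one of the three lines of the copy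
    -- on `g`; the latter is recorded by the point over the chosen `arm`.
    Class : Point → ℕ → Geometry.Line N → Set
    Class y g L = Geometry.inc N (φ g) L ≡ true
                ⊎ ∃ λ j → ∃ λ u → Geometry.inc N u L ≡ true × y ≢ u × Over u (arm g j)

    opaque
      class : ∀ {y g L} → Over y g → Geometry.inc N y L ≡ true → Class y g L
      class {y} {g} {L} oy yL = go (others yL)
        where
        g<63 : g < 63
        g<63 = bound oy

        on-arm : ∀ {u v k} (ℓ : Line₃ y u v) → through ℓ ≡ L → Over u k → δ g k ≡ 1 → Class y g L
        on-arm {u} {v} {k} ℓ refl ou gk = pick (towards g<63 (bound ou) gk) (hline g<63 (bound ou) gk)
          where
          pick : ∃ (Towards g (row k)) → ∃ (HLine g k) → Class y g L
          pick (j , close , _) (i , H) with atMost1 close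
          ... | is-0 e = inj₂ (j , u , on₂ ℓ , ne₁₂ ℓ , subst (Over u) (sym (δ≡0⇒≡ (bound ou) (arm<63 g<63 j) e)) ou)
          ... | is-1 e = inj₂ (j , v , on₃ ℓ , ne₁₃ ℓ ,
                  subst (Over v) (sym (H-third H (arm<63 g<63 j) (δ-arm g<63 j) e)) (third-over H oy ou ℓ))

        go : (∃ λ u → ∃ λ v → Σ (Line₃ y u v) λ ℓ → through ℓ ≡ L) → Class y g L
        go (u , v , ℓ , refl) with on-or-over u
        ... | k , k<63 , inj₁ refl = inj₁ (subst (λ i → Geometry.inc N (φ i) (through ℓ) ≡ true) (foot-of oy k<63 (adj₁₂ ℓ)) (on₂ ℓ))
        ... | k , k<63 , inj₂ ou with atMost1 (feet-close oy ou (adj₁₂ ℓ))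
        ...   | is-1 e = on-arm ℓ refl ou e
        ...   | is-0 e with δ≡0⇒≡ g<63 k<63 e
        ...     | refl = inj₁ (subst (λ w → Geometry.inc N w (through ℓ) ≡ true)
                           (third-unique ℓ (same-foot-line oy ou (adj₁₂ ℓ))) (on₃ ℓ))

      same-line : ∀ {y u L M} → y ≢ u → Geometry.inc N y L ≡ true → Geometry.inc N u L ≡ true →
                  Geometry.inc N y M ≡ true → Geometry.inc N u M ≡ true → L ≡ M
      same-line {y} {u} {L} {M} ne yL uL yM uM = linear y u L M ne yL uL yM uM

      slot : ∀ {y g L} → Class y g L → Fin 4
      slot (inj₁ _) = zero
      slot (inj₂ (j , _)) = suc j

      collide : ∀ {y g L M} → Over y g → Geometry.inc N y L ≡ true → Geometry.inc N y M ≡ true → L ≢ M →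
                (cL : Class y g L) (cM : Class y g M) → slot cL ≡ slot cM → ∃ λ j → Two y (arm g j)
      collide oy yL yM L≢M (inj₁ a) (inj₁ b) _ =
        contradiction (same-line (not-on oy (bound oy)) yL a yM b) L≢M
      collide oy yL yM L≢M (inj₂ (j , u , uL , y≢u , ou)) (inj₂ (.j , v , vM , y≢v , ov)) refl =
        j , two ou ov (λ { refl → L≢M (same-line y≢u yL uL yM vM) })
                (Collinear⇒Adj (_ , yL , uL) y≢u) (Collinear⇒Adj (_ , yM , vM) y≢v)

      -- Five lines fall into four slots, and only one of them goes to the foot, so two lie over the
      -- same arm.
      two-arm : ∀ {y g} → Over y g → ∃ λ j → Two y (arm g j)
      two-arm {y} {g} oy =
        let i , i′ , i<i′ , e = Fin.pigeonhole (ℕ.≤-refl {5}) (λ i → slot (class oy (Through.on-line y i)))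
        in collide oy (Through.on-line y i) (Through.on-line y i′)
             (λ e → Fin.<⇒≢ i<i′ (Through.line-injective y i i′ e))
             (class oy (Through.on-line y i)) (class oy (Through.on-line y i′)) e

      remaining-arm : ∀ (j l i i′ : Fin 3) → l ≢ j → i ≢ j → i ≢ l → i′ ≢ j → i′ ≢ l → i ≡ i′
      remaining-arm = by (Fin.all? λ j → Fin.all? λ l → Fin.all? λ i → Fin.all? λ i′ →
        ¬? (l Fin.≟ j) →-dec (¬? (i Fin.≟ j) →-dec (¬? (i Fin.≟ l) →-dec (¬? (i′ Fin.≟ j) →-dec (¬? (i′ Fin.≟ l) →-dec i Fin.≟ i′))))) refl

      -- At most two of the lines through y go over the arm j, and one through the foot of y; so if the other
      -- arms are met at most once each, all of them are met.
      meets-arm : ∀ {y g x₀ j l} → Over y g → Over x₀ (arm g j) → l ≢ j →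
                  (∀ i → i ≢ j → ¬ Two y (arm g i)) → ∃ λ z → Over z (arm g l) × Adj y z
      meets-arm {y} {g} {x₀} {j} {l} oy o₀ l≢j few = go (Fin.any? λ i → slot (classAt i) Fin.≟ suc l)
        where
        classAt : ∀ i → Class y g (Through.line y i)
        classAt i = class oy (Through.on-line y i)

        extract : ∀ {L} → Geometry.inc N y L ≡ true → (c : Class y g L) → slot c ≡ suc l → ∃ λ z → Over z (arm g l) × Adj y z
        extract yL (inj₂ (_ , u , uL , y≢u , ou)) refl = u , ou , Collinear⇒Adj (_ , yL , uL) y≢u

        -- If no line goes over the arm `l`, four slots remain: the foot, the one arm other than `j`
        -- and `l`, and the two lines leaving the copy at the arm `j`, told apart by `x₀`.
        slot′ : ∀ {L} → Class y g L → Fin 4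
        slot′ (inj₁ _) = zero
        slot′ (inj₂ (i , u , _ , _ , ou)) with i Fin.≟ j
        ... | no _ = suc zero
        ... | yes refl with compare o₀ ou
        ...   | inj₂ (inj₂ _) = suc (suc zero)
        ...   | inj₁ _ = suc (suc (suc zero))
        ...   | inj₂ (inj₁ _) = suc (suc (suc zero))

        not-both : ∀ {L M u v} → Geometry.inc N y L ≡ true → Geometry.inc N u L ≡ true → y ≢ u → Over u (arm g j) →
                   Geometry.inc N y M ≡ true → Geometry.inc N v M ≡ true → y ≢ v → Over v (arm g j) → L ≢ M → Apart u v
        not-both yL uL y≢u ou yM vM y≢v ov L≢M =
          Two-apart oy ou ov (λ { refl → L≢M (same-line y≢u yL uL yM vM) })
            (Collinear⇒Adj (_ , yL , uL) y≢u) (Collinear⇒Adj (_ , yM , vM) y≢v)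

        clash : ∀ {L M} → Geometry.inc N y L ≡ true → Geometry.inc N y M ≡ true → L ≢ M →
                (c : Class y g L) (c′ : Class y g M) → slot c ≢ suc l → slot c′ ≢ suc l → slot′ c ≡ slot′ c′ → ⊥
        clash yL yM L≢M (inj₁ a) (inj₁ b) _ _ _ = L≢M (same-line (not-on oy (bound oy)) yL a yM b)
        clash yL yM L≢M (inj₁ a) (inj₂ (i , u , uM , y≢u , ou)) _ _ e with i Fin.≟ j
        clash yL yM L≢M (inj₁ a) (inj₂ (i , u , uM , y≢u , ou)) _ _ () | no _
        ... | yes refl with compare o₀ ou
        clash yL yM L≢M (inj₁ a) (inj₂ (i , u , uM , y≢u , ou)) _ _ () | yes refl | inj₁ _
        clash yL yM L≢M (inj₁ a) (inj₂ (i , u , uM , y≢u , ou)) _ _ () | yes refl | inj₂ (inj₁ _)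
        clash yL yM L≢M (inj₁ a) (inj₂ (i , u , uM , y≢u , ou)) _ _ () | yes refl | inj₂ (inj₂ _)
        clash yL yM L≢M c@(inj₂ _) c′@(inj₁ _) n n′ e = clash yM yL (λ e′ → L≢M (sym e′)) c′ c n′ n (sym e)
        clash yL yM L≢M (inj₂ (i , u , uL , y≢u , ou)) (inj₂ (i′ , v , vM , y≢v , ov)) n n′ e
          with i Fin.≟ j | i′ Fin.≟ j
        ... | no i≢j | no i′≢j with remaining-arm j l i i′ l≢j i≢j (λ { refl → n refl }) i′≢j (λ { refl → n′ refl })
        ...   | refl = few i i≢j (two ou ov (λ { refl → L≢M (same-line y≢u yL uL yM vM) })
                         (Collinear⇒Adj (_ , yL , uL) y≢u) (Collinear⇒Adj (_ , yM , vM) y≢v))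
        clash yL yM L≢M (inj₂ (i , u , uL , y≢u , ou)) (inj₂ (i′ , v , vM , y≢v , ov)) n n′ e
          | no _ | yes refl with compare o₀ ov
        clash _ _ _ (inj₂ _) (inj₂ _) n n′ () | no _ | yes refl | inj₁ _
        clash _ _ _ (inj₂ _) (inj₂ _) n n′ () | no _ | yes refl | inj₂ (inj₁ _)
        clash _ _ _ (inj₂ _) (inj₂ _) n n′ () | no _ | yes refl | inj₂ (inj₂ _)
        clash yL yM L≢M (inj₂ (i , u , uL , y≢u , ou)) (inj₂ (i′ , v , vM , y≢v , ov)) n n′ e
          | yes refl | no _ with compare o₀ ou
        clash _ _ _ (inj₂ _) (inj₂ _) n n′ () | yes refl | no _ | inj₁ _
        clash _ _ _ (inj₂ _) (inj₂ _) n n′ () | yes refl | no _ | inj₂ (inj₁ _)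
        clash _ _ _ (inj₂ _) (inj₂ _) n n′ () | yes refl | no _ | inj₂ (inj₂ _)
        clash yL yM L≢M (inj₂ (i , u , uL , y≢u , ou)) (inj₂ (i′ , v , vM , y≢v , ov)) n n′ e
          | yes refl | yes refl
          with compare o₀ ou | compare o₀ ov | not-both yL uL y≢u ou yM vM y≢v ov L≢M
        ... | inj₁ refl | inj₁ refl | ne , _ = ne refl
        ... | inj₁ refl | inj₂ (inj₁ m) | _ , na = na (adj₂₃ (proj₁ m))
        ... | inj₂ (inj₁ m) | inj₁ refl | _ , na = na (Adj-sym (adj₂₃ (proj₁ m)))
        ... | inj₂ (inj₁ m) | inj₂ (inj₁ m′) | ne , _ = ne (mate-unique m m′)
        ... | inj₂ (inj₂ a) | inj₂ (inj₂ b) | c = three-apart o₀ ou ov a b c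
        clash _ _ _ (inj₂ _) (inj₂ _) n n′ () | yes refl | yes refl | inj₁ _ | inj₂ (inj₂ _) | _
        clash _ _ _ (inj₂ _) (inj₂ _) n n′ () | yes refl | yes refl | inj₂ (inj₁ _) | inj₂ (inj₂ _) | _
        clash _ _ _ (inj₂ _) (inj₂ _) n n′ () | yes refl | yes refl | inj₂ (inj₂ _) | inj₁ _ | _
        clash _ _ _ (inj₂ _) (inj₂ _) n n′ () | yes refl | yes refl | inj₂ (inj₂ _) | inj₂ (inj₁ _) | _

        go : Dec (∃ λ i → slot (classAt i) ≡ suc l) → ∃ λ z → Over z (arm g l) × Adj y z
        go (yes (i , e)) = extract (Through.on-line y i) (classAt i) e
        go (no none) =
          let i , i′ , i<i′ , e = Fin.pigeonhole (ℕ.≤-refl {5}) (λ i → slot′ (classAt i))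
          in ⊥-elim (clash (Through.on-line y i) (Through.on-line y i′)
               (λ e → Fin.<⇒≢ i<i′ (Through.line-injective y i i′ e))
               (classAt i) (classAt i′) (λ e → none (i , e)) (λ e → none (i′ , e)) e)

      -- A path `h`, `g`, `q`, `r` in the copy is chosen that never turns back. Over it lie `x`, two
      -- neighbours `y₁`, `y₂` of `x` over `g`, and neighbours `z₁`, `z₂` of these over `q`; beyond
      -- them `no-common-approach` fails for `x`.
      impossible : ∀ {x h} → Over x h → ⊥
      impossible {x} {h} ox = start (two-arm ox)
        where
        h<63 : h < 63
        h<63 = bound ox

        module Second {g} (g<63 : g < 63) (hg : δ h g ≡ 1) (tx : Two x g) (H : ∃ (HLine h g))
                      (T : ∃ (Towards g (row h))) where
          open Two tx renaming (over₁ to oy₁; over₂ to oy₂; adj₁ to xy₁; adj₂ to xy₂)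
          gh : δ g h ≡ 1
          gh = trans (δ-sym g<63 h<63) hg
          j : Fin 3
          j = proj₁ T

          -- Otherwise both `y₁` and `y₂` have two neighbours over `arm g i`. They are at distance 1
          -- from `x`, and the points of the copy beyond `g` on that line are at distance 3:
          -- `no-common-approach` with `m = 1`.
          no-other : ∀ i → i ≢ j → ∀ {y} → Over y g → ¬ Two y (arm g i)
          no-other i i≢j oy ty = approach (hline g<63 q<63 (δ-arm g<63 i))
            where
            q<63 : arm g i < 63
            q<63 = arm<63 g<63 i
            hq : δ h (arm g i) ≡ 2
            hq = proj₂ (proj₂ T) i i≢j
            approach : ∃ (HLine g (arm g i)) → ⊥
            approach (r , L@(_ , _ , r<63 , ℓ)) =
              let both = Two⇒TwoLine L oy ty
                  hr = trans (sym (dist F h<63 r<63))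
                         (third-d′ (φ h) ℓ (trans (dist F h<63 g<63) hg) (trans (dist F h<63 q<63) hq))
              in no-common-approach L oy₁ oy₂ y₁≢y₂ (both oy₁) (both oy₂)
                   (ℕ.≤-reflexive xy₁) (ℕ.≤-reflexive xy₂) (over-d ox q<63 hq) (over-d ox r<63 hr)

          -- Depending on the choice made by `arm`, the point over the arm pointing back to `h` is
          -- `x` itself or the third point of the line on `x` and `y`.
          reference : ∀ {y} → Over y g → Adj x y → ∃ λ x₀ → Over x₀ (arm g j)
          reference {y} oy xy = pick H (atMost1 (proj₁ (proj₂ T)))
            where
            pick : ∃ (HLine h g) → AtMost1 (nth (row h) (arm g j)) → ∃ λ x₀ → Over x₀ (arm g j)
            pick _ (is-0 e) = x , subst (Over x) (sym (δ≡0⇒≡ h<63 (arm<63 g<63 j) e)) ox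
            pick (i , L) (is-1 e) =
              let w , ℓ = line-of xy
              in w , subst (Over w) (sym (H-third L (arm<63 g<63 j) e (δ-arm g<63 j))) (third-over L ox oy ℓ)

          other : ∀ (i : Fin 3) → ∃ λ l → l ≢ i
          other zero = suc zero , λ ()
          other (suc _) = zero , λ ()

          l : Fin 3
          l = proj₁ (other j)
          l≢j : l ≢ j
          l≢j = proj₂ (other j)
          q : ℕ
          q = arm g l
          q<63 : q < 63
          q<63 = arm<63 g<63 l
          gq : δ g q ≡ 1
          gq = δ-arm g<63 l
          qg : δ q g ≡ 1
          qg = trans (δ-sym q<63 g<63) gq
          hq : δ h q ≡ 2
          hq = proj₂ (proj₂ T) l l≢j
          qh : δ q h ≡ 2
          qh = trans (δ-sym q<63 h<63) hq

          -- `TwoLine-back` would give `y₁` two neighbours over `q`, which `no-other` forbids.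
          not-back : ∀ {z} → Over z q → ¬ Two z g
          not-back oz tz = let _ , L = hline q<63 g<63 qg in no-other l l≢j oy₁ (TwoLine-back L oz tz oy₁)

          next : ∀ {y} → Over y g → Adj x y → ∃ λ z → Over z q × Adj y z
          next oy xy = meets-arm oy (proj₂ (reference oy xy)) l≢j (λ i i≢j → no-other i i≢j oy)

          finish : ∀ {z₁ z₂} → Over z₁ q → Adj y₁ z₁ → Over z₂ q → Adj y₂ z₂ → ⊥
          finish {z₁} {z₂} oz₁ yz₁ oz₂ yz₂ with compare oz₁ oz₂
          ... | inj₁ refl = not-back oz₁ (two oy₁ oy₂ y₁≢y₂ (Adj-sym yz₁) (Adj-sym yz₂))
          ... | inj₂ (inj₁ m) =
            let y₁′ , m₁ = mate-of oy₁
            in not-back oz₂ (two (proj₂ m₁) oy₂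
                 (λ e → proj₂ (Two-apart ox oy₁ oy₂ y₁≢y₂ xy₁ xy₂) (subst (Adj y₁) e (adj₂₃ (proj₁ m₁))))
                 (Adj-sym (parallel gq oy₁ oz₁ yz₁ m₁ m)) (Adj-sym yz₂))
          ... | inj₂ (inj₂ (z₁≢z₂ , _)) = away (two-arm oz₁)
            where
            within-2 : ∀ {y z} → Adj x y → Adj y z → d x z ≤ 2
            within-2 xy yz = ℕ.≤-trans (Adj-step xy _) (s≤s (ℕ.≤-reflexive yz))

            away : (∃ λ i → Two z₁ (arm q i)) → ⊥
            away (i , t) = cases (all<63 (all<63 (all<63 straight q<63) g<63 qg) r<63 qr) (hline q<63 r<63 qr)
              where
              r : ℕ
              r = arm q i
              r<63 : r < 63
              r<63 = arm<63 q<63 i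
              qr : δ q r ≡ 1
              qr = δ-arm q<63 i

              cases : δ g r ≤ 1 ⊎ Straight (row q) (row g) (row r) → ∃ (HLine q r) → ⊥
              cases (inj₁ close) (s , L) with atMost1 close
              ... | is-0 e = not-back oz₁ (subst (Two z₁) (δ≡0⇒≡ g<63 r<63 e) t)
              ... | is-1 e = not-back oz₁ (subst (Two z₁) (sym (H-third L g<63 qg (trans (δ-sym r<63 g<63) e))) (Two-third L oz₁ t))
              -- Now `r` and `s` are at distance 3 from `h`, so at distance 4 from `x`, while `z₁`
              -- and `z₂` are within 2: `no-common-approach` with `m = 2`.
              cases (inj₂ str) (s , L@(_ , _ , s<63 , ℓ)) =
                let both = Two⇒TwoLine L oz₁ t
                    hr = trans (δ-sym h<63 r<63) (all<63 str h<63 gh qh)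
                    hs = trans (sym (dist F h<63 s<63))
                           (third-d′ (φ h) ℓ (trans (dist F h<63 q<63) hq) (trans (dist F h<63 r<63) hr))
                in no-common-approach L oz₁ oz₂ z₁≢z₂ t (both oz₂)
                     (within-2 xy₁ yz₁) (within-2 xy₂ yz₂) (over-d ox r<63 hr) (over-d ox s<63 hs)

          conclusion : ⊥
          conclusion = let z₁ , oz₁ , yz₁ = next oy₁ xy₁
                           z₂ , oz₂ , yz₂ = next oy₂ xy₂
                       in finish oz₁ yz₁ oz₂ yz₂

        start : (∃ λ i → Two x (arm h i)) → ⊥
        start (i , t) =
          let g<63 = arm<63 h<63 i
              hg = δ-arm h<63 i
          in Second.conclusion g<63 hg t (hline h<63 g<63 hg) (towards g<63 h<63 (trans (δ-sym g<63 h<63) hg))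

    -- The copy has diameter 3, so one of two points at distance 4 is outside it, and `impossible`
    -- applies to that point.
    no-clones : ⊥
    no-clones with proj₁ (proj₂ (proj₂ oct))
    ... | x , y , D with on-or-over x | on-or-over y
    ...   | _ , _ , inj₂ ox | _ = impossible ox
    ...   | _ | _ , _ , inj₂ oy = impossible oy
    ...   | i , i<63 , inj₁ refl | j , j<63 , inj₁ refl =
      ℕ.<⇒≱ (ℕ.≤-refl {4}) (ℕ.≤-trans (ℕ.≤-reflexive (trans (sym (Dist⇒d D)) (dist F i<63 j<63))) (all<63 (all<63 rows≤3 i<63) j<63))

-- The Hall-Janko near octagon and its distance vectors

indexOf : ℕ → List ℕ → ℕ
indexOf x [] = 0
indexOf x (y ∷ ys) = if x ≡ᵇ y then 0 else suc (indexOf x ys)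

companions : ℕ → Triple → List ℕ
companions i (a , b , c) =
  if i ≡ᵇ a then b ∷ c ∷ [] else if i ≡ᵇ b then a ∷ c ∷ [] else if i ≡ᵇ c then a ∷ b ∷ [] else []

record OnTriple (i q : ℕ) (t : Triple) : Set where
  constructor on-triple
  field
    first : i ∈₃ t
    second : q ∈₃ t
    different : proj₁ t ≢ proj₁ (proj₂ t) → proj₁ t ≢ proj₂ (proj₂ t) → proj₁ (proj₂ t) ≢ proj₂ (proj₂ t) → i ≢ q

companions⇒OnTriple : ∀ {i q} t → q ∈ companions i t → OnTriple i q t
companions⇒OnTriple {i} (a , b , c) q∈ with i ≡ᵇ a in ea
... | true with ≡ᵇ⇒≡ {i} {a} ea | q∈
...   | refl | here refl = on-triple (inj₁ refl) (inj₂ (inj₁ refl)) λ ab _ _ → ab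
...   | refl | there (here refl) = on-triple (inj₁ refl) (inj₂ (inj₂ refl)) λ _ ac _ → ac
companions⇒OnTriple {i} (a , b , c) q∈ | false with i ≡ᵇ b in eb
... | true with ≡ᵇ⇒≡ {i} {b} eb | q∈
...   | refl | here refl = on-triple (inj₂ (inj₁ refl)) (inj₁ refl) λ ab _ _ e → ab (sym e)
...   | refl | there (here refl) = on-triple (inj₂ (inj₁ refl)) (inj₂ (inj₂ refl)) λ _ _ bc → bc
companions⇒OnTriple {i} (a , b , c) q∈ | false | false with i ≡ᵇ c in ec
... | true with ≡ᵇ⇒≡ {i} {c} ec | q∈
...   | refl | here refl = on-triple (inj₂ (inj₂ refl)) (inj₁ refl) λ _ ac _ e → ac (sym e)
...   | refl | there (here refl) = on-triple (inj₂ (inj₂ refl)) (inj₂ (inj₁ refl)) λ _ _ bc e → bc (sym e)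

opaque
  hjLines : List Triple
  hjLines = toList hjLineTable

opaque
  -- The point of the copy nearest to `j`: the zero of the label inside the copy, the unique 1
  -- outside.
  base : ℕ → ℕ
  base j = indexOf (if j <ᵇ 63 then 0 else 1) (label j)

  neighbours : ℕ → List ℕ
  neighbours i = concatMap (companions i) hjLines

  neighbours⁻ : ∀ {i q} → q ∈ neighbours i → ∃ λ t → t ∈ hjLines × q ∈ companions i t
  neighbours⁻ {i} q∈ = find (∈-concatMap⁻ (companions i) {xs = hjLines} q∈)

-- Labels of adjacent points differ by at most 1 everywhere, so this rules out adjacency.
Far : List ℕ → List ℕ → Set
Far u v = Any (λ p → 2 + nth u p ≤ nth v p ⊎ 2 + nth v p ≤ nth u p) (upTo 63)

far-apart? : ∀ u v → Dec (Far u v)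
far-apart? u v = any? (λ p → 2 + nth u p ℕ.≤? nth v p ⊎-dec 2 + nth v p ℕ.≤? nth u p) (upTo 63)

-- A point labelled i outside the copy has a neighbour over the point h, and its label can only be j.
Forces : List ℕ → List ℕ → ℕ → ℕ → Set
Forces u r j h = h < 63 × j < 315 × nth u h ≡ 2 × nth r h ≢ 1 ×
  Far u (map suc (row h)) × All (λ k → k ≡ j ⊎ Far u (label k)) (above h)

forces? : ∀ u r j h → Dec (Forces u r j h)
forces? u r j h = h ℕ.<? 63 ×-dec (j ℕ.<? 315 ×-dec (nth u h ℕ.≟ 2 ×-dec (¬? (nth r h ℕ.≟ 1) ×-dec
  (far-apart? u (map suc (row h)) ×-dec all? (λ k → k ℕ.≟ j ⊎-dec far-apart? u (label k)) (above h)))))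

Edge : ℕ → ℕ → Set
Edge i j = Forces (label i) (row (base i)) j (base j)

edge? : ∀ i j → Dec (Edge i j)
edge? i j = forces? (label i) (row (base i)) j (base j)

Complete : Triple → Set
Complete (a , b , c) = (Edge a b × Edge a c) × (Edge b a × Edge b c) × (Edge c a × Edge c b)

opaque
  -- Entries increase along a line of the table, so its first entry decides that the whole line is
  -- outside the copy.
  outerLines : List Triple
  outerLines = filter (λ (a , b , c) → 63 ℕ.≤? a) hjLines

  outerLines⊆ : ∀ {t} → t ∈ outerLines → t ∈ hjLines × 63 ≤ proj₁ t
  outerLines⊆ t∈ = ∈-filter⁻ (λ (a , b , c) → 63 ℕ.≤? a) {xs = hjLines} t∈

extend : ∀ {P : Set} → Dec P → Triple → List ℕ → List ℕ
extend (yes _) (a , b , c) S = a ∷ b ∷ c ∷ S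
extend (no _) _ S = S

Touches : Triple → List ℕ → Set
Touches (a , b , c) S = a ∈ S ⊎ b ∈ S ⊎ c ∈ S

touches? : ∀ t S → Dec (Touches t S)
touches? (a , b , c) S = a ∈ℕ? S ⊎-dec (b ∈ℕ? S ⊎-dec c ∈ℕ? S)

grow : List Triple → List ℕ → List ℕ
grow [] S = S
grow (t ∷ ts) S = grow ts (extend (touches? t S) t S)

Linked-by : (ℕ → Set) → Triple → Set
Linked-by P (a , b , c) = (P a → P b × P c) × (P b → P a × P c) × (P c → P a × P b)

extend-sound : ∀ {P t S} (D : Dec (Touches t S)) → Linked-by P t → All P S → All P (extend D t S)
extend-sound (no _) _ ps = ps
extend-sound (yes (inj₁ i)) (fa , _) ps = let pa = All.lookup ps i ; pb , pc = fa pa in pa ∷ pb ∷ pc ∷ ps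
extend-sound (yes (inj₂ (inj₁ i))) (_ , fb , _) ps = let pb = All.lookup ps i ; pa , pc = fb pb in pa ∷ pb ∷ pc ∷ ps
extend-sound (yes (inj₂ (inj₂ i))) (_ , _ , fc) ps = let pc = All.lookup ps i ; pa , pb = fc pc in pa ∷ pb ∷ pc ∷ ps

grow-sound : ∀ {P} ts S → All (Linked-by P) ts → All P S → All P (grow ts S)
grow-sound [] S [] ps = ps
grow-sound {P} (t ∷ ts) S (f ∷ fs) ps =
  grow-sound {P} ts (extend (touches? t S) t S) fs (extend-sound {P} {t} {S} (touches? t S) f ps)

opaque
  -- Two passes over the outer lines suffice to reach every outer point from 63, as `all-reached`
  -- confirms.
  reached : List ℕ
  reached = grow outerLines (grow outerLines (63 ∷ []))

  reached-sound : ∀ {P} → All (Linked-by P) outerLines → P 63 → All P reached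
  reached-sound {P} fs p =
    grow-sound {P} outerLines (grow outerLines (63 ∷ [])) fs (grow-sound {P} outerLines (63 ∷ []) fs (p ∷ []))

opaque
  unfolding row hjLines outerLines base

  outerLines-complete : All Complete outerLines
  outerLines-complete = by (all? (λ (a , b , c) → (edge? a b ×-dec edge? a c) ×-dec ((edge? b a ×-dec edge? b c) ×-dec (edge? c a ×-dec edge? c b))) outerLines) refl

opaque
  unfolding row hjLines outerLines reached

  above-reached : All (λ h → All (λ b → 63 ≤ b × b < 315) (above h)) (upTo 63)
  above-reached = by (all? (λ h → all? (λ b → 63 ℕ.≤? b ×-dec b ℕ.<? 315) (above h)) (upTo 63)) refl

  all-reached : All (λ j → j < 63 ⊎ j ∈ reached) (upTo 315)
  all-reached = by (within? reached) refl
    where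
    within? : ∀ S → Dec (All (λ j → j < 63 ⊎ j ∈ S) (upTo 315))
    within? S = all? (λ j → j ℕ.<? 63 ⊎-dec j ∈ℕ? S) (upTo 315)

Profile : ℕ → List ℕ → ℕ → Set
Profile j u b = b < 63 × (j < 63 × foot b ≡ j × nth u b ≡ 0 ⊎
  63 ≤ j × nth u b ≡ 1 × All (λ p → nth u p ≢ 0 × (nth u p ≡ 1 → p ≡ b)) (upTo 63))

opaque
  unfolding row base

  profiles : All (λ j → Profile j (label j) (base j)) (upTo 315)
  profiles = by (all? (λ j → profile? j (label j) (base j)) (upTo 315)) refl
    where
    profile? : ∀ j u b → Dec (Profile j u b)
    profile? j u b = b ℕ.<? 63 ×-dec ((j ℕ.<? 63 ×-dec (foot b ℕ.≟ j ×-dec nth u b ℕ.≟ 0)) ⊎-dec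
      (63 ℕ.≤? j ×-dec (nth u b ℕ.≟ 1 ×-dec all? (λ p → ¬? (nth u p ℕ.≟ 0) ×-dec (nth u p ℕ.≟ 1 →-dec p ℕ.≟ b)) (upTo 63))))

  feet<63 : All (λ h → foot h < 63 × base (foot h) ≡ h) (upTo 63)
  feet<63 = by (all? (λ h → foot h ℕ.<? 63 ×-dec base (foot h) ℕ.≟ h) (upTo 63)) refl

-- A left inverse of `label` on indices below 315, which shows that the labels are distinct.
decode : List ℕ → List ℕ → ℕ
decode u [] = 0
decode u (n ∷ ns) = if does (≡-dec ℕ._≟_ u (digits 10 63 n)) then 0 else suc (decode u ns)

opaque
  unfolding label

  decode-label : All (λ j → decode (label j) labelTable ≡ j) (upTo 315)
  decode-label = by (all? (λ j → decode? j (label j)) (upTo 315)) refl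
    where
    decode? : ∀ j u → Dec (decode u labelTable ≡ j)
    decode? j u = decode u labelTable ℕ.≟ j

NeighboursOK : ℕ → List ℕ → Set
NeighboursOK i ns = length ns ≡ 10 × Unique ns × All (λ j → j < 315 × (i < 63 → nth (label j) (base i) ≡ 1)) ns

neighboursOK? : ∀ i ns → Dec (NeighboursOK i ns)
neighboursOK? i ns = length ns ℕ.≟ 10 ×-dec (allPairs? (λ x y → ¬? (x ℕ.≟ y)) ns ×-dec
  all? (λ j → j ℕ.<? 315 ×-dec (i ℕ.<? 63 →-dec nth (label j) (base i) ℕ.≟ 1)) ns)

opaque
  unfolding row base neighbours hjLines

  neighbours-ok : All (λ i → NeighboursOK i (neighbours i)) (upTo 315)
  neighbours-ok = by (all? (λ i → neighboursOK? i (neighbours i)) (upTo 315)) refl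

  over-neighbours : All (λ j → j < 63 ⊎ j ∈ neighbours (foot (base j))) (upTo 315)
  over-neighbours = by (all? (λ j → j ℕ.<? 63 ⊎-dec j ∈ℕ? neighbours (foot (base j))) (upTo 315)) refl

LineOK : Triple → Set
LineOK (a , b , c) = a < b × b < c × c < 315 × (a < 63 × nth (label b) (base a) ≡ 1 ⊎ 63 ≤ a × Edge a b) ×
  zipWith third (label a) (label b) ≡ label c

lineOK? : ∀ t → Dec (LineOK t)
lineOK? (a , b , c) = a ℕ.<? b ×-dec (b ℕ.<? c ×-dec (c ℕ.<? 315 ×-dec
  (((a ℕ.<? 63 ×-dec nth (label b) (base a) ℕ.≟ 1) ⊎-dec (63 ℕ.≤? a ×-dec edge? a b)) ×-dec
  ≡-dec ℕ._≟_ (zipWith third (label a) (label b)) (label c))))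

-- The lines are listed lexicographically, so comparing consecutive keys is enough to exclude
-- repetitions.
key : Triple → ℕ
key (a , b , _) = 315 * a + b

opaque
  unfolding row base hjLines

  lines-ok : All LineOK hjLines
  lines-ok = by (all? lineOK? hjLines) refl

  keys-increase : Linked (λ s t → key s < key t) hjLines
  keys-increase = by (linked? (λ s t → key s ℕ.<? key t) hjLines) refl

all<315 : ∀ {P : ℕ → Set} → All P (upTo 315) → ∀ {p} → p < 315 → P p
all<315 ps p<315 = All.lookup ps (∈-upTo⁺ p<315)

opaque
  label-injective : ∀ {i j} → i < 315 → j < 315 → (∀ {p} → p < 63 → nth (label i) p ≡ nth (label j) p) → i ≡ j
  label-injective {i} {j} i<315 j<315 e =
    trans (sym (all<315 decode-label i<315))
      (trans (cong (λ u → decode u labelTable) (label-ext i j e)) (all<315 decode-label j<315))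

  label-third : ∀ {a b c} → zipWith third (label a) (label b) ≡ label c → ∀ {p} → p < 63 →
                third (nth (label a) p) (nth (label b) p) ≡ nth (label c) p
  label-third {a} {b} e {p} p<63 =
    trans (sym (nth-zipWith third (label a) (label b) (subst (p <_) (sym (length-label a)) p<63) (subst (p <_) (sym (length-label b)) p<63)))
          (cong (λ u → nth u p) e)

  profile-of : ∀ {j} → j < 315 → Profile j (label j) (base j)
  profile-of = all<315 profiles

  base<63 : ∀ {j} → j < 315 → base j < 63
  base<63 j<315 = proj₁ (profile-of j<315)

  outer-profile : ∀ {j} → 63 ≤ j → j < 315 →
    nth (label j) (base j) ≡ 1 × (∀ {p} → p < 63 → nth (label j) p ≢ 0 × (nth (label j) p ≡ 1 → p ≡ base j))
  outer-profile 63≤j j<315 with proj₂ (profile-of j<315)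
  ... | inj₁ (j<63 , _) = contradiction j<63 (ℕ.≤⇒≯ 63≤j)
  ... | inj₂ (_ , e , ps) = e , all<63 ps

  inner-profile : ∀ {j} → j < 63 → foot (base j) ≡ j × nth (label j) (base j) ≡ 0
  inner-profile j<63 with proj₂ (profile-of (ℕ.<-≤-trans j<63 (ℕ.m≤m+n 63 252)))
  ... | inj₁ (_ , f , e) = f , e
  ... | inj₂ (63≤j , _) = contradiction j<63 (ℕ.≤⇒≯ 63≤j)

  foot<63 : ∀ {h} → h < 63 → foot h < 63
  foot<63 h<63 = proj₁ (all<63 feet<63 h<63)

  base-foot : ∀ {h} → h < 63 → base (foot h) ≡ h
  base-foot h<63 = proj₂ (all<63 feet<63 h<63)

<63⇒<315 : ∀ {j} → j < 63 → j < 315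
<63⇒<315 j<63 = ℕ.<-≤-trans j<63 (ℕ.m≤m+n 63 252)

Far-absurd : ∀ {u v} {f g : ℕ → ℕ} → (∀ {p} → p < 63 → f p ≡ nth u p) → (∀ {p} → p < 63 → g p ≡ nth v p) →
             (∀ p → f p ≤ suc (g p) × g p ≤ suc (f p)) → ¬ Far u v
Far-absurd {u} {v} {f} {g} fu gv close any with find any
... | p , p∈ , inj₁ le = ℕ.<⇒≱ (subst₂ (λ x y → 2 + x ≤ y) (sym (fu (∈-upTo⁻ p∈))) (sym (gv (∈-upTo⁻ p∈))) le) (proj₂ (close p))
... | p , p∈ , inj₂ le = ℕ.<⇒≱ (subst₂ (λ x y → 2 + x ≤ y) (sym (gv (∈-upTo⁻ p∈))) (sym (fu (∈-upTo⁻ p∈))) le) (proj₁ (close p))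

nth-map-suc : ∀ v {p} → p < length v → nth (map suc v) p ≡ suc (nth v p)
nth-map-suc (_ ∷ v) {zero} _ = refl
nth-map-suc (_ ∷ v) {suc p} (s≤s p<) = nth-map-suc v p<

AllPairs-toList : ∀ {A : Set} {R : A → A → Set} {n} (xs : Vec A n) → AllPairs R (toList xs) →
                  ∀ i j → i Fin.< j → R (lookup xs i) (lookup xs j)
AllPairs-toList (_ ∷ xs) (r ∷ _) zero (suc j) _ = All-toList⁻ xs r j
AllPairs-toList (_ ∷ xs) (_ ∷ rs) (suc i) (suc j) (s≤s i<j) = AllPairs-toList xs rs i j i<j

lookup∈toList : ∀ {A : Set} {n} (xs : Vec A n) l → lookup xs l ∈ toList xs
lookup∈toList xs = All-toList⁻ xs (All.tabulate λ x∈ → x∈)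

KeyLess : Triple → Triple → Set
KeyLess s t = key s < key t

opaque
  hjLine : Fin 525 → Triple
  hjLine = lookup hjLineTable

opaque
  unfolding hjLine hjLines

  inc⇒hjLine : ∀ p l → Geometry.inc HJ p l ≡ true → toℕ p ∈₃ hjLine l
  inc⇒hjLine = inc⇒∈₃ hjLineTable

  hjLine⇒inc : ∀ p l → toℕ p ∈₃ hjLine l → Geometry.inc HJ p l ≡ true
  hjLine⇒inc = ∈₃⇒inc hjLineTable

  hjLine∈ : ∀ l → hjLine l ∈ hjLines
  hjLine∈ = lookup∈toList hjLineTable

  hjLine-surjective : ∀ {t} → t ∈ hjLines → ∃ λ l → t ≡ hjLine l
  hjLine-surjective {t} = Any-toList {P = t ≡_} hjLineTable

  keys-ordered : ∀ l m → l Fin.< m → key (hjLine l) < key (hjLine m)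
  keys-ordered = AllPairs-toList {R = KeyLess} hjLineTable (Linked⇒AllPairs {R = KeyLess} ℕ.<-trans keys-increase)

key-injective : ∀ l m → key (hjLine l) ≡ key (hjLine m) → l ≡ m
key-injective l m e with Fin.<-cmp l m
... | tri≈ _ eq _ = eq
... | tri< lt _ _ = contradiction e (ℕ.<⇒≢ (keys-ordered l m lt))
... | tri> _ _ gt = contradiction (sym e) (ℕ.<⇒≢ (keys-ordered m l gt))

Increasing : Triple → Set
Increasing (a , b , c) = a < b × b < c

≤-last : ∀ {t x} → Increasing t → x ∈₃ t → x ≤ proj₂ (proj₂ t)
≤-last (a<b , b<c) (inj₁ refl) = ℕ.<⇒≤ (ℕ.<-trans a<b b<c)
≤-last (a<b , b<c) (inj₂ (inj₁ refl)) = ℕ.<⇒≤ b<c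
≤-last (a<b , b<c) (inj₂ (inj₂ refl)) = ℕ.≤-refl

increasing-key : ∀ {s t} → Increasing s → Increasing t → (∀ {x} → x ∈₃ s → x ∈₃ t) → key s ≡ key t
increasing-key {a , b , c} {a′ , b′ , c′} (a<b , b<c) t↑@(a′<b′ , b′<c′) sub =
  go (sub (inj₁ refl)) (sub (inj₂ (inj₁ refl)))
  where
  c≤c′ : c ≤ c′
  c≤c′ = ≤-last {a′ , b′ , c′} t↑ (sub (inj₂ (inj₂ refl)))

  go : a ∈₃ (a′ , b′ , c′) → b ∈₃ (a′ , b′ , c′) → 315 * a + b ≡ 315 * a′ + b′
  go (inj₁ refl) (inj₁ refl) = contradiction a<b (ℕ.<-irrefl refl)
  go (inj₁ refl) (inj₂ (inj₁ refl)) = refl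
  go _ (inj₂ (inj₂ refl)) = contradiction c≤c′ (ℕ.<⇒≱ b<c)
  go (inj₂ (inj₁ refl)) (inj₁ refl) = contradiction a<b (ℕ.<⇒≯ a′<b′)
  go (inj₂ (inj₁ refl)) (inj₂ (inj₁ refl)) = contradiction a<b (ℕ.<-irrefl refl)
  go (inj₂ (inj₂ refl)) b∈ = contradiction (≤-last {a′ , b′ , c′} t↑ b∈) (ℕ.<⇒≱ a<b)

≡-from-⇔ : ∀ {a b : Bool} → (a ≡ true → b ≡ true) → (b ≡ true → a ≡ true) → a ≡ b
≡-from-⇔ {true} {true} _ _ = refl
≡-from-⇔ {false} {false} _ _ = refl
≡-from-⇔ {true} {false} f _ = sym (f refl)
≡-from-⇔ {false} {true} _ g = g refl

-- Recovering HJ from the labels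

module Labelled (N : Geometry) (oct : IsNearOctagon N) (order : HasOrder N 2 4) where
  open Geometry N using (Point; Line; inc)
  open NearOctagon N oct order
  open Frames N oct order
  open Outer N oct order

  module Realise {φ : ℕ → Point} (F : Frame φ) where

    Real : ℕ → Set
    Real j = ∃ λ x → HasLabel φ x j

    opaque
      foot-label : ∀ {h} → h < 63 → HasLabel φ (φ h) (foot h)
      foot-label {h} h<63 {p} p<63 = trans (dist F h<63 p<63) (cong (λ r → nth r p) (row-foot h))

      is-foot : ∀ {x h} → h < 63 → HasLabel φ x (foot h) → x ≡ φ h
      is-foot {x} {h} h<63 lx = d≡0⇒≡ (trans (lx h<63) (trans (cong (λ r → nth r h) (sym (row-foot h))) (row-self h<63)))

      inner : ∀ {x j} → j < 63 → HasLabel φ x j → x ≡ φ (base j)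
      inner {x} {j} j<63 lx = is-foot (base<63 (<63⇒<315 j<63)) (subst (HasLabel φ x) (sym (proj₁ (inner-profile j<63))) lx)

      adjacent-close : ∀ {x y} → Adj x y → ∀ p → d x (φ p) ≤ suc (d y (φ p)) × d y (φ p) ≤ suc (d x (φ p))
      adjacent-close xy p = Adj-step xy (φ p) , Adj-step (Adj-sym xy) (φ p)

      -- A neighbour `y` of `x` is at distance 1 from `φ (base j)`. If it were in the copy it would
      -- be `φ (base i)`, which is not collinear with that point; type A and all other labels at
      -- `base j` are too far from the label of `x`.
      edge : ∀ {x i j} → 63 ≤ i → i < 315 → Edge i j → HasLabel φ x i → ∃ λ y → Adj x y × HasLabel φ y j
      edge {x} {i} {j} 63≤i i<315 (h<63 , j<315 , at-2 , not-near , far-clone , far-labels) lx =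
        go (neighbour-towards (trans (lx h<63) at-2))
        where
        h : ℕ
        h = base j

        go : (∃ λ y → Adj x y × d y (φ h) ≡ 1) → ∃ λ y → Adj x y × HasLabel φ y j
        go (y , xy , dy) with on-copy? φ y
        ... | inj₁ (q , q<63 , refl) = contradiction
                (subst (λ r → nth (row r) h ≡ 1) (proj₂ (proj₂ (outer-profile 63≤i i<315) q<63) (trans (sym (lx q<63)) xy))
                  (trans (sym (dist F q<63 h<63)) dy)) not-near
        ... | inj₂ ab with type-at {φ} {y} F ab h<63 dy
        ...   | inj₁ clone = contradiction far-clone
                  (Far-absurd {label i} {map suc (row h)} {λ p → d x (φ p)} {λ p → d y (φ p)} lx
                    (λ {p} p<63 → trans (clone p<63) (sym (nth-map-suc (row h) (subst (p <_) (sym (length-row h)) p<63))))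
                    (adjacent-close xy))
        ...   | inj₂ (k , k∈ , ly) with All.lookup far-labels k∈
        ...     | inj₁ refl = y , xy , ly
        ...     | inj₂ far = contradiction far
                    (Far-absurd {label i} {label k} {λ p → d x (φ p)} {λ p → d y (φ p)} lx ly (adjacent-close xy))

    -- Which label occurs first in `N` is not known in advance; comparing each with 63 lets one
    -- connectivity computation serve all of them.
    Equi : ℕ → Set
    Equi j = (Real j → Real 63) × (Real 63 → Real j)

    opaque
      equi-step : ∀ {i j} → 63 ≤ i → i < 315 → 63 ≤ j → j < 315 → Edge i j → Edge j i → Equi i → Equi j
      equi-step a b c e ij ji (to , from) =
        (λ (x , lx) → to (let y , _ , ly = edge c e ji lx in y , ly)) ,
        (λ r → let x , lx = from r ; y , _ , ly = edge a b ij lx in y , ly)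

      equi-lines : All (Linked-by Equi) outerLines
      equi-lines = All.tabulate λ {t} t∈ → on t t∈ (All.lookup outerLines-complete t∈)
        where
        on : ∀ t → t ∈ outerLines → Complete t → Linked-by Equi t
        on (a , b , c) t∈ ((ab , ac) , (ba , bc) , (ca , cb)) =
          (λ e → equi-step 63≤a a< 63≤b b< ab ba e , equi-step 63≤a a< 63≤c c< ac ca e) ,
          (λ e → equi-step 63≤b b< 63≤a a< ba ab e , equi-step 63≤b b< 63≤c c< bc cb e) ,
          (λ e → equi-step 63≤c c< 63≤a a< ca ac e , equi-step 63≤c c< 63≤b b< cb bc e)
          where
          ok : LineOK (a , b , c)
          ok = All.lookup lines-ok (proj₁ (outerLines⊆ t∈))
          63≤a : 63 ≤ a
          63≤a = proj₂ (outerLines⊆ t∈)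
          63≤b : 63 ≤ b
          63≤b = ℕ.≤-trans 63≤a (ℕ.<⇒≤ (proj₁ ok))
          63≤c : 63 ≤ c
          63≤c = ℕ.≤-trans 63≤b (ℕ.<⇒≤ (proj₁ (proj₂ ok)))
          c< : c < 315
          c< = proj₁ (proj₂ (proj₂ ok))
          b< : b < 315
          b< = ℕ.<-trans (proj₁ (proj₂ ok)) c<
          a< : a < 315
          a< = ℕ.<-trans (proj₁ ok) b<

      equi : ∀ {j} → 63 ≤ j → j < 315 → Equi j
      equi 63≤j j<315 with all<315 all-reached j<315
      ... | inj₁ j<63 = contradiction j<63 (ℕ.≤⇒≯ 63≤j)
      ... | inj₂ j∈ = All.lookup (reached-sound {Equi} equi-lines ((λ r → r) , λ r → r)) j∈

      real : ∀ {b} → 63 ≤ b → b < 315 → Real b → ∀ {j} → j < 315 → Real j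
      real 63≤b b<315 r {j} j<315 with 63 ℕ.≤? j
      ... | yes 63≤j = proj₂ (equi 63≤j j<315) (proj₁ (equi 63≤b b<315) r)
      ... | no ¬63≤j = φ (base j) , subst (HasLabel φ (φ (base j))) (proj₁ (inner-profile (ℕ.≰⇒> ¬63≤j))) (foot-label (base<63 j<315))

  module Iso {φ : ℕ → Point} (F : Frame φ) (realised : ∀ {j} → j < 315 → ∃ λ x → HasLabel φ x j) where
    open Realise F

    opaque
      θ : ℕ → Point
      θ j with j ℕ.<? 315
      ... | yes j<315 = proj₁ (realised j<315)
      ... | no _ = φ 0

      θ-label : ∀ {j} → j < 315 → HasLabel φ (θ j) j
      θ-label {j} j<315 with j ℕ.<? 315
      ... | yes p = proj₂ (realised p)
      ... | no n = contradiction j<315 n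

    opaque
      same-label : ∀ {x i j} → i < 315 → j < 315 → HasLabel φ x i → HasLabel φ x j → i ≡ j
      same-label i< j< li lj = label-injective i< j< λ p<63 → trans (sym (li p<63)) (lj p<63)

      θ-injective : ∀ {i j} → i < 315 → j < 315 → θ i ≡ θ j → i ≡ j
      θ-injective {i} {j} i< j< e = same-label i< j< (θ-label i<) (subst (λ x → HasLabel φ x j) (sym e) (θ-label j<))

      neighbours<315 : ∀ {i} → i < 315 → All (_< 315) (neighbours i)
      neighbours<315 i< = All.map proj₁ (proj₂ (proj₂ (all<315 neighbours-ok i<)))

      θ-apart : ∀ {qs} → All (_< 315) qs → Unique qs → AllPairs _≢_ (map θ qs)
      θ-apart [] [] = []
      θ-apart (b ∷ bs) (ne ∷ u) = All-map⁺ (All.zipWith (λ (c , q≢) e → q≢ (θ-injective b c e)) (bs , ne)) ∷ θ-apart bs u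

      neighbour-label : ∀ {x i y} → i < 315 → (∀ {q} → q ∈ neighbours i → Adj x (θ q)) → Adj x y →
                        ∃ λ q → q ∈ neighbours i × y ≡ θ q
      neighbour-label {x} {i} i< adj xy =
        let ten , unique , _ = all<315 neighbours-ok i<
        in ∈-map⁻ θ (Neighbours.all-neighbours x (map θ (neighbours i)) (All-map⁺ (All.tabulate adj))
             (θ-apart (neighbours<315 i<) unique) (trans (length-map θ (neighbours i)) ten) xy)

      -- The ten points `θ q` with `q` a neighbour of the foot exhaust the neighbours of `φ h`, so
      -- an outer `x` is among them, and its label tells which.
      is-θ : ∀ {x j} → j < 315 → HasLabel φ x j → x ≡ θ j
      is-θ {x} {j} j< lx = cases (all<315 over-neighbours j<)
        where
        h : ℕ
        h = base j
        h<63 : h < 63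
        h<63 = base<63 j<
        f< : foot h < 315
        f< = <63⇒<315 (foot<63 h<63)

        adj : ∀ {q} → q ∈ neighbours (foot h) → Adj (φ h) (θ q)
        adj {q} q∈ =
          let q< , at = All.lookup (proj₂ (proj₂ (all<315 neighbours-ok f<))) q∈
          in Adj-sym (trans (θ-label q< h<63) (trans (cong (nth (label q)) (sym (base-foot h<63))) (at (foot<63 h<63))))

        cases : j < 63 ⊎ j ∈ neighbours (foot h) → x ≡ θ j
        cases (inj₁ j<63) = trans (inner j<63 lx) (sym (inner j<63 (θ-label j<)))
        cases (inj₂ _) with 63 ℕ.≤? j
        ... | no ¬63≤j = trans (inner (ℕ.≰⇒> ¬63≤j) lx) (sym (inner (ℕ.≰⇒> ¬63≤j) (θ-label j<)))
        ... | yes 63≤j =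
          let q , q∈ , x≡ = neighbour-label f< adj (Adj-sym (trans (lx h<63) (proj₁ (outer-profile 63≤j j<))))
              q< = All.lookup (neighbours<315 f<) q∈
          in trans x≡ (cong θ (same-label q< j< (θ-label q<) (subst (λ y → HasLabel φ y j) x≡ lx)))

      -- For an outer line, `edge` gives a neighbour of `θ a` with label `b`, which must be `θ b`;
      -- on a line meeting the copy, the label of `b` shows adjacency directly. The label of the
      -- third point is then forced to be `c`.
      line-at : ∀ {a b c} → (a , b , c) ∈ hjLines → Line₃ (θ a) (θ b) (θ c)
      line-at {a} {b} {c} t∈ = finish (All.lookup lines-ok t∈)
        where
        finish : LineOK (a , b , c) → Line₃ (θ a) (θ b) (θ c)
        finish (a<b , b<c , c< , join , thirds) = close (line-of (joined join))
          where
          b< : b < 315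
          b< = ℕ.<-trans b<c c<
          a< : a < 315
          a< = ℕ.<-trans a<b b<

          joined : a < 63 × nth (label b) (base a) ≡ 1 ⊎ 63 ≤ a × Edge a b → Adj (θ a) (θ b)
          joined (inj₁ (a<63 , e)) = Adj-sym (trans (cong (d (θ b)) (inner a<63 (θ-label a<))) (trans (θ-label b< (base<63 a<)) e))
          joined (inj₂ (63≤a , ab)) = let y , ay , ly = edge 63≤a a< ab (θ-label a<) in subst (Adj (θ a)) (is-θ b< ly) ay

          close : (∃ λ z → Line₃ (θ a) (θ b) z) → Line₃ (θ a) (θ b) (θ c)
          close (z , ℓ) = subst (Line₃ (θ a) (θ b)) (is-θ c< λ {p} p<63 →
            trans (sym (Near⇒third (near′ ℓ (φ p)))) (trans (cong₂ third (θ-label a< p<63) (θ-label b< p<63)) (label-third thirds p<63))) ℓ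

      on-line : ∀ {a b c q} (ℓ : Line₃ (θ a) (θ b) (θ c)) → q ∈₃ (a , b , c) → inc (θ q) (through ℓ) ≡ true
      on-line ℓ (inj₁ refl) = on₁ ℓ
      on-line ℓ (inj₂ (inj₁ refl)) = on₂ ℓ
      on-line ℓ (inj₂ (inj₂ refl)) = on₃ ℓ

      triple-bounds : ∀ {a b c q} → (a , b , c) ∈ hjLines → q ∈₃ (a , b , c) → q < 315
      triple-bounds t∈ q∈ with All.lookup lines-ok t∈
      triple-bounds t∈ (inj₁ refl) | a<b , b<c , c< , _ = ℕ.<-trans a<b (ℕ.<-trans b<c c<)
      triple-bounds t∈ (inj₂ (inj₁ refl)) | a<b , b<c , c< , _ = ℕ.<-trans b<c c<
      triple-bounds t∈ (inj₂ (inj₂ refl)) | a<b , b<c , c< , _ = c<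

      labelled-adjacent : ∀ {i q} → q ∈ neighbours i → Adj (θ i) (θ q)
      labelled-adjacent {i} {q} q∈ with neighbours⁻ {i} {q} q∈
      ... | t@(a , b , c) , t∈ , o with companions⇒OnTriple {i} {q} t o | All.lookup lines-ok t∈
      ...   | on-triple i∈ q∈′ ne | a<b , b<c , _ =
        let ℓ = line-at t∈
            i≢q = ne (ℕ.<⇒≢ a<b) (ℕ.<⇒≢ (ℕ.<-trans a<b b<c)) (ℕ.<⇒≢ b<c)
        in Collinear⇒Adj (through ℓ , on-line ℓ i∈ , on-line ℓ q∈′)
             (λ e → i≢q (θ-injective (triple-bounds t∈ i∈) (triple-bounds t∈ q∈′) e))

      -- Each `θ i` has all its ten neighbours among the points `θ q`, so by connectedness there are
      -- no others.
      labelled : ∀ x → ∃ λ j → j < 315 × x ≡ θ j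
      labelled x = go _ x refl
        where
        go : ∀ n x → d x (φ 0) ≡ n → ∃ λ j → j < 315 × x ≡ θ j
        go zero x e = foot 0 , f< , trans (d≡0⇒≡ e) (is-θ f< (foot-label (s≤s z≤n)))
          where
          f< : foot 0 < 315
          f< = <63⇒<315 (foot<63 (s≤s z≤n))
        go (suc n) x e with neighbour-towards {x} {φ 0} e
        ... | y , xy , dy with go n y dy
        ...   | i , i< , refl =
          let q , q∈ , x≡ = neighbour-label {θ i} i< (λ {q} → labelled-adjacent {i} {q}) (Adj-sym xy)
          in q , All.lookup (neighbours<315 i<) q∈ , x≡

    opaque
      position : Point → Fin 315
      position x = fromℕ< (proj₁ (proj₂ (labelled x)))

      θ-position : ∀ x → θ (toℕ (position x)) ≡ x
      θ-position x =
        let j , j< , e = labelled x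
        in trans (cong θ (Fin.toℕ-fromℕ< j<)) (sym e)

      position-θ : ∀ i → position (θ (toℕ i)) ≡ i
      position-θ i = Fin.toℕ-injective (θ-injective (Fin.toℕ<n _) (Fin.toℕ<n i) (θ-position (θ (toℕ i))))

      line₃-of : ∀ l → Line₃ (θ (proj₁ (hjLine l))) (θ (proj₁ (proj₂ (hjLine l)))) (θ (proj₂ (proj₂ (hjLine l))))
      line₃-of l = line-at (hjLine∈ l)

    opaque
      image : Fin 525 → Line
      image l = through (line₃-of l)

      on-image : ∀ l {q} → q ∈₃ hjLine l → inc (θ q) (image l) ≡ true
      on-image l = on-line (line₃-of l)

      image-points : ∀ l {q} → q < 315 → inc (θ q) (image l) ≡ true → q ∈₃ hjLine l
      image-points l {q} q< qL = pick (line₃-cover (line₃-of l) qL)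
        where
        within : ∀ {r} → r ∈₃ hjLine l → θ q ≡ θ r → q ≡ r
        within r∈ = θ-injective q< (triple-bounds (hjLine∈ l) r∈)

        pick : (θ q ≡ θ (proj₁ (hjLine l))) ⊎ (θ q ≡ θ (proj₁ (proj₂ (hjLine l)))) ⊎ (θ q ≡ θ (proj₂ (proj₂ (hjLine l)))) →
               q ∈₃ hjLine l
        pick (inj₁ e) = inj₁ (within (inj₁ refl) e)
        pick (inj₂ (inj₁ e)) = inj₂ (inj₁ (within (inj₂ (inj₁ refl)) e))
        pick (inj₂ (inj₂ e)) = inj₂ (inj₂ (within (inj₂ (inj₂ refl)) e))

      image-injective : ∀ l m → image l ≡ image m → l ≡ m
      image-injective l m e = key-injective l m (increasing-key {hjLine l} {hjLine m} (increasing l) (increasing m)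
        λ {q} q∈ → image-points m (triple-bounds (hjLine∈ l) q∈) (subst (λ L → inc (θ q) L ≡ true) e (on-image l q∈)))
        where
        increasing : ∀ l → Increasing (hjLine l)
        increasing l = let a<b , b<c , _ = All.lookup lines-ok (hjLine∈ l) in a<b , b<c

      -- Two points of `L` are neighbours, hence come from a line of the table, whose image shares
      -- both with `L`.
      preimage : ∀ L → ∃ λ l → image l ≡ L
      preimage L = go (labelled x)
        where
        x y : Point
        x = OnLine.point L zero
        y = OnLine.point L (suc zero)

        x≢y : x ≢ y
        x≢y e with OnLine.point-injective L zero (suc zero) e
        ... | ()

        xy : Adj x y
        xy = Collinear⇒Adj (L , OnLine.point-on L zero , OnLine.point-on L (suc zero)) x≢y

        go : (∃ λ i → i < 315 × x ≡ θ i) → ∃ λ l → image l ≡ L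
        go (i , i< , x≡) =
          let q , q∈ , y≡ = neighbour-label {θ i} i< (λ {q} → labelled-adjacent {i} {q}) (subst (λ u → Adj u y) x≡ xy)
              t , t∈ , q∈t = neighbours⁻ {i} {q} q∈
              on-triple i∈ q∈′ _ = companions⇒OnTriple {i} {q} t q∈t
              l , t≡ = hjLine-surjective t∈
              xL = subst (λ u → inc u (image l) ≡ true) (sym x≡) (on-image l (subst (i ∈₃_) t≡ i∈))
              yL = subst (λ u → inc u (image l) ≡ true) (sym y≡) (on-image l (subst (q ∈₃_) t≡ q∈′))
          in l , linear x y (image l) L x≢y xL yL (OnLine.point-on L zero) (OnLine.point-on L (suc zero))

    isomorphism : Isomorphism N HJ
    isomorphism = record
      { onPoints = mk↔ₛ′ position (λ i → θ (toℕ i)) position-θ θ-position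
      ; onLines = mk↔ₛ′ (λ L → proj₁ (preimage L)) image
          (λ l → image-injective _ l (proj₂ (preimage (image l)))) (λ L → proj₂ (preimage L))
      ; inc-eq = λ p L → ≡-from-⇔
          (λ pL → hjLine⇒inc (position p) (proj₁ (preimage L)) (image-points (proj₁ (preimage L)) (Fin.toℕ<n (position p))
            (subst₂ (λ u M → inc u M ≡ true) (sym (θ-position p)) (sym (proj₂ (preimage L))) pL)))
          (λ e → subst₂ (λ u M → inc u M ≡ true) (θ-position p) (proj₂ (preimage L))
            (on-image (proj₁ (preimage L)) (inc⇒hjLine (position p) (proj₁ (preimage L)) e)))
      }

  NonClone : (ℕ → Point) → Set
  NonClone φ = ∃ λ h → h < 63 × ∃ λ b → b ∈ above h × ∃ λ z → HasLabel φ z b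

  -- The case distinction is made decidable by a finite search: the points on the five lines through
  -- each point of the copy are tested against the four labels there.
  nonClone? : ∀ {φ} → Frame φ → NonClone φ ⊎ AllClones φ
  nonClone? {φ} F = go (ℕ.anyUpTo? labelled-neighbour? 63)
    where
    neighbour : ℕ → Fin 5 → Fin 3 → Point
    neighbour h i j = OnLine.point (Through.line (φ h) i) j

    hasLabel? : ∀ z b → Dec (HasLabel φ z b)
    hasLabel? z b = ℕ.allUpTo? (λ p → d z (φ p) ℕ.≟ nth (label b) p) 63

    LabelledNeighbour : ℕ → Set
    LabelledNeighbour h = ∃ λ i → ∃ λ j → Any (HasLabel φ (neighbour h i j)) (above h)

    labelled-neighbour? : ∀ h → Dec (LabelledNeighbour h)
    labelled-neighbour? h = Fin.any? λ i → Fin.any? λ j → any? (hasLabel? (neighbour h i j)) (above h)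

    go : Dec (∃ λ h → h < 63 × LabelledNeighbour h) → NonClone φ ⊎ AllClones φ
    go (yes (h , h<63 , i , j , any)) = let b , b∈ , l = find any in inj₁ (h , h<63 , b , b∈ , _ , l)
    go (no none) = inj₂ λ {z} {h} ab h<63 dz → clone {z} {h} h<63 dz (type-at {φ} {z} F ab h<63 dz)
      where
      clone : ∀ {z h} → h < 63 → d z (φ h) ≡ 1 → Clone 1 φ z h ⊎ (∃ λ b → b ∈ above h × HasLabel φ z b) → Clone 1 φ z h
      clone _ _ (inj₁ c) = c
      clone {z} {h} h<63 dz (inj₂ (b , b∈ , l)) =
        let i , j , e = neighbour-index {φ h} {z} (Adj-sym dz)
        in contradiction (h , h<63 , i , j , lose {P = HasLabel φ (neighbour h i j)} b∈ (transport e (λ {p} → l {p}))) none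
        where
        transport : ∀ {u b} → u ≡ z → HasLabel φ z b → HasLabel φ u b
        transport refl l = l

theorem1p2 : (N : Geometry) → IsNearOctagon N → HasOrder N 2 4
    → IsometricSubgeometry H2D N → Isomorphism N HJ
theorem1p2 N oct order S = cases (nonClone? frame₀)
  where
  open Embedded N oct order S using (φ; frame₀)
  open Labelled N oct order
  open Outer N oct order using (AllClones)

  cases : NonClone φ ⊎ AllClones φ → Isomorphism N HJ
  cases (inj₂ clones) = ⊥-elim (Clones.AllOver.no-clones N oct order (frame₀ , λ {z} {h} → clones {z} {h}))
  cases (inj₁ (h , h<63 , b , b∈ , z , l)) =
    let 63≤b , b<315 = All.lookup (all<63 above-reached h<63) b∈
    in Iso.isomorphism frame₀ (Realise.real frame₀ 63≤b b<315 (z , l))
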